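{- Let $G$ be an $(s,k)$-edge-connected graph such that $k\geq 2$ and $\deg(s)>4$. Then: (i) If $L(G,s,k)$ is disconnected, then $\deg(s)$ is odd and $L(G,s,k)$ is the disjoint union of an isolated vertex and a balanced complete bipartite graph. (ii) If $k$ is even, then $L(G,s,k)$ is either a complete multipartite graph or the disjoint union of an isolated vertex and a balanced complete bipartite graph. (iii) If the complement of $L(G,s,k)$ is connected, then this complement is either a Hamilton cycle or two cliques of the same size joined by a path, and $k$ is odd except possibly when $L(G,s,k)$ is as in (i) (where $k$ may be even or odd). Moreover, $G$ has an $(s,r)$-cycle structure or an $(s,r)$-path structure (correspondingly), where $r=(k-1)/2$, except possibly when $L(G,s,k)$ is as in (i), in which case only $r\geq (k-1)/2$ is asserted. Furthermore, the subgraph of $G$ induced by each blob of this structure is $\lceil k/2\rceil$-edge-connected, except possibly the middle blob (of the three blobs) when $L(G,s,k)$ is as in (i).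
   Context: All graphs are finite loopless multigraphs. For $X\subseteq V(G)$, $\delta(X)$ is the set of edges with exactly one end in $X$. A graph $G$ is $(s,k)$-edge-connected if $G$ has at least three vertices, $s$ is a vertex of $G$, $k$ is a positive integer, and any two vertices of $G$ both different from $s$ are joined by $k$ pairwise edge-disjoint paths in $G$ (these paths may pass through $s$). Lifting two edges $sv,sw$ incident with $s$ means deleting them and adding a new edge $vw$ if $v\neq w$, and only deleting them if $v=w$ (parallel edges); call the result $G_{v,w}$. Edges $sv,sw$ form a $k$-liftable pair if $G_{v,w}$ is $(s,k)$-edge-connected. The $k$-lifting graph $L(G,s,k)$ has as vertices the edges of $G$ incident with $s$, two being adjacent iff they form a $k$-liftable pair. Path/cycle structure: let $r\geq 1$, $n\geq 3$, and suppose $G-s$ has pairwise disjoint subgraphs $H_0,\dots,H_{n-1}$ (the blobs) whose vertex sets cover $V(G-s)$. $G$ has an $(s,r)$-cycle structure if for every $i=0,\dots,n-1$, $\delta(H_i)$ consists of exactly $2r+1$ edges: one edge with other end $s$, $r$ edges with other ends in $H_{i-1}$ and $r$ edges with other ends in $H_{i+1}$ (indices mod $n$). $G$ has an $(s,r)$-path structure if the same holds for every $i=1,\dots,n-2$ (no condition is imposed on $H_0$ and $H_{n-1}$). "Two cliques joined by a path" allows the path to have length $0$ (the two cliques share a vertex). -}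

module Defs where

open import Data.Nat using (ℕ; zero; suc; _+_; _*_; _∸_; _≤_; _<_; _≡ᵇ_)
open import Data.Bool using (Bool; true; false; _∧_; _∨_; _xor_; if_then_else_)
open import Data.Fin using (Fin; toℕ; _≟_)
open import Data.Fin.Permutation using (Permutation′; _⟨$⟩ʳ_)
open import Data.List using (List; []; _∷_; _++_; length; lookup; filterᵇ; allFin)
open import Data.List.Relation.Unary.All using (All)
open import Data.List.Relation.Unary.Unique.Propositional using (Unique)
open import Data.List.Membership.Propositional using (_∈_)
open import Data.Maybe using (Maybe; just; nothing)
open import Data.Product using (Σ; _×_; _,_; proj₁; proj₂)
open import Data.Sum using (_⊎_)
open import Data.Unit using (⊤)
open import Data.Empty using (⊥)
open import Relation.Nullary using (¬_)
open import Relation.Nullary.Decidable using (⌊_⌋)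
open import Relation.Binary.PropositionalEquality using (_≡_; _≢_)
open import Relation.Binary.Construct.Closure.ReflexiveTransitive using (Star)
open import Function.Bundles using (_⇔_)

Even : ℕ → Set
Even n = Σ ℕ λ m → n ≡ 2 * m

Odd : ℕ → Set
Odd n = Σ ℕ λ m → n ≡ suc (2 * m)

-- Finite multigraphs: vertex set Fin n, edges a list of endpoint pairs.
-- The identity of an edge is its position in the list (so parallel
-- edges are distinct edges).

record Graph : Set where
  constructor mkGraph
  field
    n     : ℕ
    edges : List (Fin n × Fin n)

open Graph public

Edge : Graph → Set
Edge G = Fin (length (edges G))

ends : (G : Graph) → Edge G → Fin (n G) × Fin (n G)
ends G e = lookup (edges G) e

Loopless : Graph → Set
Loopless G = (e : Edge G) → proj₁ (ends G e) ≢ proj₂ (ends G e)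

Joins : (G : Graph) → Edge G → Fin (n G) → Fin (n G) → Set
Joins G e u w = (ends G e ≡ (u , w)) ⊎ (ends G e ≡ (w , u))

data Walk (G : Graph) : Fin (n G) → Fin (n G) → Set where
  stop : ∀ {u} → Walk G u u
  step : ∀ {u w v} (e : Edge G) → Joins G e u w → Walk G w v → Walk G u v

walkVerts : ∀ {G u v} → Walk G u v → List (Fin (n G))
walkVerts {u = u} stop = u ∷ []
walkVerts {u = u} (step e j p) = u ∷ walkVerts p

walkEdges : ∀ {G u v} → Walk G u v → List (Edge G)
walkEdges stop = []
walkEdges (step e j p) = e ∷ walkEdges p

Path : (G : Graph) → Fin (n G) → Fin (n G) → Set
Path G u v = Σ (Walk G u v) λ w → Unique (walkVerts w)

EdgeDisjointPaths : (G : Graph) → (Fin (n G) → Set) → ℕ → Fin (n G) → Fin (n G) → Set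
EdgeDisjointPaths G Inside l u v =
  Σ (Fin l → Path G u v) λ P →
    ((i : Fin l) → All Inside (walkVerts (proj₁ (P i)))) ×
    ((i j : Fin l) → i ≢ j → (e : Edge G) →
       e ∈ walkEdges (proj₁ (P i)) → e ∈ walkEdges (proj₁ (P j)) → ⊥)

SKEdgeConnected : (G : Graph) → Fin (n G) → ℕ → Set
SKEdgeConnected G s k =
  3 ≤ n G × 1 ≤ k ×
  ((u v : Fin (n G)) → u ≢ s → v ≢ s → u ≢ v →
     EdgeDisjointPaths G (λ _ → ⊤) k u v)

-- the subgraph of G induced by the vertex set X is l-edge-connected
-- (paths in the induced subgraph = paths all of whose vertices lie in X)
InducedEdgeConnected : (G : Graph) → (Fin (n G) → Bool) → ℕ → Set
InducedEdgeConnected G X l =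
  (u v : Fin (n G)) → X u ≡ true → X v ≡ true → u ≢ v →
    EdgeDisjointPaths G (λ w → X w ≡ true) l u v

incidentᵇ : {m : ℕ} → Fin m → Fin m × Fin m → Bool
incidentᵇ s (a , b) = ⌊ a ≟ s ⌋ ∨ ⌊ b ≟ s ⌋

otherEnd : {m : ℕ} → Fin m → Fin m × Fin m → Fin m
otherEnd s (a , b) = if ⌊ a ≟ s ⌋ then b else a

deleteTwo : {A : Set} → ℕ → ℕ → ℕ → List A → List A
deleteTwo i j p [] = []
deleteTwo i j p (x ∷ xs) =
  if (p ≡ᵇ i) ∨ (p ≡ᵇ j) then deleteTwo i j (suc p) xs
  else x ∷ deleteTwo i j (suc p) xs

newEdge : {m : ℕ} → Fin m → Fin m → List (Fin m × Fin m)
newEdge v w = if ⌊ v ≟ w ⌋ then [] else ((v , w) ∷ [])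

lift : (G : Graph) → Fin (n G) → Edge G → Edge G → Graph
lift G s e f =
  mkGraph (n G)
    (deleteTwo (toℕ e) (toℕ f) 0 (edges G)
      ++ newEdge (otherEnd s (ends G e)) (otherEnd s (ends G f)))

Liftable : (G : Graph) → Fin (n G) → ℕ → Edge G → Edge G → Set
Liftable G s k e f =
  e ≢ f × incidentᵇ s (ends G e) ≡ true × incidentᵇ s (ends G f) ≡ true ×
  SKEdgeConnected (lift G s e f) s k

incEdges : (G : Graph) → Fin (n G) → List (Edge G)
incEdges G s = filterᵇ (λ e → incidentᵇ s (ends G e)) (allFin (length (edges G)))

deg : (G : Graph) → Fin (n G) → ℕ
deg G s = length (incEdges G s)

LiftGraph : (G : Graph) → (s : Fin (n G)) → ℕ → Fin (deg G s) → Fin (deg G s) → Set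
LiftGraph G s k x y = Liftable G s k (lookup (incEdges G s) x) (lookup (incEdges G s) y)

Connected : (d : ℕ) → (Fin d → Fin d → Set) → Set
Connected d A = (x y : Fin d) → Star A x y

Complement : (d : ℕ) → (Fin d → Fin d → Set) → Fin d → Fin d → Set
Complement d A x y = x ≢ y × ¬ A x y

countᶠ : (d : ℕ) → (Fin d → Bool) → ℕ
countᶠ d p = length (filterᵇ p (allFin d))

IsolatedPlusBalancedBipartite : (d : ℕ) → (Fin d → Fin d → Set) → Set
IsolatedPlusBalancedBipartite d A =
  Σ (Fin d) λ x0 → Σ (Fin d → Bool) λ side →
    ((x y : Fin d) → A x y ⇔ (x ≢ x0 × y ≢ x0 × side x ≢ side y)) ×
    countᶠ d (λ x → (Data.Bool.not ⌊ x ≟ x0 ⌋) ∧ side x)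
      ≡ countᶠ d (λ x → (Data.Bool.not ⌊ x ≟ x0 ⌋) ∧ Data.Bool.not (side x))

CompleteMultipartite : (d : ℕ) → (Fin d → Fin d → Set) → Set
CompleteMultipartite d A =
  Σ (Fin d → ℕ) λ part → (x y : Fin d) → A x y ⇔ (part x ≢ part y)

cycleAdj : ℕ → ℕ → ℕ → Set
cycleAdj d i j =
  j ≡ suc i ⊎ i ≡ suc j ⊎ (suc i ≡ d × j ≡ 0) ⊎ (suc j ≡ d × i ≡ 0)

HamiltonCycle : (d : ℕ) → (Fin d → Fin d → Set) → Set
HamiltonCycle d A =
  Σ (Permutation′ d) λ σ →
    (x y : Fin d) → A x y ⇔ cycleAdj d (toℕ (σ ⟨$⟩ʳ x)) (toℕ (σ ⟨$⟩ʳ y))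

-- on positions 0..d-1: clique on {0..a-1}, clique on {d-a..d-1},
-- and the path a-1, a, ..., d-a (of length d+1-2a ≥ 0)
twoCliquesAdj : ℕ → ℕ → ℕ → ℕ → Set
twoCliquesAdj d a i j =
  i ≢ j ×
  ((i < a × j < a) ⊎ (d ∸ a ≤ i × d ∸ a ≤ j) ⊎
   (a ∸ 1 ≤ i × j ≡ suc i × j ≤ d ∸ a) ⊎
   (a ∸ 1 ≤ j × i ≡ suc j × i ≤ d ∸ a))

TwoCliquesJoinedByPath : (d : ℕ) → (Fin d → Fin d → Set) → Set
TwoCliquesJoinedByPath d A =
  Σ ℕ λ a → 1 ≤ a × a + a ≤ suc d ×
  Σ (Permutation′ d) λ σ →
    (x y : Fin d) → A x y ⇔ twoCliquesAdj d a (toℕ (σ ⟨$⟩ʳ x)) (toℕ (σ ⟨$⟩ʳ y))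

BlobAssignment : (G : Graph) → Fin (n G) → ℕ → Set
BlobAssignment G s nb =
  Σ (Fin (n G) → Maybe (Fin nb)) λ β → (v : Fin (n G)) → (β v ≡ nothing) ⇔ (v ≡ s)

inBlob : {m nb : ℕ} → (Fin m → Maybe (Fin nb)) → ℕ → Fin m → Bool
inBlob β j v with β v
... | just i  = toℕ i ≡ᵇ j
... | nothing = false

between : (G : Graph) → (Fin (n G) → Bool) → (Fin (n G) → Bool) → ℕ
between G X Y = length (filterᵇ (λ ab → (X (proj₁ ab) ∧ Y (proj₂ ab)) ∨ (X (proj₂ ab) ∧ Y (proj₁ ab))) (edges G))

boundary : (G : Graph) → (Fin (n G) → Bool) → ℕ
boundary G X = length (filterᵇ (λ ab → X (proj₁ ab) xor X (proj₂ ab)) (edges G))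

BlobCondition : (G : Graph) → Fin (n G) → ℕ → {nb : ℕ} → (Fin (n G) → Maybe (Fin nb)) →
                ℕ → ℕ → ℕ → Set
BlobCondition G s r β i prev next =
  boundary G (inBlob β i) ≡ suc (2 * r) ×
  between G (inBlob β i) (λ v → ⌊ v ≟ s ⌋) ≡ 1 ×
  between G (inBlob β i) (inBlob β prev) ≡ r ×
  between G (inBlob β i) (inBlob β next) ≡ r

predMod : ℕ → ℕ → ℕ
predMod nb zero = nb ∸ 1
predMod nb (suc i) = i

succMod : ℕ → ℕ → ℕ
succMod nb i = if suc i ≡ᵇ nb then 0 else suc i

CycleStructure : (G : Graph) → Fin (n G) → ℕ → (nb : ℕ) → (Fin (n G) → Maybe (Fin nb)) → Set
CycleStructure G s r nb β =
  1 ≤ r × 3 ≤ nb × ((i : ℕ) → i < nb → BlobCondition G s r β i (predMod nb i) (succMod nb i))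

PathStructure : (G : Graph) → Fin (n G) → ℕ → (nb : ℕ) → (Fin (n G) → Maybe (Fin nb)) → Set
PathStructure G s r nb β =
  1 ≤ r × 3 ≤ nb × ((i : ℕ) → 1 ≤ i → suc i < nb → BlobCondition G s r β i (i ∸ 1) (suc i))

StructureClaim : (G : Graph) → (s : Fin (n G)) → ℕ →
                 ((r nb : ℕ) → (Fin (n G) → Maybe (Fin nb)) → Set) → Set → Set
StructureClaim G s k Str caseI =
  Σ ℕ λ r → Σ ℕ λ nb → Σ (BlobAssignment G s nb) λ B →
    Str r nb (proj₁ B) ×
    (( k ≡ suc (2 * r) ×
       ((i : ℕ) → i < nb → InducedEdgeConnected G (inBlob (proj₁ B) i) Data.Nat.⌈ k /2⌉))
     ⊎
     ( caseI × k ≤ suc (2 * r) × nb ≡ 3 ×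
       ((i : ℕ) → i < nb → i ≢ 1 → InducedEdgeConnected G (inBlob (proj₁ B) i) Data.Nat.⌈ k /2⌉)))

{-# OPTIONS --safe #-}
module Submission where

-- By Menger's theorem two edges at s fail to form a liftable pair exactly when their ends lie in a
-- common dangerous set: a set X avoiding s, missing some other vertex, with at most k + 1 boundary
-- edges. Two incomparable dangerous sets X, Y that share an end of an edge at s share only that
-- one; their differences are tight (k boundary edges), and X ∩ Y sends equally many edges to X ─ Y
-- and Y ─ X and one to s.
-- If two such sets contain the ends of all edges at s ("special"), they cover everything but s and
-- L is an isolated vertex plus a balanced complete bipartite graph, with blobs X ─ Y, X ∩ Y, Y ─ X.
-- Otherwise the intersection of two maximal dangerous sets ("lines") sharing an end is tight, which
-- forces k to be odd. Hence for even k being in a common line is an equivalence relation. In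
-- general an edge at s lies in at most two lines, and a line two of whose edges lie in further
-- lines contains only these two. So if the complement of L is connected, the lines form a cycle or
-- a path; the blobs are the intersections of consecutive lines and, for a path, what remains of the
-- two end lines. They are disjoint because tight sets cannot cross when k is odd, and their edges
-- are accounted for by counting.

-- Why two cases: submodularity bounds `δ (X ∩ Y)` by `k` only if `δ (X ∪ Y)` is at least `k + 2`,
-- and for maximal dangerous sets this is known only when the union misses the end of some edge at
-- `s`, since otherwise it need not be a candidate for a dangerous set. When the union holds all
-- these ends, `δ (X ∩ Y)` is an odd number at least `k` and possibly larger. This is why `k` may be
-- even there, why `r` is only bounded below, and why nothing is asserted about the connectivity of
-- the middle blob. The degree of `s` enters through one inequality: the vertices outside a
-- dangerous set and `s` form another cut, so a dangerous set holds at most half of `d + 1` edges at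
-- `s`. The bound `d > 4` is also what stops two lines with two edges each from holding everything.
-- The argument is constructive: each case distinction is a search through finitely many vertices,
-- edges or vertex sets. Inequalities between cuts are checked on one edge at a time, according to
-- the regions of its ends, and are then combined by linear arithmetic; both are evaluated during
-- type checking.

open import Defs
open import Data.Nat hiding (_≟_)
open import Data.Nat.Properties hiding (_≟_)
import Data.Nat.Properties as ℕ
open import Data.Nat.Solver using (module +-*-Solver)
open import Data.Bool using (Bool; true; false; T; not; _∧_; _∨_; _xor_; if_then_else_)
import Data.Bool.Properties as Bool
open import Data.Bool.Properties using (T-∧; T-≡; T?)
open import Data.Empty using (⊥; ⊥-elim)
open import Data.Fin using (Fin; zero; suc; toℕ; _≟_; inject≤; cast; fromℕ<)
open import Data.Fin.Permutation using (Permutation′; permutation; _⟨$⟩ʳ_)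
open import Data.Fin.Properties using (any?; all?; ¬∀⟶∃¬; injective⇒≤; inject≤-injective; toℕ-injective; toℕ-cast; cast-involutive; toℕ<n; toℕ-fromℕ<)
open import Data.Fin.Subset.Properties using (anySubset?)
open import Data.List using (List; []; _∷_; _++_; map; length; lookup; filterᵇ; allFin; applyUpTo)
open import Data.List.Properties using (map-tabulate; tabulate-lookup; filter-++; length-++; length-tabulate; length-applyUpTo)
open import Data.List.Membership.Propositional using (_∈_; find)
open import Data.List.Membership.Propositional.Properties using (∈-∃++; ∈-lookup; ∈-filter⁺; ∈-filter⁻; ∈-allFin; ∈-++⁺ˡ; ∈-++⁺ʳ; ∈-++⁻; ∈-applyUpTo⁺; ∈-applyUpTo⁻)
open import Data.List.Relation.Binary.Permutation.Propositional as ↭ using (_↭_; prep; swap)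
open import Data.List.Relation.Binary.Permutation.Propositional.Properties using (shift; filter-↭; ↭-length; All-resp-↭)
open import Data.List.Relation.Binary.Subset.Propositional using (_⊆_)
open import Data.List.Relation.Unary.All as All using (All; []; _∷_)
import Data.List.Relation.Unary.All.Properties as All
open import Data.List.Relation.Unary.AllPairs using (AllPairs; []; _∷_)
import Data.List.Relation.Unary.AllPairs.Properties as AllPairs
open import Data.List.Relation.Unary.Any as Any using (here; there; index)
open import Data.List.Relation.Unary.Any.Properties using (lookup-index)
open import Data.List.Relation.Unary.Unique.Propositional using (Unique)
import Data.List.Relation.Unary.Unique.Propositional.Properties as Unique
open import Data.Maybe using (Maybe; just; nothing)
open import Data.Product using (Σ; ∃; _×_; _,_; proj₁; proj₂)
open import Data.Sum as Sum using (_⊎_; inj₁; inj₂; [_,_]′)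
open import Data.Unit using (⊤; tt)
open import Data.Vec using (Vec; []; _∷_)
import Data.Vec as Vec
open import Data.Vec.Properties using (lookup∘tabulate)
open import Function using (_∘_; id)
open import Function.Bundles using (Equivalence; _⇔_; mk⇔)
open import Relation.Nullary using (¬_; Dec; yes; no; contradiction)
open import Relation.Nullary.Decidable using (⌊_⌋; map′; _×-dec_; ¬?; decidable-stable; toSum)
open import Relation.Binary.Construct.Closure.ReflexiveTransitive as Star using (Star; ε; _◅_)
open import Relation.Binary.Definitions using (tri<; tri≈; tri>)
open import Relation.Binary.PropositionalEquality using (_≡_; _≢_; _≗_; refl; sym; trans; cong; cong₂; subst; subst₂; ≢-sym)

-- Linear arithmetic over ℕ by Fourier–Motzkin elimination

infixl 6 _⊕_
infixl 7 _⊛_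
infix 4 _≼_ _≐_
infixr 3 _⇒_
infix 3 ⊢_

data Term : Set where
  # : ℕ → Term
  var : ℕ → Term
  1+_ : Term → Term
  _⊕_ : Term → Term → Term
  _⊛_ : ℕ → Term → Term

data Atom : Set where
  _≼_ _≐_ : Term → Term → Atom

data Formula : Set where
  _⇒_ : Atom → Formula → Formula
  ⊢_  : Atom → Formula
  ⊢⊥  : Formula

valueAt : List ℕ → ℕ → ℕ
valueAt [] i = 0
valueAt (x ∷ ρ) zero = x
valueAt (x ∷ ρ) (suc i) = valueAt ρ i

⟦_⟧ : Term → List ℕ → ℕ
⟦ # c ⟧ ρ = c
⟦ var i ⟧ ρ = valueAt ρ i
⟦ 1+ t ⟧ ρ = suc (⟦ t ⟧ ρ)
⟦ t ⊕ u ⟧ ρ = ⟦ t ⟧ ρ + ⟦ u ⟧ ρ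
⟦ c ⊛ t ⟧ ρ = c * ⟦ t ⟧ ρ

⟦_⟧ᴬ : Atom → List ℕ → Set
⟦ t ≼ u ⟧ᴬ ρ = ⟦ t ⟧ ρ ≤ ⟦ u ⟧ ρ
⟦ t ≐ u ⟧ᴬ ρ = ⟦ t ⟧ ρ ≡ ⟦ u ⟧ ρ

⟦_⟧ᶠ : Formula → List ℕ → Set
⟦ a ⇒ f ⟧ᶠ ρ = ⟦ a ⟧ᴬ ρ → ⟦ f ⟧ᶠ ρ
⟦ ⊢ a ⟧ᶠ ρ = ⟦ a ⟧ᴬ ρ
⟦ ⊢⊥ ⟧ᶠ ρ = ⊥

-- A linear form is its list of coefficients, the constant term first.
dot : List ℕ → List ℕ → ℕ
dot [] ρ = 0
dot (c ∷ cs) [] = 0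
dot (c ∷ cs) (x ∷ ρ) = c * x + dot cs ρ

add : List ℕ → List ℕ → List ℕ
add [] ds = ds
add (c ∷ cs) [] = c ∷ cs
add (c ∷ cs) (d ∷ ds) = c + d ∷ add cs ds

scale : ℕ → List ℕ → List ℕ
scale c = map (c *_)

unit : ℕ → List ℕ
unit zero = 1 ∷ []
unit (suc i) = 0 ∷ unit i

coefficients : Term → List ℕ
coefficients (# c) = c ∷ []
coefficients (var i) = 0 ∷ unit i
coefficients (1+ t) = add (1 ∷ []) (coefficients t)
coefficients (t ⊕ u) = add (coefficients t) (coefficients u)
coefficients (c ⊛ t) = scale c (coefficients t)

dot-add : ∀ cs ds ρ → dot (add cs ds) ρ ≡ dot cs ρ + dot ds ρ
dot-add [] ds ρ = refl
dot-add (c ∷ cs) [] ρ = sym (+-identityʳ _)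
dot-add (c ∷ cs) (d ∷ ds) [] = refl
dot-add (c ∷ cs) (d ∷ ds) (x ∷ ρ) rewrite dot-add cs ds ρ =
  solve 5 (λ c d x a b → (c :+ d) :* x :+ (a :+ b) := c :* x :+ a :+ (d :* x :+ b))
    refl c d x (dot cs ρ) (dot ds ρ)
  where open +-*-Solver

dot-scale : ∀ c cs ρ → dot (scale c cs) ρ ≡ c * dot cs ρ
dot-scale c [] ρ = sym (*-zeroʳ c)
dot-scale c (d ∷ cs) [] = sym (*-zeroʳ c)
dot-scale c (d ∷ cs) (x ∷ ρ) rewrite dot-scale c cs ρ =
  solve 4 (λ c d x a → c :* d :* x :+ c :* a := c :* (d :* x :+ a)) refl c d x (dot cs ρ)
  where open +-*-Solver

dot-unit : ∀ i ρ → dot (unit i) ρ ≡ valueAt ρ i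
dot-unit zero [] = refl
dot-unit zero (x ∷ ρ) = trans (+-identityʳ _) (*-identityˡ x)
dot-unit (suc i) [] = refl
dot-unit (suc i) (x ∷ ρ) = dot-unit i ρ

dot-coefficients : ∀ t ρ → dot (coefficients t) (1 ∷ ρ) ≡ ⟦ t ⟧ ρ
dot-coefficients (# c) ρ = trans (+-identityʳ _) (*-identityʳ c)
dot-coefficients (var i) ρ = dot-unit i ρ
dot-coefficients (1+ t) ρ =
  trans (dot-add (1 ∷ []) (coefficients t) (1 ∷ ρ)) (cong suc (dot-coefficients t ρ))
dot-coefficients (t ⊕ u) ρ =
  trans (dot-add (coefficients t) (coefficients u) (1 ∷ ρ))
    (cong₂ _+_ (dot-coefficients t ρ) (dot-coefficients u ρ))
dot-coefficients (c ⊛ t) ρ =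
  trans (dot-scale c (coefficients t) (1 ∷ ρ)) (cong (c *_) (dot-coefficients t ρ))

-- Comparing coefficients is a sound test because every variable ranges over ℕ. A missing
-- coefficient counts as zero.
_≤ᶜ_ : List ℕ → List ℕ → Bool
[] ≤ᶜ ds = true
(c ∷ cs) ≤ᶜ [] = (c ≡ᵇ 0) ∧ (cs ≤ᶜ [])
(c ∷ cs) ≤ᶜ (d ∷ ds) = (c ≤ᵇ d) ∧ (cs ≤ᶜ ds)

≤ᶜ-sound : ∀ cs ds ρ → T (cs ≤ᶜ ds) → dot cs ρ ≤ dot ds ρ
≤ᶜ-sound [] ds ρ _ = z≤n
≤ᶜ-sound (c ∷ cs) ds [] _ = z≤n
≤ᶜ-sound (zero ∷ cs) [] (x ∷ ρ) p = ≤ᶜ-sound cs [] ρ p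
≤ᶜ-sound (c ∷ cs) (d ∷ ds) (x ∷ ρ) p with Equivalence.to (T-∧ {c ≤ᵇ d}) p
... | q , r = +-mono-≤ (*-monoˡ-≤ x (≤ᵇ⇒≤ c d q)) (≤ᶜ-sound cs ds ρ r)

System : Set
System = List (Term × Term)

Satisfies : List ℕ → System → Set
Satisfies ρ [] = ⊤
Satisfies ρ ((t , u) ∷ h) = ⟦ t ⟧ ρ ≤ ⟦ u ⟧ ρ × Satisfies ρ h

combine : List ℕ → System → List ℕ × List ℕ
combine (m ∷ ms) ((t , u) ∷ h) =
  add (scale m (coefficients t)) (proj₁ (combine ms h)) ,
  add (scale m (coefficients u)) (proj₂ (combine ms h))
combine _ _ = [] , []

combine-sound : ∀ ρ ms h → Satisfies ρ h →
  dot (proj₁ (combine ms h)) (1 ∷ ρ) ≤ dot (proj₂ (combine ms h)) (1 ∷ ρ)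
combine-sound ρ [] h _ = z≤n
combine-sound ρ (m ∷ ms) [] _ = z≤n
combine-sound ρ (m ∷ ms) ((t , u) ∷ h) (p , ps) =
  subst₂ _≤_ (sym (side t (proj₁ (combine ms h)))) (sym (side u (proj₂ (combine ms h))))
    (+-mono-≤ (*-monoʳ-≤ m p) (combine-sound ρ ms h ps))
  where
  side : ∀ t cs → dot (add (scale m (coefficients t)) cs) (1 ∷ ρ) ≡ m * ⟦ t ⟧ ρ + dot cs (1 ∷ ρ)
  side t cs = trans (dot-add (scale m (coefficients t)) cs (1 ∷ ρ))
    (cong (_+ dot cs (1 ∷ ρ))
      (trans (dot-scale m (coefficients t) (1 ∷ ρ)) (cong (m *_) (dot-coefficients t ρ))))

-- A Farkas certificate: the multipliers combine the system into some `l ≤ r`, while `1 + r ≤ l`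
-- holds in every coefficient.
refutes : System → List ℕ → Bool
refutes h ms = add (1 ∷ []) (proj₂ (combine ms h)) ≤ᶜ proj₁ (combine ms h)

refutes-sound : ∀ ρ h ms → T (refutes h ms) → Satisfies ρ h → ⊥
refutes-sound ρ h ms ok sat = <-irrefl refl (≤-trans
  (≤-trans (≤-reflexive (sym (dot-add (1 ∷ []) (proj₂ (combine ms h)) (1 ∷ ρ))))
    (≤ᶜ-sound (add (1 ∷ []) (proj₂ (combine ms h))) (proj₁ (combine ms h)) (1 ∷ ρ) ok))
  (combine-sound ρ ms h sat))

-- The search for multipliers needs no correctness proof, since its result is checked by refutes.
-- A row (l , r , ms) stands for the inequality l ≤ r obtained as the ms-combination of the system.
Row : Set
Row = List ℕ × List ℕ × List ℕ

cancel : List ℕ → List ℕ → List ℕ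
cancel [] ds = []
cancel (c ∷ cs) [] = c ∷ cs
cancel (c ∷ cs) (d ∷ ds) = c ∸ d ∷ cancel cs ds

zeroAt : ℕ → List ℕ → List ℕ
zeroAt i [] = []
zeroAt zero (c ∷ cs) = 0 ∷ cs
zeroAt (suc i) (c ∷ cs) = c ∷ zeroAt i cs

-- Truncated subtraction in both directions leaves each variable on at most one side of the row, and
-- this side serves as the sign of its coefficient.
rowOf : List ℕ → List ℕ → List ℕ → Row
rowOf l r ms = cancel l r , cancel r l , ms

rows : ℕ → System → List Row
rows i [] = []
rows i ((t , u) ∷ h) = rowOf (coefficients t) (coefficients u) (unit i) ∷ rows (suc i) h

-- A row with the variable on the left bounds it from above. Such a row also stays among the
-- `neutral` ones with that coefficient erased: this is its resolvent with `0 ≤ x`, which is nowhere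
-- listed as a row.
positive negative neutral : ℕ → List Row → List Row
positive j [] = []
positive j (w@(l , r , ms) ∷ ws) =
  if 0 <ᵇ valueAt l j then w ∷ positive j ws else positive j ws
negative j [] = []
negative j (w@(l , r , ms) ∷ ws) =
  if 0 <ᵇ valueAt r j then w ∷ negative j ws else negative j ws
neutral j [] = []
neutral j (w@(l , r , ms) ∷ ws) =
  if 0 <ᵇ valueAt r j then neutral j ws else (zeroAt j l , r , ms) ∷ neutral j ws

informative : List Row → List Row
informative [] = []
informative (w@(l , r , ms) ∷ ws) = if l ≤ᶜ [] then informative ws else w ∷ informative ws

resolve : ℕ → Row → Row → Row
resolve j (l , r , ms) (l′ , r′ , ms′) =
  rowOf (add (scale b l) (scale a l′)) (add (scale b r) (scale a r′))
        (add (scale b ms) (scale a ms′))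
  where
  a = valueAt l j
  b = valueAt r′ j

resolvents : ℕ → List Row → List Row → List Row
resolvents j [] ns = []
resolvents j (p ∷ ps) ns = map (resolve j p) ns ++ resolvents j ps ns

eliminate : ℕ → List Row → List Row
eliminate j ws = informative (neutral j ws ++ resolvents j (positive j ws) (negative j ws))

cheapest : List ℕ → ℕ → ℕ → List Row → ℕ
cheapest [] best cost ws = best
cheapest (j ∷ js) best cost ws =
  if c <ᵇ cost then cheapest js j c ws else cheapest js best cost ws
  where
  c = length (positive j ws) * length (negative j ws)

without : ℕ → List ℕ → List ℕ
without j [] = []
without j (i ∷ is) = if i ≡ᵇ j then is else i ∷ without j is

contradictory : List Row → List ℕ
contradictory [] = []
contradictory ((l , r , ms) ∷ ws) =
  if (0 <ᵇ valueAt l 0) ∧ (r ≤ᶜ []) then ms else contradictory ws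

search : ℕ → List ℕ → List Row → List ℕ
search zero js ws = contradictory ws
search (suc f) js ws = search f (without j js) (eliminate j ws)
  where
  -- The variable with the fewest resolvents is eliminated next; 100000 stands for infinity.
  j = cheapest js 0 100000 ws

indices : ℕ → ℕ → List ℕ
indices i zero = []
indices i (suc m) = i ∷ indices (suc i) m

-- An equation is a pair of opposite rows; it is used to substitute for one of its variables.
Equation : Set
Equation = Row × Row

_≡ᶜ_ : List ℕ → List ℕ → Bool
cs ≡ᶜ ds = (cs ≤ᶜ ds) ∧ (ds ≤ᶜ cs)

-- An equality hypothesis enters the system as two consecutive opposite inequalities, so only
-- neighbouring rows are compared.
equations : List Row → List Equation × List Row
equations ((l , r , ms) ∷ (l′ , r′ , ms′) ∷ ws) =
  if (l ≡ᶜ r′) ∧ (r ≡ᶜ l′)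
  then (((l , r , ms) , (l′ , r′ , ms′)) ∷ proj₁ (equations ws) , proj₂ (equations ws))
  else (proj₁ (equations ((l′ , r′ , ms′) ∷ ws)) , (l , r , ms) ∷ proj₂ (equations ((l′ , r′ , ms′) ∷ ws)))
equations ws = [] , ws

pivot : ℕ → List ℕ → ℕ
pivot i [] = 0
pivot i (c ∷ cs) = if 0 <ᵇ c then i else pivot (suc i) cs

substitute : ℕ → Equation → Row → Row
substitute j (p , q) w@(l , r , ms) =
  if 0 <ᵇ valueAt l j then resolve j w q else (if 0 <ᵇ valueAt r j then resolve j p w else w)

substituteᵉ : ℕ → Equation → List Equation → List Equation
substituteᵉ j e [] = []
substituteᵉ j e ((w , w′) ∷ es) = (substitute j e w , substitute j e w′) ∷ substituteᵉ j e es

dropConstant : List ℕ → List ℕ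
dropConstant [] = []
dropConstant (_ ∷ cs) = cs

solve-equations : ℕ → List Equation → List Row → List Row
solve-equations zero es ws = ws
solve-equations (suc f) [] ws = ws
solve-equations (suc f) (e@(p@(l , r , ms) , q) ∷ es) ws =
  if 0 <ᵇ pivot 1 (dropConstant l)
  then solve-equations f (substituteᵉ (pivot 1 (dropConstant l)) e es) (map (substitute (pivot 1 (dropConstant l)) e) ws)
  else (if 0 <ᵇ pivot 1 (dropConstant r)
    then solve-equations f (substituteᵉ (pivot 1 (dropConstant r)) (q , p) es) (map (substitute (pivot 1 (dropConstant r)) (q , p)) ws)
    else solve-equations f es (p ∷ q ∷ ws))

multipliers : ℕ → System → List ℕ
multipliers m h = search m (indices 1 m)
  (informative (solve-equations (length h) (proj₁ (equations (rows 0 h))) (proj₂ (equations (rows 0 h)))))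

valid : ℕ → System → Formula → Bool
valid m h ((t ≼ u) ⇒ f) = valid m ((t , u) ∷ h) f
valid m h ((t ≐ u) ⇒ f) = valid m ((t , u) ∷ (u , t) ∷ h) f
valid m h (⊢ t ≼ u) = refutes ((1+ u , t) ∷ h) (multipliers m ((1+ u , t) ∷ h))
valid m h (⊢ t ≐ u) =
  refutes ((1+ u , t) ∷ h) (multipliers m ((1+ u , t) ∷ h)) ∧
  refutes ((1+ t , u) ∷ h) (multipliers m ((1+ t , u) ∷ h))
valid m h ⊢⊥ = refutes h (multipliers m h)

valid-sound : ∀ ρ m h f → T (valid m h f) → Satisfies ρ h → ⟦ f ⟧ᶠ ρ
valid-sound ρ m h ((t ≼ u) ⇒ f) ok sat p = valid-sound ρ m _ f ok (p , sat)
valid-sound ρ m h ((t ≐ u) ⇒ f) ok sat p =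
  valid-sound ρ m _ f ok (≤-reflexive p , ≤-reflexive (sym p) , sat)
valid-sound ρ m h (⊢ t ≼ u) ok sat =
  ≮⇒≥ λ q → refutes-sound ρ ((1+ u , t) ∷ h) (multipliers m ((1+ u , t) ∷ h)) ok (q , sat)
valid-sound ρ m h (⊢ t ≐ u) ok sat
  with Equivalence.to (T-∧ {refutes ((1+ u , t) ∷ h) (multipliers m ((1+ u , t) ∷ h))}) ok
... | p , q = ≤-antisym
  (≮⇒≥ λ r → refutes-sound ρ ((1+ u , t) ∷ h) (multipliers m ((1+ u , t) ∷ h)) p (r , sat))
  (≮⇒≥ λ r → refutes-sound ρ ((1+ t , u) ∷ h) (multipliers m ((1+ t , u) ∷ h)) q (r , sat))
valid-sound ρ m h ⊢⊥ ok sat = refutes-sound ρ h (multipliers m h) ok sat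

Quantified : ℕ → Set
Quantified zero = Formula
Quantified (suc m) = Term → Quantified m

body : ∀ m → ℕ → Quantified m → Formula
body zero i f = f
body (suc m) i f = body m (suc i) (f (var i))

∀ℕ : ℕ → (List ℕ → Set) → Set
∀ℕ zero P = P []
∀ℕ (suc m) P = (x : ℕ) → ∀ℕ m (λ ρ → P (x ∷ ρ))

generalise : ∀ m {P : List ℕ → Set} → (∀ ρ → P ρ) → ∀ℕ m P
generalise zero p = p []
generalise (suc m) p x = generalise m (λ ρ → p (x ∷ ρ))

Linear : ∀ m → Quantified m → Set
Linear m f = ∀ℕ m ⟦ body m 0 f ⟧ᶠ

-- For a formula that the procedure accepts, the implicit argument has the unit type after
-- evaluation and is filled in silently. Formulas are functions of terms, which spares the numbering
-- of variables.
linear : ∀ m (f : Quantified m) {_ : T (valid m [] (body m 0 f))} → Linear m f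
linear m f {ok} = generalise m λ ρ → valid-sound ρ m [] (body m 0 f) ok tt

-- Vertex sets as Boolean functions

infixr 7 _∩_
infixr 6 _∪_ _─_

_∩_ _∪_ _─_ : {A : Set} → (A → Bool) → (A → Bool) → A → Bool
(X ∩ Y) v = X v ∧ Y v
(X ∪ Y) v = X v ∨ Y v
(X ─ Y) v = X v ∧ not (Y v)

∁ : {A : Set} → (A → Bool) → A → Bool
∁ X v = not (X v)

⁅_⁆ : ∀ {m} → Fin m → Fin m → Bool
⁅ s ⁆ v = ⌊ v ≟ s ⌋

⁅⁆-self : ∀ {m} (s : Fin m) → ⁅ s ⁆ s ≡ true
⁅⁆-self s with s ≟ s
... | yes _ = refl
... | no s≢s = contradiction refl s≢s

⁅⁆-other : ∀ {m} {s v : Fin m} → v ≢ s → ⁅ s ⁆ v ≡ false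
⁅⁆-other {s = s} {v} v≢s with v ≟ s
... | yes v≡s = contradiction v≡s v≢s
... | no _ = refl

⁅⁆-true : ∀ {m} {s v : Fin m} → ⁅ s ⁆ v ≡ true → v ≡ s
⁅⁆-true {s = s} {v} p with v ≟ s
... | yes v≡s = v≡s

true≢false : ∀ {b} → b ≡ true → b ≡ false → ⊥
true≢false refl ()

¬true⇒false : ∀ {b} → ¬ b ≡ true → b ≡ false
¬true⇒false {true} p = contradiction refl p
¬true⇒false {false} p = refl

∩-intro : ∀ {a b} → a ≡ true → b ≡ true → a ∧ b ≡ true
∩-intro refl refl = refl

─-intro : ∀ {a b} → a ≡ true → b ≡ false → a ∧ not b ≡ true
─-intro refl refl = refl

∧-true : ∀ {a b} → a ∧ b ≡ true → a ≡ true × b ≡ true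
∧-true {true} {true} p = refl , refl

∧-falseˡ : ∀ {a b} → a ≡ false → a ∧ b ≡ false
∧-falseˡ refl = refl

∧-falseʳ : ∀ {a b} → b ≡ false → a ∧ b ≡ false
∧-falseʳ {true} refl = refl
∧-falseʳ {false} refl = refl

∨-trueˡ : ∀ {a b} → a ≡ true → a ∨ b ≡ true
∨-trueˡ refl = refl

∨-trueʳ : ∀ {a b} → b ≡ true → a ∨ b ≡ true
∨-trueʳ {true} refl = refl
∨-trueʳ {false} refl = refl

∨-false : ∀ {a b} → a ≡ false → b ≡ false → a ∨ b ≡ false
∨-false refl refl = refl

∨-true : ∀ {a b} → a ∨ b ≡ true → a ≡ true ⊎ b ≡ true
∨-true {true} p = inj₁ refl
∨-true {false} p = inj₂ p

not-true : ∀ {a} → not a ≡ true → a ≡ false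
not-true {false} p = refl

-- Counting

count : {A : Set} → (A → Bool) → List A → ℕ
count p xs = length (filterᵇ p xs)

bit : Bool → ℕ
bit true = 1
bit false = 0

bit-mono : ∀ {b c} → (b ≡ true → c ≡ true) → bit b ≤ bit c
bit-mono {false} h = z≤n
bit-mono {true} h = ≤-reflexive (cong bit (sym (h refl)))

count-∷ : ∀ {A : Set} (p : A → Bool) x xs → count p (x ∷ xs) ≡ bit (p x) + count p xs
count-∷ p x xs with p x
... | true = refl
... | false = refl

count-++ : ∀ {A : Set} (p : A → Bool) xs ys → count p (xs ++ ys) ≡ count p xs + count p ys
count-++ p xs ys = trans (cong length (filter-++ (T? ∘ p) xs ys)) (length-++ (filterᵇ p xs))

count-cong-∈ : ∀ {A : Set} {p q : A → Bool} xs → (∀ {x} → x ∈ xs → p x ≡ q x) →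
  count p xs ≡ count q xs
count-cong-∈ [] h = refl
count-cong-∈ {p = p} {q} (x ∷ xs) h =
  trans (count-∷ p x xs) (trans (cong₂ (λ b c → bit b + c) (h (here refl))
    (count-cong-∈ xs (h ∘ there))) (sym (count-∷ q x xs)))

count-cong : ∀ {A : Set} {p q : A → Bool} → p ≗ q → ∀ xs → count p xs ≡ count q xs
count-cong h xs = count-cong-∈ xs (λ {x} _ → h x)

count-map : ∀ {A B : Set} (p : B → Bool) (f : A → B) xs → count p (map f xs) ≡ count (p ∘ f) xs
count-map p f [] = refl
count-map p f (x ∷ xs) =
  trans (count-∷ p (f x) (map f xs)) (trans (cong (bit (p (f x)) +_) (count-map p f xs))
    (sym (count-∷ (p ∘ f) x xs)))

map-lookup-allFin : ∀ {A : Set} (xs : List A) → map (lookup xs) (allFin (length xs)) ≡ xs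
map-lookup-allFin xs = trans (map-tabulate id (lookup xs)) (tabulate-lookup xs)

count-lookup : ∀ {A : Set} (p : A → Bool) xs → countᶠ (length xs) (p ∘ lookup xs) ≡ count p xs
count-lookup p xs =
  trans (sym (count-map p (lookup xs) (allFin (length xs)))) (cong (count p) (map-lookup-allFin xs))

count-filter : ∀ {A : Set} (p q : A → Bool) xs → count p (filterᵇ q xs) ≡ count (q ∩ p) xs
count-filter p q [] = refl
count-filter p q (x ∷ xs) rewrite count-∷ (q ∩ p) x xs with q x
... | true = trans (count-∷ p x (filterᵇ q xs)) (cong (bit (p x) +_) (count-filter p q xs))
... | false = count-filter p q xs

count-positive : ∀ {A : Set} (p : A → Bool) {x} xs → x ∈ xs → p x ≡ true → 1 ≤ count p xs
count-positive p (x ∷ xs) (here refl) px rewrite count-∷ p x xs | px = s≤s z≤n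
count-positive p (y ∷ xs) (there i) px rewrite count-∷ p y xs =
  ≤-trans (count-positive p xs i px) (m≤n+m _ (bit (p y)))

injection⇒≤countᶠ : ∀ {l m} (p : Fin m → Bool) (f : Fin l → Fin m) →
  (∀ {i j} → f i ≡ f j → i ≡ j) → (∀ i → p (f i) ≡ true) → l ≤ countᶠ m p
injection⇒≤countᶠ {l} {m} p f inj pf = injective⇒≤ {f = position} λ {i} {j} eq →
  inj (trans (lookup-index (member i)) (trans (cong (lookup chosen) eq) (sym (lookup-index (member j)))))
  where
  chosen = filterᵇ p (allFin m)
  member : ∀ i → f i ∈ chosen
  member i = ∈-filter⁺ (T? ∘ p) (∈-allFin (f i)) (Equivalence.from T-≡ (pf i))
  position : Fin l → Fin (length chosen)
  position i = index (member i)

-- The singleton has its own clause so that three predicates unfold to `a + (b + c)` without a final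
-- `+ 0`, the shape in which the cut identities are stated.
Σcount : {A : Set} → List (A → Bool) → List A → ℕ
Σcount [] xs = 0
Σcount (p ∷ []) xs = count p xs
Σcount (p ∷ q ∷ ps) xs = count p xs + Σcount (q ∷ ps) xs

Σbit : {A : Set} → List (A → Bool) → A → ℕ
Σbit [] x = 0
Σbit (p ∷ []) x = bit (p x)
Σbit (p ∷ q ∷ ps) x = bit (p x) + Σbit (q ∷ ps) x

Σcount-∷ : ∀ {A : Set} (ps : List (A → Bool)) x xs → Σcount ps (x ∷ xs) ≡ Σbit ps x + Σcount ps xs
Σcount-∷ [] x xs = refl
Σcount-∷ (p ∷ []) x xs = count-∷ p x xs
Σcount-∷ (p ∷ q ∷ ps) x xs =
  linear 6 (λ a b c d e f → a ≐ b ⊕ c ⇒ d ≐ e ⊕ f ⇒ ⊢ a ⊕ d ≐ b ⊕ e ⊕ (c ⊕ f))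
    (count p (x ∷ xs)) (bit (p x)) (count p xs)
    (Σcount (q ∷ ps) (x ∷ xs)) (Σbit (q ∷ ps) x) (Σcount (q ∷ ps) xs)
    (count-∷ p x xs) (Σcount-∷ (q ∷ ps) x xs)

Σcount-[] : ∀ {A : Set} (ps : List (A → Bool)) → Σcount ps [] ≡ 0
Σcount-[] [] = refl
Σcount-[] (p ∷ []) = refl
Σcount-[] (p ∷ q ∷ ps) = Σcount-[] (q ∷ ps)

Σcount-mono : ∀ {A : Set} (ps qs : List (A → Bool)) xs → (∀ {x} → x ∈ xs → Σbit ps x ≤ Σbit qs x) →
  Σcount ps xs ≤ Σcount qs xs
Σcount-mono ps qs [] h rewrite Σcount-[] ps = z≤n
Σcount-mono ps qs (x ∷ xs) h rewrite Σcount-∷ ps x xs | Σcount-∷ qs x xs =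
  +-mono-≤ (h (here refl)) (Σcount-mono ps qs xs (h ∘ there))

-- A linear relation between edge counts holds as soon as it holds for a single edge, whose two ends
-- only matter through their memberships in the given sets.

Label : ℕ → Set
Label m = Vec Bool m

label : ∀ {V : Set} {m} → Vec (V → Bool) m → V → Label m
label Xs v = Vec.map (λ X → X v) Xs

EdgePredicate : ℕ → Set
EdgePredicate m = Label m → Label m → Bool

cut : ∀ {m} → (Label m → Bool) → EdgePredicate m
cut φ a b = φ a xor φ b

out : ∀ {m} → (Label m → Bool) → EdgePredicate m
out φ a b = φ a ∧ not (φ b)

join : ∀ {m} → (Label m → Bool) → (Label m → Bool) → EdgePredicate m
join φ ψ a b = (φ a ∧ ψ b) ∨ (φ b ∧ ψ a)

bothEnds : ∀ {m} → (Label m → Bool) → EdgePredicate m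
bothEnds ω a b = ω a ∧ ω b

in₁ : ∀ {m} → Label (1 + m) → Bool
in₁ (x ∷ _) = x

in₂ : ∀ {m} → Label (2 + m) → Bool
in₂ (_ ∷ y ∷ _) = y

in₃ : ∀ {m} → Label (3 + m) → Bool
in₃ (_ ∷ _ ∷ z ∷ _) = z

in₄ : ∀ {m} → Label (4 + m) → Bool
in₄ (_ ∷ _ ∷ _ ∷ w ∷ _) = w

everyLabel : ∀ m → (Label m → Bool) → Bool
everyLabel zero p = p []
everyLabel (suc m) p = everyLabel m (p ∘ (true ∷_)) ∧ everyLabel m (p ∘ (false ∷_))

everyLabel-sound : ∀ m p → T (everyLabel m p) → ∀ l → T (p l)
everyLabel-sound zero p h [] = h
everyLabel-sound (suc m) p h (true ∷ l) =
  everyLabel-sound m _ (proj₁ (Equivalence.to (T-∧ {everyLabel m (p ∘ (true ∷_))}) h)) l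
everyLabel-sound (suc m) p h (false ∷ l) =
  everyLabel-sound m _ (proj₂ (Equivalence.to (T-∧ {everyLabel m (p ∘ (true ∷_))}) h)) l

module _ {A V : Set} (ends : A → V × V) where

  at : ∀ {m} → Vec (V → Bool) m → EdgePredicate m → A → Bool
  at Xs w e = w (label Xs (proj₁ (ends e))) (label Xs (proj₂ (ends e)))

  labelSum : ∀ {m} → List (EdgePredicate m) → Label m → Label m → ℕ
  labelSum [] a b = 0
  labelSum (w ∷ []) a b = bit (w a b)
  labelSum (w ∷ u ∷ ws) a b = bit (w a b) + labelSum (u ∷ ws) a b

  Σbit-at : ∀ {m} (Xs : Vec (V → Bool) m) ws e →
    Σbit (map (at Xs) ws) e ≡ labelSum ws (label Xs (proj₁ (ends e))) (label Xs (proj₂ (ends e)))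
  Σbit-at Xs [] e = refl
  Σbit-at Xs (w ∷ []) e = refl
  Σbit-at Xs (w ∷ u ∷ ws) e = cong (_ +_) (Σbit-at Xs (u ∷ ws) e)

  labelwise : ∀ {m} → EdgePredicate m → List (EdgePredicate m) → List (EdgePredicate m) → Bool
  labelwise {m} ok ls rs = everyLabel m λ a → everyLabel m λ b →
    if ok a b then labelSum ls a b ≤ᵇ labelSum rs a b else true

  -- All `4 ^ m` pairs of labels are inspected by evaluation. `ok` carries what is known about every
  -- edge, such as disjointness of some regions, and excuses the pairs of labels that do not occur.
  regions-≤ : ∀ {m} (Xs : Vec (V → Bool) m) (ok : EdgePredicate m) (ls rs : List (EdgePredicate m)) →
    {_ : T (labelwise ok ls rs)} → ∀ es → (∀ {e} → e ∈ es → at Xs ok e ≡ true) →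
    Σcount (map (at Xs) ls) es ≤ Σcount (map (at Xs) rs) es
  regions-≤ {m} Xs ok ls rs {good} es okay = Σcount-mono (map (at Xs) ls) (map (at Xs) rs) es pointwise
    where
    pointwise : ∀ {e} → e ∈ es → Σbit (map (at Xs) ls) e ≤ Σbit (map (at Xs) rs) e
    pointwise {e} e∈ rewrite Σbit-at Xs ls e | Σbit-at Xs rs e
      with everyLabel-sound m _ (everyLabel-sound m _ good (label Xs (proj₁ (ends e)))) (label Xs (proj₂ (ends e)))
    ... | h rewrite okay e∈ = ≤ᵇ⇒≤ _ _ h

  regions-≡ : ∀ {m} (Xs : Vec (V → Bool) m) (ok : EdgePredicate m) (ls rs : List (EdgePredicate m)) →
    {_ : T (labelwise ok ls rs)} {_ : T (labelwise ok rs ls)} →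
    ∀ es → (∀ {e} → e ∈ es → at Xs ok e ≡ true) →
    Σcount (map (at Xs) ls) es ≡ Σcount (map (at Xs) rs) es
  regions-≡ Xs ok ls rs {p} {q} es okay =
    ≤-antisym (regions-≤ Xs ok ls rs {p} es okay) (regions-≤ Xs ok rs ls {q} es okay)

  bothEnds-at : ∀ {m} (Xs : Vec (V → Bool) m) (ω : Label m → Bool) → (∀ v → ω (label Xs v) ≡ true) →
    ∀ e → at Xs (bothEnds ω) e ≡ true
  bothEnds-at Xs ω h e = ∩-intro (h (proj₁ (ends e))) (h (proj₂ (ends e)))

-- The search runs over Boolean vectors. Invariance of `P` under pointwise equality replaces
-- function extensionality in passing from a set to its vector.
anySet? : ∀ {m} {P : (Fin m → Bool) → Set} → (∀ {X Y} → X ≗ Y → P X → P Y) →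
  (∀ X → Dec (P X)) → Dec (∃ P)
anySet? {m} {P} resp P? = map′
  (λ (S , p) → Vec.lookup S , p)
  (λ (X , p) → Vec.tabulate X , resp (λ v → sym (lookup∘tabulate X v)) p)
  (anySubset? {n = m} (λ S → P? (Vec.lookup S)))

count-strict : ∀ {A : Set} {p q : A → Bool} xs → (∀ x → p x ≡ true → q x ≡ true) →
  ∀ {x} → x ∈ xs → p x ≡ false → q x ≡ true → count p xs < count q xs
count-strict {p = p} {q} (y ∷ xs) imp (here refl) px qx
  rewrite count-∷ p y xs | count-∷ q y xs | px | qx =
  s≤s (Σcount-mono (p ∷ []) (q ∷ []) xs λ {x} _ → bit-mono (imp x))
count-strict {p = p} {q} (y ∷ xs) imp (there x∈) px qx
  rewrite count-∷ p y xs | count-∷ q y xs =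
  +-mono-≤-< (bit-mono (imp y)) (count-strict xs imp x∈ px qx)

count-true : ∀ {A : Set} (p : A → Bool) xs → (∀ x → p x ≡ true) → count p xs ≡ length xs
count-true p [] h = refl
count-true p (x ∷ xs) h rewrite count-∷ p x xs | h x = cong suc (count-true p xs h)

-- Menger's theorem

count-↭ : ∀ {A : Set} (p : A → Bool) {xs ys} → xs ↭ ys → count p xs ≡ count p ys
count-↭ p xs↭ys = ↭-length (filter-↭ (T? ∘ p) xs↭ys)

extract : ∀ {A : Set} {x : A} {xs} → x ∈ xs → ∃ λ ys → xs ↭ x ∷ ys
extract x∈xs with ∈-∃++ x∈xs
... | ys , zs , refl = ys ++ zs , shift _ ys zs

AllPairs-resp-↭ : ∀ {A : Set} {R : A → A → Set} → (∀ {x y} → R x y → R y x) →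
  ∀ {xs ys} → xs ↭ ys → AllPairs R xs → AllPairs R ys
AllPairs-resp-↭ sy ↭.refl ps = ps
AllPairs-resp-↭ sy (prep x π) (p ∷ ps) = All-resp-↭ π p ∷ AllPairs-resp-↭ sy π ps
AllPairs-resp-↭ sy (swap x y π) ((r ∷ p) ∷ q ∷ ps) =
  (sy r ∷ All-resp-↭ π q) ∷ All-resp-↭ π p ∷ AllPairs-resp-↭ sy π ps
AllPairs-resp-↭ sy (↭.trans π ρ) ps = AllPairs-resp-↭ sy ρ (AllPairs-resp-↭ sy π ps)

AllPairs-lookup : ∀ {A : Set} {R : A → A → Set} → (∀ {x y} → R x y → R y x) →
  ∀ {xs} → AllPairs R xs → ∀ i j → i ≢ j → R (lookup xs i) (lookup xs j)
AllPairs-lookup sy (p ∷ ps) zero zero i≢j = contradiction refl i≢j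
AllPairs-lookup sy (p ∷ ps) zero (suc j) i≢j = All.lookup p (∈-lookup j)
AllPairs-lookup sy (p ∷ ps) (suc i) zero i≢j = sy (AllPairs-lookup sy (p ∷ ps) zero (suc i) (λ ()))
AllPairs-lookup sy (p ∷ ps) (suc i) (suc j) i≢j = AllPairs-lookup sy ps i j (i≢j ∘ cong suc)

module _ {G : Graph} where

  _⁀_ : ∀ {u v w} → Walk G u v → Walk G v w → Walk G u w
  stop ⁀ q = q
  step e j p ⁀ q = step e j (p ⁀ q)

  walkEdges-⁀ : ∀ {u v w} (p : Walk G u v) (q : Walk G v w) {e} →
    e ∈ walkEdges (p ⁀ q) → e ∈ walkEdges p ⊎ e ∈ walkEdges q
  walkEdges-⁀ stop q e∈ = inj₂ e∈
  walkEdges-⁀ (step _ _ p) q (here eq) = inj₁ (here eq)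
  walkEdges-⁀ (step _ _ p) q (there e∈) = [ inj₁ ∘ there , inj₂ ]′ (walkEdges-⁀ p q e∈)

  walkVerts-⁀ : ∀ {u v w} {P : Fin (n G) → Set} (p : Walk G u v) (q : Walk G v w) →
    All P (walkVerts p) → All P (walkVerts q) → All P (walkVerts (p ⁀ q))
  walkVerts-⁀ stop q ps qs = qs
  walkVerts-⁀ (step _ _ p) q (x ∷ ps) qs = x ∷ walkVerts-⁀ p q ps qs

  suffix : ∀ {u v x} (p : Walk G u v) → x ∈ walkVerts p → Walk G x v
  suffix stop (here refl) = stop
  suffix (step e j p) (here refl) = step e j p
  suffix (step e j p) (there i) = suffix p i

  walkVerts-suffix : ∀ {u v x} (p : Walk G u v) (i : x ∈ walkVerts p) →
    walkVerts (suffix p i) ⊆ walkVerts p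
  walkVerts-suffix stop (here refl) = id
  walkVerts-suffix (step e j p) (here refl) = id
  walkVerts-suffix (step e j p) (there i) = there ∘ walkVerts-suffix p i

  walkEdges-suffix : ∀ {u v x} (p : Walk G u v) (i : x ∈ walkVerts p) →
    walkEdges (suffix p i) ⊆ walkEdges p
  walkEdges-suffix stop (here refl) = id
  walkEdges-suffix (step e j p) (here refl) = id
  walkEdges-suffix (step e j p) (there i) = there ∘ walkEdges-suffix p i

  unique-suffix : ∀ {u v x} (p : Walk G u v) (i : x ∈ walkVerts p) →
    Unique (walkVerts p) → Unique (walkVerts (suffix p i))
  unique-suffix stop (here refl) un = un
  unique-suffix (step e j p) (here refl) un = un
  unique-suffix (step e j p) (there i) (_ ∷ un) = unique-suffix p i un

  shorten : ∀ {u v} (p : Walk G u v) → Σ (Path G u v) λ q →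
    walkVerts (proj₁ q) ⊆ walkVerts p × walkEdges (proj₁ q) ⊆ walkEdges p
  shorten stop = (stop , [] ∷ []) , id , id
  shorten {u} (step e j p) with shorten p
  ... | (q , un) , vs , es with Any.any? (u ≟_) (walkVerts q)
  ...   | yes u∈q = (suffix q u∈q , unique-suffix q u∈q un) ,
                    there ∘ vs ∘ walkVerts-suffix q u∈q , there ∘ es ∘ walkEdges-suffix q u∈q
  ...   | no u∉q = (step e j q , All.¬Any⇒All¬ _ u∉q ∷ un) ,
                   (λ { (here eq) → here eq ; (there i) → there (vs i) }) ,
                   (λ { (here eq) → here eq ; (there i) → there (es i) })

  crossing : ∀ {u v} (X : Fin (n G) → Bool) (p : Walk G u v) → X u ≡ true → X v ≡ false →
    ∃ λ e → e ∈ walkEdges p × X (proj₁ (ends G e)) xor X (proj₂ (ends G e)) ≡ true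
  crossing X stop xu xv = ⊥-elim (true≢false xu xv)
  crossing X (step {w = w} e j p) xu xv with X w in xw
  ... | true with crossing X p xw xv
  ...   | f , f∈ , cr = f , there f∈ , cr
  crossing X (step e (inj₁ eq) p) xu xv | false =
    e , here refl , trans (cong (λ ab → X (proj₁ ab) xor X (proj₂ ab)) eq) (cong₂ _xor_ xu xw)
  crossing X (step e (inj₂ eq) p) xu xv | false =
    e , here refl , trans (cong (λ ab → X (proj₁ ab) xor X (proj₂ ab)) eq) (cong₂ _xor_ xw xu)

  boundary-≥ : ∀ {P : Fin (n G) → Set} {l u v} → EdgeDisjointPaths G P l u v →
    ∀ X → X u ≡ true → X v ≡ false → l ≤ boundary G X
  boundary-≥ {l = l} (P , _ , disjoint) X xu xv =
    ≤-trans (injection⇒≤countᶠ crosses chosen injective (λ i → proj₂ (proj₂ (pick i))))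
      (≤-reflexive (count-lookup (λ ab → X (proj₁ ab) xor X (proj₂ ab)) (edges G)))
    where
    crosses : Edge G → Bool
    crosses e = X (proj₁ (ends G e)) xor X (proj₂ (ends G e))
    pick = λ i → crossing X (proj₁ (P i)) xu xv
    chosen : Fin l → Edge G
    chosen i = proj₁ (pick i)
    injective : ∀ {i j} → chosen i ≡ chosen j → i ≡ j
    injective {i} {j} eq with i ≟ j
    ... | yes i≡j = i≡j
    ... | no i≢j = ⊥-elim (disjoint i j i≢j (chosen i) (proj₁ (proj₂ (pick i)))
            (subst (_∈ walkEdges (proj₁ (P j))) (sym eq) (proj₁ (proj₂ (pick j)))))

-- An undirected graph satisfying the cut condition can be oriented so that the directed cut
-- condition holds; then arcs leaving u are lifted one by one until they all end in v. An arc of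
-- the intermediate digraphs is a walk of G.
module Arcs (G : Graph) (I : Fin (n G) → Bool) (l : ℕ) (u v : Fin (n G)) where

  record Arc : Set where
    constructor arc
    field
      src tgt : Fin (n G)
      walk    : Walk G src tgt
      inside  : All (λ w → I w ≡ true) (walkVerts walk)

  open Arc

  arcEnds : Arc → Fin (n G) × Fin (n G)
  arcEnds a = src a , tgt a

  Disjoint : Arc → Arc → Set
  Disjoint a b = ∀ {e} → e ∈ walkEdges (walk a) → e ∈ walkEdges (walk b) → ⊥

  Disjoint-sym : ∀ {a b} → Disjoint a b → Disjoint b a
  Disjoint-sym d p q = d q p

  leaves : (Fin (n G) → Bool) → Arc → Bool
  leaves U a = U (src a) ∧ not (U (tgt a))

  outflow : (Fin (n G) → Bool) → List Arc → ℕ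
  outflow U = count (leaves U)

  outflow-submodular : ∀ X Y A → outflow (X ∩ Y) A + outflow (X ∪ Y) A ≤ outflow X A + outflow Y A
  outflow-submodular X Y A = regions-≤ arcEnds (X ∷ Y ∷ []) (λ _ _ → true)
    (out (in₁ ∩ in₂) ∷ out (in₁ ∪ in₂) ∷ []) (out in₁ ∷ out in₂ ∷ []) A (λ _ → refl)

  outflow-cong : ∀ {X Y} → X ≗ Y → ∀ A → outflow X A ≡ outflow Y A
  outflow-cong h = count-cong (λ a → cong₂ (λ p q → p ∧ not q) (h (src a)) (h (tgt a)))

  Violates : ((Fin (n G) → Bool) → ℕ) → (Fin (n G) → Bool) → Set
  Violates f U = U u ≡ true × U v ≡ false × f U < l

  Supports : ((Fin (n G) → Bool) → ℕ) → Set
  Supports f = ∀ U → U u ≡ true → U v ≡ false → l ≤ f U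

  supports? : ∀ f → (∀ {X Y} → X ≗ Y → f X ≡ f Y) → Supports f ⊎ ∃ (Violates f)
  supports? f resp with anySet? {P = Violates f}
    (λ h (p , q , r) → trans (sym (h u)) p , trans (sym (h v)) q , subst (_< l) (resp h) r)
    (λ U → (U u Bool.≟ true) ×-dec (U v Bool.≟ false) ×-dec (f U <? l))
  ... | yes bad = inj₂ bad
  ... | no none = inj₁ λ U p q → ≮⇒≥ λ r → none (U , p , q , r)

  undirected : (Fin (n G) → Bool) → List (Edge G) → ℕ
  undirected U = count (λ e → U (proj₁ (ends G e)) xor U (proj₂ (ends G e)))

  undirected-submodular : ∀ X Y es →
    undirected (X ∩ Y) es + undirected (X ∪ Y) es ≤ undirected X es + undirected Y es
  undirected-submodular X Y es = regions-≤ (ends G) (X ∷ Y ∷ []) (λ _ _ → true)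
    (cut (in₁ ∩ in₂) ∷ cut (in₁ ∪ in₂) ∷ []) (cut in₁ ∷ cut in₂ ∷ []) es (λ _ → refl)

  undirected-cong : ∀ {X Y} → X ≗ Y → ∀ es → undirected X es ≡ undirected Y es
  undirected-cong h = count-cong (λ e → cong₂ _xor_ (h (proj₁ (ends G e))) (h (proj₂ (ends G e))))

  InsideEdge : Edge G → Set
  InsideEdge e = I (proj₁ (ends G e)) ≡ true × I (proj₂ (ends G e)) ≡ true

  forward backward : ∀ e → InsideEdge e → Arc
  forward e (p , q) = arc _ _ (step e (inj₁ refl) stop) (p ∷ q ∷ [])
  backward e (p , q) = arc _ _ (step e (inj₂ refl) stop) (q ∷ p ∷ [])

  -- `A` collects the arcs chosen so far and `B` those still to come. Confining the walks of `B` to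
  -- `es` is what keeps the arc of the next edge disjoint from them.
  Oriented : List (Edge G) → List Arc → Set
  Oriented es A = ∃ λ B → All (λ b → walkEdges (walk b) ⊆ es) B × AllPairs Disjoint B ×
    Supports (λ U → outflow U A + outflow U B)

  Oriented-∷ : ∀ {e es A} (a : Arc) → walkEdges (walk a) ⊆ e ∷ [] → All (e ≢_) es →
    Oriented es (a ∷ A) → Oriented (e ∷ es) A
  Oriented-∷ {e} {es} {A} a a⊆ fresh (B , B⊆ , pairs , good) =
    a ∷ B ,
    (single ∘ a⊆) ∷ All.map (λ b⊆ {_} x∈ → there (b⊆ x∈)) B⊆ ,
    All.map (λ b⊆ {_} p q → separate (a⊆ p) (b⊆ q)) B⊆ ∷ pairs ,
    λ U p q → ≤-trans (good U p q) (≤-reflexive (move U))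
    where
    single : ∀ {x} → x ∈ e ∷ [] → x ∈ e ∷ es
    single (here eq) = here eq
    separate : ∀ {x} → x ∈ e ∷ [] → x ∈ es → ⊥
    separate (here refl) x∈ = All.lookup fresh x∈ refl
    move : ∀ U → outflow U (a ∷ A) + outflow U B ≡ outflow U A + outflow U (a ∷ B)
    move U = linear 5 (λ aA aB A B b → aA ≐ b ⊕ A ⇒ aB ≐ b ⊕ B ⇒ ⊢ aA ⊕ B ≐ A ⊕ aB)
      (outflow U (a ∷ A)) (outflow U (a ∷ B)) (outflow U A) (outflow U B) (bit (leaves U a))
      (count-∷ (leaves U) a A) (count-∷ (leaves U) a B)

  -- If both orientations of `e` failed, on sets `X` and `Y`, the two values would fall short of
  -- `2 l` by at least two. Uncrossing into `X ∩ Y` and `X ∪ Y`, where `e` still counts as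
  -- undirected, gains at most one by `edgewise`, yet has to reach `2 l`.
  orient : ∀ es → All InsideEdge es → Unique es → ∀ A →
    Supports (λ U → outflow U A + undirected U es) → Oriented es A
  orient [] _ _ A good = [] , [] , [] , good
  orient (e ∷ es) (ie ∷ ies) (fresh ∷ un) A good
    with supports? (λ U → outflow U (forward e ie ∷ A) + undirected U es)
           (λ h → cong₂ _+_ (outflow-cong h (forward e ie ∷ A)) (undirected-cong h es))
       | supports? (λ U → outflow U (backward e ie ∷ A) + undirected U es)
           (λ h → cong₂ _+_ (outflow-cong h (backward e ie ∷ A)) (undirected-cong h es))
  ... | inj₁ fwd | _ = Oriented-∷ {A = A} (forward e ie) id fresh (orient es ies un (forward e ie ∷ A) fwd)
  ... | inj₂ _ | inj₁ bwd = Oriented-∷ {A = A} (backward e ie) id fresh (orient es ies un (backward e ie ∷ A) bwd)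
  ... | inj₂ (X , xu , xv , X<) | inj₂ (Y , yu , yv , Y<) = ⊥-elim
    (linear 15 (λ l oi oj ox oy ui uj ux uy bi bj fx by oX oY →
        1+ (oX ⊕ ux) ≼ l ⇒ 1+ (oY ⊕ uy) ≼ l ⇒ l ≼ oi ⊕ (bi ⊕ ui) ⇒ l ≼ oj ⊕ (bj ⊕ uj) ⇒
        oX ≐ fx ⊕ ox ⇒ oY ≐ by ⊕ oy ⇒ oi ⊕ oj ≼ ox ⊕ oy ⇒ ui ⊕ uj ≼ ux ⊕ uy ⇒
        bi ⊕ bj ≼ 1+ (fx ⊕ by) ⇒ ⊢⊥)
      l (outflow (X ∩ Y) A) (outflow (X ∪ Y) A) (outflow X A) (outflow Y A)
      (undirected (X ∩ Y) es) (undirected (X ∪ Y) es) (undirected X es) (undirected Y es)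
      (bit ((X ∩ Y) a xor (X ∩ Y) b)) (bit ((X ∪ Y) a xor (X ∪ Y) b))
      (bit (X a ∧ not (X b))) (bit (Y b ∧ not (Y a)))
      (outflow X (forward e ie ∷ A)) (outflow Y (backward e ie ∷ A))
      X< Y<
      (≤-trans (good (X ∩ Y) (∩-intro xu yu) (∧-falseˡ xv))
        (≤-reflexive (cong (outflow (X ∩ Y) A +_) (count-∷ _ e es))))
      (≤-trans (good (X ∪ Y) (∨-trueˡ xu) (∨-false xv yv))
        (≤-reflexive (cong (outflow (X ∪ Y) A +_) (count-∷ _ e es))))
      (count-∷ (leaves X) (forward e ie) A) (count-∷ (leaves Y) (backward e ie) A)
      (outflow-submodular X Y A) (undirected-submodular X Y es)
      (edgewise (X a) (X b) (Y a) (Y b)))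
    where
    a = proj₁ (ends G e)
    b = proj₂ (ends G e)
    -- An edge crossing both the intersection and the union has one end in both sets and the other
    -- in neither. So it leaves `X` when directed forwards or `Y` when directed backwards.
    edgewise : ∀ xa xb ya yb → bit ((xa ∧ ya) xor (xb ∧ yb)) + bit ((xa ∨ ya) xor (xb ∨ yb)) ≤
      suc (bit (xa ∧ not xb) + bit (yb ∧ not ya))
    edgewise xa xb ya yb = ≤ᵇ⇒≤ _ _ (everyLabel-sound 4
      (λ { (xa ∷ xb ∷ ya ∷ yb ∷ []) →
        bit ((xa ∧ ya) xor (xb ∧ yb)) + bit ((xa ∨ ya) xor (xb ∨ yb)) ≤ᵇ
        suc (bit (xa ∧ not xb) + bit (yb ∧ not ya)) }) tt (xa ∷ xb ∷ ya ∷ yb ∷ []))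

  Supported : List Arc → Set
  Supported A = Supports (λ U → outflow U A)

  supported? : ∀ A → Supported A ⊎ ∃ (Violates (λ U → outflow U A))
  supported? A = supports? (λ U → outflow U A) (λ h → outflow-cong h A)

  Supported-↭ : ∀ {A B} → A ↭ B → Supported A → Supported B
  Supported-↭ π good U p q = ≤-trans (good U p q) (≤-reflexive (count-↭ (leaves U) π))

  merge : (a b : Arc) → src b ≡ tgt a → Arc
  merge (arc x y p i) (arc .y z q j) refl = arc x z (p ⁀ q) (walkVerts-⁀ p q i j)

  src-merge : ∀ a b eq → src (merge a b eq) ≡ src a
  src-merge (arc _ _ _ _) (arc _ _ _ _) refl = refl

  tgt-merge : ∀ a b eq → tgt (merge a b eq) ≡ tgt b
  tgt-merge (arc _ _ _ _) (arc _ _ _ _) refl = refl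

  merge-disjoint : ∀ a b eq {B} → All (Disjoint a) B → All (Disjoint b) B →
    All (Disjoint (merge a b eq)) B
  merge-disjoint a b eq [] [] = []
  merge-disjoint a@(arc _ _ p _) b@(arc _ _ q _) refl (da ∷ das) (db ∷ dbs) =
    (λ e∈ f∈ → [ (λ i → da i f∈) , (λ i → db i f∈) ]′ (walkEdges-⁀ p q e∈)) ∷
    merge-disjoint a b refl das dbs

  Linking : Set
  Linking = ∃ λ B → AllPairs Disjoint B × All (λ a → src a ≡ u × tgt a ≡ v) B × l ≤ length B

  -- Among the sets tight for a ∷ A that avoid w = tgt a, one contains all heads of arcs leaving w
  -- (unless some arc can be lifted); adding w to it contradicts the cut condition.
  module Lift (a : Arc) (A : List Arc) (src≡u : src a ≡ u) (tgt≢u : tgt a ≢ u) (tgt≢v : tgt a ≢ v)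
    (good : Supported (a ∷ A)) where

    w = tgt a

    Mergeable : Set
    Mergeable = ∃ λ b → ∃ λ B → Σ (src b ≡ w) λ eq → A ↭ b ∷ B × Supported (merge a b eq ∷ B)

    Tight : (Fin (n G) → Bool) → Set
    Tight U = U u ≡ true × U v ≡ false × U w ≡ false × outflow U (a ∷ A) ≤ l

    Tight-∪ : ∀ {X Y} → Tight X → Tight Y → Tight (X ∪ Y)
    Tight-∪ {X} {Y} (xu , xv , xw , xl) (yu , yv , yw , yl) =
      ∨-trueˡ xu , ∨-false xv yv , ∨-false xw yw ,
      linear 5 (λ l i j x y → x ≼ l ⇒ y ≼ l ⇒ l ≼ i ⇒ i ⊕ j ≼ x ⊕ y ⇒ ⊢ j ≼ l)
        l _ _ _ _ xl yl (good (X ∩ Y) (∩-intro xu yu) (∧-falseˡ xv)) (outflow-submodular X Y (a ∷ A))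

    bit-leaves : ∀ U {p q} c → U (src c) ≡ p → U (tgt c) ≡ q → bit (leaves U c) ≡ bit (p ∧ not q)
    bit-leaves U c p q = cong₂ (λ p q → bit (p ∧ not q)) p q

    -- Deleting `a` costs a set containing `u` at most one unit, and only when the set misses `w`.
    removed-tight : ∀ {U} → Violates (λ U → outflow U A) U → Tight U
    removed-tight {U} (p , q , r) = p , q , analyse (U w) outflow-a r (good U p q)
      where
      outflow-a : outflow U (a ∷ A) ≡ bit (true ∧ not (U w)) + outflow U A
      outflow-a = trans (count-∷ (leaves U) a A) (cong (_+ outflow U A)
        (bit-leaves U a (trans (cong U src≡u) p) refl))
      analyse : ∀ b {x y} → x ≡ bit (true ∧ not b) + y → y < l → l ≤ x → b ≡ false × x ≤ l
      analyse true refl y< l≤ = ⊥-elim (<⇒≱ y< l≤)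
      analyse false refl y< l≤ = refl , y<

    -- For a set containing `u`, merging lowers the outflow only when `a` leaves the set and `b`
    -- enters it again, that is, when `w` lies outside and the head of `b` inside.
    merged-tight : ∀ {b B} (eq : src b ≡ w) → A ↭ b ∷ B → ∀ {U} →
      Violates (λ U → outflow U (merge a b eq ∷ B)) U → Tight U × U (tgt b) ≡ true
    merged-tight {b} {B} eq π {U} (p , q , r)
      with analyse (U w) (U (tgt b)) outflow-merge outflow-a r (good U p q)
      where
      uU : U (src a) ≡ true
      uU = trans (cong U src≡u) p
      outflow-merge : outflow U (merge a b eq ∷ B) ≡ bit (true ∧ not (U (tgt b))) + outflow U B
      outflow-merge = trans (count-∷ (leaves U) (merge a b eq) B) (cong (_+ outflow U B)
        (bit-leaves U (merge a b eq) (trans (cong U (src-merge a b eq)) uU) (cong U (tgt-merge a b eq))))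
      outflow-a : outflow U (a ∷ A) ≡
        bit (true ∧ not (U w)) + (bit (U w ∧ not (U (tgt b))) + outflow U B)
      outflow-a = trans (count-↭ (leaves U) (prep a π)) (trans (count-∷ (leaves U) a (b ∷ B))
        (cong₂ _+_ (bit-leaves U a uU refl) (trans (count-∷ (leaves U) b B)
          (cong (_+ outflow U B) (bit-leaves U b (cong U eq) refl)))))
      analyse : ∀ c d {x y z} → x ≡ bit (true ∧ not d) + z →
        y ≡ bit (true ∧ not c) + (bit (c ∧ not d) + z) → x < l → l ≤ y → c ≡ false × y ≤ l × d ≡ true
      analyse true true refl refl x< l≤ = ⊥-elim (<⇒≱ x< l≤)
      analyse true false refl refl x< l≤ = ⊥-elim (<⇒≱ x< l≤)
      analyse false false refl refl x< l≤ = ⊥-elim (<⇒≱ x< l≤)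
      analyse false true refl refl x< l≤ = refl , x< , refl
    ... | uw , tight , ub = (p , q , uw , tight) , ub

    Absorbs : List Arc → (Fin (n G) → Bool) → Set
    Absorbs bs U = ∀ {b} → b ∈ bs → src b ≡ w → U (tgt b) ≡ true

    absorb : ∀ {T₀} → Tight T₀ → ∀ bs → bs ⊆ A → Mergeable ⊎ ∃ λ U → Tight U × Absorbs bs U
    absorb t₀ [] _ = inj₂ (_ , t₀ , λ ())
    absorb t₀ (b ∷ bs) bs⊆ with absorb t₀ bs (bs⊆ ∘ there)
    ... | inj₁ done = inj₁ done
    ... | inj₂ (U , t , abs) with src b ≟ w
    ...   | no b≢w = inj₂ (U , t , λ { (here refl) eq → contradiction eq b≢w ; (there i) → abs i })
    ...   | yes eq with extract (bs⊆ (here refl))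
    ...     | B , π with supported? (merge a b eq ∷ B)
    ...       | inj₁ ok = inj₁ (b , B , eq , π , ok)
    ...       | inj₂ (X , bad) with merged-tight eq π {X} bad
    ...         | tX , Xb = inj₂ (U ∪ X , Tight-∪ {U} {X} t tX ,
                  λ { (here refl) _ → ∨-trueʳ {U _} Xb ; (there i) e → ∨-trueˡ (abs i e) })

    -- With `w` added, `a` no longer leaves the set, and no new arc does, because the arcs starting
    -- at `w` end inside. The outflow would drop below `l`.
    absorbed-impossible : ∀ {U} → Tight U → Absorbs A U → ⊥
    absorbed-impossible {U} (p , q , r , t) abs =
      linear 5 (λ l oU oU′ A A′ → oU ≼ l ⇒ l ≼ oU′ ⇒ oU ≐ # 1 ⊕ A ⇒ oU′ ≐ A′ ⇒ A′ ≼ A ⇒ ⊢⊥)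
        l (outflow U (a ∷ A)) (outflow U′ (a ∷ A)) (outflow U A) (outflow U′ A)
        t (good U′ (∨-trueˡ p) (∨-false q (⁅⁆-other (tgt≢v ∘ sym))))
        (trans (count-∷ (leaves U) a A) (cong (λ b → bit b + outflow U A) crosses))
        (trans (count-∷ (leaves U′) a A) (cong (λ b → bit b + outflow U′ A) inside′))
        (Σcount-mono (leaves U′ ∷ []) (leaves U ∷ []) A
          (λ {b} b∈ → bit-mono (transfer b∈)))
      where
      U′ = U ∪ ⁅ w ⁆
      crosses : leaves U a ≡ true
      crosses = ─-intro (trans (cong U src≡u) p) r
      inside′ : leaves U′ a ≡ false
      inside′ = ∧-falseʳ {U′ (src a)} (cong not (∨-trueʳ {U w} (⁅⁆-self w)))
      transfer : ∀ {b} → b ∈ A → leaves U′ b ≡ true → leaves U b ≡ true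
      transfer {b} b∈ h with ∧-true {U′ (src b)} h
      ... | s∈ , t∉ with ∨-true {U (src b)} s∈
      ...   | inj₁ Us = ─-intro Us (¬true⇒false λ Ut → true≢false (∨-trueˡ Ut) (not-true t∉))
      ...   | inj₂ eq = ⊥-elim (true≢false (∨-trueˡ (abs b∈ (⁅⁆-true eq))) (not-true t∉))

    lift-one : Supported A ⊎ Mergeable
    lift-one with supported? A
    ... | inj₁ ok = inj₁ ok
    ... | inj₂ (T₀ , bad) with absorb (removed-tight {T₀} bad) A id
    ...   | inj₁ ok = inj₂ ok
    ...   | inj₂ (U , t , abs) = ⊥-elim (absorbed-impossible {U} t abs)

  -- Each round deletes an arc or merges two, so the number of arcs decreases. At the end every arc
  -- leaving the singleton of `u` runs to `v`; merging may have produced closed arcs at `u`, but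
  -- these do not leave it.
  linking : ∀ N A → length A ≤ N → AllPairs Disjoint A → Supported A → u ≢ v → Linking
  linking N A len dis good u≢v
    with Any.any? (λ a → (src a ≟ u) ×-dec ¬? (tgt a ≟ u) ×-dec ¬? (tgt a ≟ v)) A
  ... | no none = filterᵇ direct A , AllPairs.filter⁺ (T? ∘ direct) dis ,
    All.map (λ {a} t → ends-direct {a} (Equivalence.to T-≡ t)) (All.all-filter (T? ∘ direct) A) ,
    ≤-trans (good ⁅ u ⁆ (⁅⁆-self u) (⁅⁆-other (u≢v ∘ sym)))
      (Σcount-mono (leaves ⁅ u ⁆ ∷ []) (direct ∷ []) A λ {a} a∈ → pointwise a a∈)
    where
    direct : Arc → Bool
    direct a = ⁅ u ⁆ (src a) ∧ ⁅ v ⁆ (tgt a)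
    ends-direct : ∀ {a} → direct a ≡ true → src a ≡ u × tgt a ≡ v
    ends-direct {a} d with ∧-true {⁅ u ⁆ (src a)} d
    ... | p , q = ⁅⁆-true p , ⁅⁆-true q
    pointwise : ∀ a → a ∈ A → bit (leaves ⁅ u ⁆ a) ≤ bit (direct a)
    pointwise a a∈ with src a ≟ u | tgt a ≟ u | tgt a ≟ v
    ... | yes _ | yes _ | _ = z≤n
    ... | yes p | no q | yes r = s≤s z≤n
    ... | yes p | no q | no r = contradiction (Any.map (λ { refl → p , q , r }) a∈) none
    ... | no _ | _ | _ = z≤n
  linking zero [] len dis good u≢v | yes ()
  linking (suc N) A len dis good u≢v | yes some with find some
  ... | a , a∈ , p , q , r with extract a∈
  ...   | A′ , π with AllPairs-resp-↭ (λ {x} {y} → Disjoint-sym {x} {y}) π dis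
  ...     | dis-a ∷ dis′ with Lift.lift-one a A′ p q r (Supported-↭ π good)
  ...       | inj₁ ok = linking N A′ (s≤s⁻¹ (≤-trans (≤-reflexive (sym (↭-length π))) len)) dis′ ok u≢v
  ...       | inj₂ (b , B , eq , ρ , ok)
    with AllPairs-resp-↭ (λ {x} {y} → Disjoint-sym {x} {y}) ρ dis′ | All-resp-↭ ρ dis-a
  ...         | dis-b ∷ dis″ | _ ∷ dis-a′ = linking N (merge a b eq ∷ B)
      (s≤s⁻¹ (≤-trans (≤-reflexive (sym (trans (↭-length π) (cong suc (↭-length ρ))))) len))
      (merge-disjoint a b eq dis-a′ dis-b ∷ dis″) ok u≢v

  paths : Linking → EdgeDisjointPaths G (λ w → I w ≡ true) l u v
  paths (B , dis , direct , l≤) =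
    (λ i → proj₁ (short i)) ,
    (λ i → All.tabulate λ x∈ → All.lookup (proj₁ (proj₂ (moved i))) (proj₁ (proj₂ (short i)) x∈)) ,
    λ i j i≢j e e∈i e∈j →
      AllPairs-lookup {R = Disjoint} (λ {x} {y} → Disjoint-sym {x} {y}) dis
        (inject≤ i l≤) (inject≤ j l≤) (i≢j ∘ inject≤-injective l≤ l≤ i j)
        (within i (proj₂ (proj₂ (short i)) e∈i)) (within j (proj₂ (proj₂ (short j)) e∈j))
    where
    given : Fin l → Arc
    given i = lookup B (inject≤ i l≤)
    relocate : ∀ b → src b ≡ u × tgt b ≡ v → Σ (Walk G u v) λ p →
      All (λ w → I w ≡ true) (walkVerts p) × walkEdges p ≡ walkEdges (walk b)
    relocate (arc _ _ p i) (refl , refl) = p , i , refl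
    moved = λ i → relocate (given i) (All.lookup direct (∈-lookup (inject≤ i l≤)))
    short = λ i → shorten (proj₁ (moved i))
    within : ∀ i {e} → e ∈ walkEdges (proj₁ (moved i)) → e ∈ walkEdges (walk (given i))
    within i = subst (_ ∈_) (proj₂ (proj₂ (moved i)))

-- Only edges with both ends in `I` are oriented, so the same statement serves for the whole graph
-- and for the subgraphs induced by blobs.
menger : ∀ (G : Graph) (I : Fin (n G) → Bool) l u v → u ≢ v →
  (∀ U → U u ≡ true → U v ≡ false →
    l ≤ count (λ ab → (I (proj₁ ab) ∧ I (proj₂ ab)) ∧ (U (proj₁ ab) xor U (proj₂ ab))) (edges G)) →
  EdgeDisjointPaths G (λ w → I w ≡ true) l u v
menger G I l u v u≢v cuts with orient insideEdges insideAll unique [] supported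
  where
  open Arcs G I l u v
  insideᵇ : Edge G → Bool
  insideᵇ e = I (proj₁ (ends G e)) ∧ I (proj₂ (ends G e))
  insideEdges = filterᵇ insideᵇ (allFin (length (edges G)))
  insideAll : All InsideEdge insideEdges
  insideAll = All.map (λ {e} t → ∧-true (Equivalence.to T-≡ t)) (All.all-filter (T? ∘ insideᵇ) (allFin _))
  unique : Unique insideEdges
  unique = Unique.filter⁺ (T? ∘ insideᵇ) (Unique.allFin⁺ _)
  supported : Supports (λ U → undirected U insideEdges)
  supported U p q = ≤-trans (cuts U p q) (≤-reflexive (sym
    (trans (count-filter _ insideᵇ (allFin _)) (count-lookup _ (edges G)))))
... | B , _ , dis , good = paths (linking (length B) B ≤-refl dis good u≢v)
  where open Arcs G I l u v

-- Lifting and dangerous sets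

≡ᵇ-false : ∀ {i j} → i ≢ j → (i ≡ᵇ j) ≡ false
≡ᵇ-false {i} {j} i≢j = ¬true⇒false λ p → i≢j (≡ᵇ⇒≡ i j (Equivalence.from T-≡ p))

≡ᵇ-true : ∀ {i j} → i ≡ j → (i ≡ᵇ j) ≡ true
≡ᵇ-true {i} {j} p = Equivalence.to T-≡ (≡⇒≡ᵇ i j p)

deleteTwo-comm : ∀ {A : Set} i j q (xs : List A) → deleteTwo i j q xs ≡ deleteTwo j i q xs
deleteTwo-comm i j q [] = refl
deleteTwo-comm i j q (x ∷ xs)
  rewrite Bool.∨-comm (q ≡ᵇ i) (q ≡ᵇ j) | deleteTwo-comm i j (suc q) xs = refl

deleteTwo-below : ∀ {A : Set} {i j q} → i < q → j < q → (xs : List A) → deleteTwo i j q xs ≡ xs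
deleteTwo-below i<q j<q [] = refl
deleteTwo-below i<q j<q (x ∷ xs)
  rewrite ≡ᵇ-false (>⇒≢ i<q) | ≡ᵇ-false (>⇒≢ j<q)
  = cong (x ∷_) (deleteTwo-below (m<n⇒m<1+n i<q) (m<n⇒m<1+n j<q) xs)

module _ {A : Set} (p : A → Bool) where

  -- `q` is the position of the head of the list. As `i` has already been passed, only one entry
  -- remains to be deleted.
  count-delete-one : ∀ {i q} → i < q → ∀ xs (f : Fin (length xs)) →
    count p xs ≡ bit (p (lookup xs f)) + count p (deleteTwo i (q + toℕ f) q xs)
  count-delete-one {i} {q} i<q (x ∷ xs) zero
    rewrite +-identityʳ q | ≡ᵇ-false (>⇒≢ i<q) | ≡ᵇ-true {q} refl
          | deleteTwo-below (m<n⇒m<1+n i<q) (n<1+n q) xs = count-∷ p x xs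
  count-delete-one {i} {q} i<q (x ∷ xs) (suc f)
    rewrite ≡ᵇ-false (>⇒≢ i<q) | ≡ᵇ-false (<⇒≢ (m<m+n q {suc (toℕ f)} (s≤s z≤n))) | +-suc q (toℕ f) =
    linear 6 (λ a b c d e g → a ≐ b ⊕ c ⇒ c ≐ d ⊕ e ⇒ g ≐ b ⊕ e ⇒ ⊢ a ≐ d ⊕ g)
      (count p (x ∷ xs)) (bit (p x)) (count p xs) (bit (p (lookup xs f))) (count p rest) (count p (x ∷ rest))
      (count-∷ p x xs) (count-delete-one (m<n⇒m<1+n i<q) xs f) (count-∷ p x rest)
    where rest = deleteTwo i (suc (q + toℕ f)) (suc q) xs

  count-delete-two : ∀ q xs (e f : Fin (length xs)) → e ≢ f →
    count p xs ≡ bit (p (lookup xs e)) + (bit (p (lookup xs f)) +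
      count p (deleteTwo (q + toℕ e) (q + toℕ f) q xs))
  count-delete-two q (x ∷ xs) zero zero e≢f = contradiction refl e≢f
  count-delete-two q (x ∷ xs) zero (suc f) e≢f
    rewrite +-identityʳ q | ≡ᵇ-true {q} refl | +-suc q (toℕ f) =
    trans (count-∷ p x xs) (cong (bit (p x) +_) (count-delete-one (n<1+n q) xs f))
  count-delete-two q (x ∷ xs) (suc e) zero e≢f =
    trans (count-delete-two q (x ∷ xs) zero (suc e) (λ ()))
      (linear 4 (λ a b c d → c ≐ d ⇒ ⊢ a ⊕ (b ⊕ c) ≐ b ⊕ (a ⊕ d)) (bit (p x)) (bit (p (lookup xs e))) _ _
        (cong (count p) (deleteTwo-comm (q + 0) (q + suc (toℕ e)) q (x ∷ xs))))
  count-delete-two q (x ∷ xs) (suc e) (suc f) e≢f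
    rewrite ≡ᵇ-false (<⇒≢ (m<m+n q {suc (toℕ e)} (s≤s z≤n)))
          | ≡ᵇ-false (<⇒≢ (m<m+n q {suc (toℕ f)} (s≤s z≤n))) | +-suc q (toℕ e) | +-suc q (toℕ f) =
    linear 7 (λ a b c d e f g → a ≐ b ⊕ c ⇒ c ≐ d ⊕ (e ⊕ f) ⇒ g ≐ b ⊕ f ⇒ ⊢ a ≐ d ⊕ (e ⊕ g))
      (count p (x ∷ xs)) (bit (p x)) (count p xs) (bit (p (lookup xs e))) (bit (p (lookup xs f)))
      (count p rest) (count p (x ∷ rest))
      (count-∷ p x xs) (count-delete-two (suc q) xs e f (e≢f ∘ cong suc)) (count-∷ p x rest)
    where rest = deleteTwo (suc (q + toℕ e)) (suc (q + toℕ f)) (suc q) xs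

module _ {m : ℕ} (X : Fin m → Bool) where

  crossesᵇ : Fin m × Fin m → Bool
  crossesᵇ ab = X (proj₁ ab) xor X (proj₂ ab)

  count-newEdge : ∀ v w → count crossesᵇ (newEdge v w) ≡ bit (X v xor X w)
  count-newEdge v w with v ≟ w
  ... | yes refl = cong bit (sym (Bool.xor-same (X v)))
  ... | no _ = trans (count-∷ crossesᵇ (v , w) []) (+-identityʳ _)

  crosses-otherEnd : ∀ {s} → X s ≡ false → ∀ ab → incidentᵇ s ab ≡ true →
    crossesᵇ ab ≡ X (otherEnd s ab)
  crosses-otherEnd {s} xs (a , b) inc with a ≟ s | b ≟ s
  ... | yes refl | _ rewrite xs = refl
  ... | no _ | yes refl rewrite xs = Bool.xor-comm (X a) false

  incident-between : ∀ {s} → X s ≡ false → ∀ ab →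
    incidentᵇ s ab ∧ X (otherEnd s ab) ≡
    (X (proj₁ ab) ∧ ⁅ s ⁆ (proj₂ ab)) ∨ (X (proj₂ ab) ∧ ⁅ s ⁆ (proj₁ ab))
  incident-between {s} xs (a , b) with a ≟ s | b ≟ s
  ... | yes refl | yes refl rewrite xs = refl
  ... | yes refl | no _ rewrite xs = sym (Bool.∧-identityʳ (X b))
  ... | no _ | yes refl rewrite xs = sym (trans (Bool.∨-identityʳ _) (Bool.∧-identityʳ (X a)))
  ... | no _ | no _ = sym (trans (cong₂ _∨_ (Bool.∧-zeroʳ (X a)) (Bool.∧-zeroʳ (X b))) refl)

-- Written without subtraction: the boundary drops by two if both ends lie in `X` and stays the same
-- otherwise. This includes the case of equal ends, where no edge is added.
boundary-lift : ∀ G s e f → e ≢ f → incidentᵇ s (ends G e) ≡ true → incidentᵇ s (ends G f) ≡ true →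
  ∀ X → X s ≡ false →
  let x = X (otherEnd s (ends G e)); y = X (otherEnd s (ends G f)) in
  bit x + (bit y + boundary (lift G s e f) X) ≡ bit (x xor y) + boundary G X
boundary-lift G s e f e≢f ie if X xs =
  linear 7 (λ g d l x y w n → g ≐ x ⊕ (y ⊕ d) ⇒ l ≐ d ⊕ n ⇒ n ≐ w ⇒ ⊢ x ⊕ (y ⊕ l) ≐ w ⊕ g)
    (boundary G X) (count (crossesᵇ X) rest) (boundary (lift G s e f) X)
    (bit (X (otherEnd s (ends G e)))) (bit (X (otherEnd s (ends G f))))
    (bit (X v xor X w)) (count (crossesᵇ X) (newEdge v w))
    (trans (count-delete-two (crossesᵇ X) 0 (edges G) e f e≢f)
      (cong₂ (λ b c → bit b + (bit c + count (crossesᵇ X) rest))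
        (crosses-otherEnd X xs (ends G e) ie) (crosses-otherEnd X xs (ends G f) if)))
    (count-++ (crossesᵇ X) rest (newEdge v w)) (count-newEdge X v w)
  where
  v = otherEnd s (ends G e)
  w = otherEnd s (ends G f)
  rest = deleteTwo (toℕ e) (toℕ f) 0 (edges G)

CutCondition : ∀ (G : Graph) → Fin (n G) → ℕ → Set
CutCondition G s k = ∀ X → X s ≡ false → ∀ {u v} → X u ≡ true → v ≢ s → X v ≡ false → k ≤ boundary G X

SK⇒cuts : ∀ {G s k} → SKEdgeConnected G s k → CutCondition G s k
SK⇒cuts (_ , _ , conn) X xs {u} {v} xu v≢s xv =
  boundary-≥ (conn u v (λ { refl → true≢false xu xs }) v≢s (λ { refl → true≢false xu xv })) X xu xv

boundary-∁ : ∀ G X → boundary G (∁ X) ≡ boundary G X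
boundary-∁ G X = regions-≡ id (X ∷ []) (λ _ _ → true) (cut (∁ in₁) ∷ []) (cut in₁ ∷ []) (edges G) (λ _ → refl)

cuts⇒SK : ∀ {G s k} → 3 ≤ n G → 1 ≤ k → CutCondition G s k → SKEdgeConnected G s k
cuts⇒SK {G} {s} {k} 3≤n 1≤k cuts = 3≤n , 1≤k , λ u v u≢s v≢s u≢v →
  forget (menger G (λ _ → true) k u v u≢v λ U Uu Uv → bound U u≢s v≢s Uu Uv)
  where
  bound : ∀ U {u v} → u ≢ s → v ≢ s → U u ≡ true → U v ≡ false → k ≤ boundary G U
  bound U u≢s v≢s Uu Uv with U s in Us
  ... | false = cuts U Us Uu v≢s Uv
  -- A cut containing `s` is replaced by its complement, which exchanges `u` and `v`.
  ... | true = subst (k ≤_) (boundary-∁ G U) (cuts (∁ U) (cong not Us) (cong not Uv) u≢s (cong not Uu))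
  forget : ∀ {u v} → EdgeDisjointPaths G (λ _ → true ≡ true) k u v → EdgeDisjointPaths G (λ _ → ⊤) k u v
  forget (P , _ , dis) = P , (λ i → All.tabulate (λ _ → tt)) , dis

record Dangerous (G : Graph) (s : Fin (n G)) (k : ℕ) (X : Fin (n G) → Bool) : Set where
  constructor dangerous
  field
    avoids : X s ≡ false
    small  : boundary G X ≤ suc k
    missed : ∃ λ v → v ≢ s × X v ≡ false

boundary-cong : ∀ G {X Y} → X ≗ Y → boundary G X ≡ boundary G Y
boundary-cong G h = count-cong (λ ab → cong₂ _xor_ (h (proj₁ ab)) (h (proj₂ ab))) (edges G)

Dangerous-cong : ∀ {G s k X Y} → X ≗ Y → Dangerous G s k X → Dangerous G s k Y
Dangerous-cong {G} {s} {k} h (dangerous xs small (v , v≢s , xv)) =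
  dangerous (trans (sym (h s)) xs) (subst (_≤ suc k) (boundary-cong G h) small)
    (v , v≢s , trans (sym (h v)) xv)

module _ (G : Graph) (s : Fin (n G)) where

  edgeAt : Fin (deg G s) → Edge G
  edgeAt = lookup (incEdges G s)

  opaque

    tip : Fin (deg G s) → Fin (n G)
    tip x = otherEnd s (ends G (edgeAt x))

  edgeAt-incident : ∀ x → incidentᵇ s (ends G (edgeAt x)) ≡ true
  edgeAt-incident x = Equivalence.to T-≡ (proj₂ (∈-filter⁻ (λ e → T? (incidentᵇ s (ends G e)))
    {xs = allFin (length (edges G))} (∈-lookup {xs = incEdges G s} x)))

  edgeAt-injective : ∀ {x y} → x ≢ y → edgeAt x ≢ edgeAt y
  edgeAt-injective {x} {y} = AllPairs-lookup ≢-sym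
    (Unique.filter⁺ (λ e → T? (incidentᵇ s (ends G e))) (Unique.allFin⁺ (length (edges G)))) x y

  opaque
    unfolding tip

    tip≢s : Loopless G → ∀ x → tip x ≢ s
    tip≢s loopless x = aux (ends G (edgeAt x)) (loopless (edgeAt x))
      where
      aux : ∀ ab → proj₁ ab ≢ proj₂ ab → otherEnd s ab ≢ s
      aux (a , b) a≢b with a ≟ s
      ... | yes refl = a≢b ∘ sym
      ... | no a≢s = a≢s

    countᶠ-tip : ∀ X → X s ≡ false → countᶠ (deg G s) (X ∘ tip) ≡ between G X ⁅ s ⁆
    countᶠ-tip X xs =
      trans (count-lookup (X ∘ otherEnd s ∘ ends G) (incEdges G s))
      (trans (count-filter (X ∘ otherEnd s ∘ ends G) (incidentᵇ s ∘ ends G) (allFin (length (edges G))))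
      (trans (count-cong (λ e → incident-between X xs (ends G e)) (allFin (length (edges G))))
        (count-lookup (λ ab → (X (proj₁ ab) ∧ ⁅ s ⁆ (proj₂ ab)) ∨ (X (proj₂ ab) ∧ ⁅ s ⁆ (proj₁ ab))) (edges G))))

module _ (G : Graph) (s : Fin (n G)) (k : ℕ) where

  dangerous? : ∀ X → Dec (Dangerous G s k X)
  dangerous? X = map′ (λ (p , q , r) → dangerous p q r) (λ (dangerous p q r) → p , q , r)
    ((X s Bool.≟ false) ×-dec (boundary G X ≤? suc k) ×-dec any? (λ v → ¬? (v ≟ s) ×-dec (X v Bool.≟ false)))

  record Together (x y : Fin (deg G s)) : Set where
    constructor together
    field
      set       : Fin (n G) → Bool
      isDangerous : Dangerous G s k set
      holds₁    : set (tip G s x) ≡ true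
      holds₂    : set (tip G s y) ≡ true

  together? : ∀ x y → Dec (Together x y)
  together? x y = map′ (λ (X , dX , p , q) → together X dX p q) (λ (together X dX p q) → X , dX , p , q) (anySet?
    (λ h (dx , p , q) → Dangerous-cong h dx , trans (sym (h (tip G s x))) p , trans (sym (h (tip G s y))) q)
    (λ X → dangerous? X ×-dec (X (tip G s x) Bool.≟ true) ×-dec (X (tip G s y) Bool.≟ true)))

  module _ (sk : SKEdgeConnected G s k) where

    opaque
      unfolding tip

      apart⇒liftable : ∀ {x y} → x ≢ y → ¬ Together x y → LiftGraph G s k x y
      apart⇒liftable {x} {y} x≢y apart =
        (edgeAt-injective G s x≢y) , edgeAt-incident G s x , edgeAt-incident G s y ,
        cuts⇒SK (proj₁ sk) (proj₁ (proj₂ sk)) λ X xs {u} {v} xu v≢s xv →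
          bound X (X (tip G s x)) (X (tip G s y)) refl refl
            (boundary-lift G s (edgeAt G s x) (edgeAt G s y) (edgeAt-injective G s x≢y)
              (edgeAt-incident G s x) (edgeAt-incident G s y) X xs)
            (SK⇒cuts sk X xs xu v≢s xv) (λ small → dangerous xs small (v , v≢s , xv))
        where
        bound : ∀ X a b → X (tip G s x) ≡ a → X (tip G s y) ≡ b → ∀ {l} →
          bit (X (tip G s x)) + (bit (X (tip G s y)) + l) ≡ bit (X (tip G s x) xor X (tip G s y)) + boundary G X →
          k ≤ boundary G X → (boundary G X ≤ suc k → Dangerous G s k X) → k ≤ l
        bound X a b xa yb {l} eq k≤ dang rewrite xa | yb with a | b
        ... | true | true with boundary G X ≤? suc k
        ...   | yes small = contradiction (together X (dang small) xa yb) apart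
        ...   | no large = linear 3 (λ k l g → # 2 ⊕ l ≐ g ⇒ # 2 ⊕ k ≼ g ⇒ ⊢ k ≼ l) k l _ eq (≰⇒> large)
        bound X a b xa yb {l} eq k≤ dang | true | false = subst (k ≤_) (sym (suc-injective eq)) k≤
        bound X a b xa yb {l} eq k≤ dang | false | true = subst (k ≤_) (sym (suc-injective eq)) k≤
        bound X a b xa yb {l} eq k≤ dang | false | false = subst (k ≤_) (sym eq) k≤

      liftable⇒apart : ∀ {x y} → LiftGraph G s k x y → x ≢ y × ¬ Together x y
      liftable⇒apart {x} {y} (e≢f , ie , if , sk′) = (λ { refl → e≢f refl }) ,
        λ (together X (dangerous xs small (v , v≢s , xv)) xx xy) →
          linear 3 (λ k l g → # 2 ⊕ l ≐ g ⇒ k ≼ l ⇒ g ≼ 1+ k ⇒ ⊢⊥) k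
            (boundary (lift G s (edgeAt G s x) (edgeAt G s y)) X) (boundary G X)
            (trans (cong₂ (λ a b → bit a + (bit b + boundary (lift G s (edgeAt G s x) (edgeAt G s y)) X)) (sym xx) (sym xy))
              (trans (boundary-lift G s (edgeAt G s x) (edgeAt G s y) e≢f ie if X xs)
                (cong₂ (λ a b → bit (a xor b) + boundary G X) xx xy)))
            (SK⇒cuts sk′ X xs xx v≢s xv) small

-- Uncrossing

module Cuts (G : Graph) where

  private
    V = Fin (n G)

  δ : (V → Bool) → ℕ
  δ = boundary G

  e : (V → Bool) → (V → Bool) → ℕ
  e = between G

  outside : (V → Bool) → (V → Bool) → V → Bool
  outside X Y = ∁ (X ∪ Y)

  private
    any : ∀ {m} → EdgePredicate m
    any _ _ = true

  -- Posimodularity with its exact error term: an edge from `X ∩ Y` to the outside counts twice on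
  -- the left and for neither difference. An edge at `s` whose end lies in both sets is such an
  -- edge.
  uncross-─ : ∀ X Y → δ X + δ Y ≡ δ (X ─ Y) + (δ (Y ─ X) + (e (X ∩ Y) (outside X Y) + e (X ∩ Y) (outside X Y)))
  uncross-─ X Y = regions-≡ id (X ∷ Y ∷ []) any (cut in₁ ∷ cut in₂ ∷ [])
    (cut (in₁ ─ in₂) ∷ cut (in₂ ─ in₁) ∷ join (in₁ ∩ in₂) (∁ (in₁ ∪ in₂)) ∷ join (in₁ ∩ in₂) (∁ (in₁ ∪ in₂)) ∷ [])
    (edges G) (λ _ → refl)

  uncross-∩ : ∀ X Y → δ (X ∩ Y) + δ (X ∪ Y) ≤ δ X + δ Y
  uncross-∩ X Y = regions-≤ id (X ∷ Y ∷ []) any (cut (in₁ ∩ in₂) ∷ cut (in₁ ∪ in₂) ∷ [])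
    (cut in₁ ∷ cut in₂ ∷ []) (edges G) (λ _ → refl)

  -- Once both boundaries are known, this compares the numbers of edges that `X ∩ Y` sends to the
  -- two differences.
  δ-─ : ∀ X Y → δ X + e (X ∩ Y) (X ─ Y) ≡ δ (X ─ Y) + (e (X ∩ Y) (Y ─ X) + e (X ∩ Y) (outside X Y))
  δ-─ X Y = regions-≡ id (X ∷ Y ∷ []) any (cut in₁ ∷ join (in₁ ∩ in₂) (in₁ ─ in₂) ∷ [])
    (cut (in₁ ─ in₂) ∷ join (in₁ ∩ in₂) (in₂ ─ in₁) ∷ join (in₁ ∩ in₂) (∁ (in₁ ∪ in₂)) ∷ [])
    (edges G) (λ _ → refl)

  δ-∩ : ∀ X Y → δ (X ∩ Y) ≡ e (X ∩ Y) (X ─ Y) + (e (X ∩ Y) (Y ─ X) + e (X ∩ Y) (outside X Y))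
  δ-∩ X Y = regions-≡ id (X ∷ Y ∷ []) any (cut (in₁ ∩ in₂) ∷ [])
    (join (in₁ ∩ in₂) (in₁ ─ in₂) ∷ join (in₁ ∩ in₂) (in₂ ─ in₁) ∷ join (in₁ ∩ in₂) (∁ (in₁ ∪ in₂)) ∷ [])
    (edges G) (λ _ → refl)

  uncross-three : ∀ X Y Z → let o = e (X ∩ Y ∩ Z) (∁ (X ∪ Y ∪ Z)) in
    δ (X ∩ Y ∩ Z) + (δ (X ─ (Y ∪ Z)) + (δ (Y ─ (X ∪ Z)) + (δ (Z ─ (X ∪ Y)) + (o + o)))) ≤ δ X + (δ Y + δ Z)
  uncross-three X Y Z = regions-≤ id (X ∷ Y ∷ Z ∷ []) any
    (cut (in₁ ∩ in₂ ∩ in₃) ∷ cut (in₁ ─ (in₂ ∪ in₃)) ∷ cut (in₂ ─ (in₁ ∪ in₃)) ∷ cut (in₃ ─ (in₁ ∪ in₂)) ∷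
      join (in₁ ∩ in₂ ∩ in₃) (∁ (in₁ ∪ in₂ ∪ in₃)) ∷ join (in₁ ∩ in₂ ∩ in₃) (∁ (in₁ ∪ in₂ ∪ in₃)) ∷ [])
    (cut in₁ ∷ cut in₂ ∷ cut in₃ ∷ []) (edges G) (λ _ → refl)

  e-comm : ∀ X Y → e X Y ≡ e Y X
  e-comm X Y = regions-≡ id (X ∷ Y ∷ []) any (join in₁ in₂ ∷ []) (join in₂ in₁ ∷ []) (edges G) (λ _ → refl)

  e-mono : ∀ X Y Z → (∀ v → Y v ≡ true → Z v ≡ true) → e X Y ≤ e X Z
  e-mono X Y Z h = regions-≤ id (X ∷ Y ∷ Z ∷ []) (bothEnds ω) (join in₁ in₂ ∷ []) (join in₁ in₃ ∷ [])
    (edges G) (λ {ab} _ → bothEnds-at id (X ∷ Y ∷ Z ∷ []) ω ok ab)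
    where
    ω : Label 3 → Bool
    ω = ∁ (in₂ ─ in₃)
    ok : ∀ v → ω (label (X ∷ Y ∷ Z ∷ []) v) ≡ true
    ok v with Y v in y
    ... | false = refl
    ... | true rewrite h v y = refl

  e-cong : ∀ {X X′ Y Y′} → X ≗ X′ → Y ≗ Y′ → e X Y ≡ e X′ Y′
  e-cong h g = count-cong (λ ab → cong₂ _∨_ (cong₂ _∧_ (h (proj₁ ab)) (g (proj₂ ab)))
    (cong₂ _∧_ (h (proj₂ ab)) (g (proj₁ ab)))) (edges G)

module Dangerously (G : Graph) (s : Fin (n G)) (k : ℕ) (loopless : Loopless G)
  (sk : SKEdgeConnected G s k) (2≤k : 2 ≤ k) (4<d : 4 < deg G s) where

  open Cuts G public

  V = Fin (n G)

  d = deg G s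

  t : Fin d → V
  t = tip G s

  S : V → Bool
  S = ⁅ s ⁆

  D : (V → Bool) → Set
  D = Dangerous G s k

  open Dangerous public

  infix 4 _∋_ _∌_

  _∋_ _∌_ : (V → Bool) → Fin d → Set
  X ∋ x = X (t x) ≡ true
  X ∌ x = X (t x) ≡ false

  t≢s : ∀ x → t x ≢ s
  t≢s = tip≢s G s loopless

  cuts : CutCondition G s k
  cuts = SK⇒cuts sk

  ∈⇒≢s : ∀ {X : V → Bool} → X s ≡ false → ∀ {v} → X v ≡ true → v ≢ s
  ∈⇒≢s xs xv refl = true≢false xv xs

  disjoint-S : ∀ {X : V → Bool} → X s ≡ false → ∀ v → not (X v ∧ S v) ≡ true
  disjoint-S {X} xs v with v ≟ s
  ... | yes refl rewrite xs = refl
  ... | no _ rewrite Bool.∧-zeroʳ (X v) = refl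

  tips≤ : ∀ {X : V → Bool} → X s ≡ false → ∀ xs → Unique xs → All (X ∋_) xs → length xs ≤ e X S
  tips≤ {X} noS xs un all = subst (length xs ≤_) (countᶠ-tip G s X noS)
    (injection⇒≤countᶠ (X ∘ t) (lookup xs) injective (λ i → All.lookup all (∈-lookup i)))
    where
    injective : ∀ {i j} → lookup xs i ≡ lookup xs j → i ≡ j
    injective {i} {j} eq with i ≟ j
    ... | yes i≡j = i≡j
    ... | no i≢j = contradiction eq (AllPairs-lookup ≢-sym un i j i≢j)

  tip≤ : ∀ {X : V → Bool} → X s ≡ false → ∀ {x} → X ∋ x → 1 ≤ e X S
  tip≤ {X} noS {x} x∈ = tips≤ {X} noS (x ∷ []) ([] ∷ []) (x∈ ∷ [])

  degree : e (∁ S) S ≡ d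
  degree = trans (sym (countᶠ-tip G s (∁ S) (cong not (⁅⁆-self s))))
    (trans (count-true (∁ S ∘ t) (allFin d) (λ x → cong not (⁅⁆-other (t≢s x)))) (length-tabulate id))

  δ-complement : ∀ {X : V → Bool} → X s ≡ false → δ (∁ (X ∪ S)) + (e X S + e X S) ≡ δ X + d
  δ-complement {X} noS = trans
    (regions-≡ id (X ∷ S ∷ []) (bothEnds ω)
      (cut (∁ (in₁ ∪ in₂)) ∷ join in₁ in₂ ∷ join in₁ in₂ ∷ []) (cut in₁ ∷ join (∁ in₂) in₂ ∷ [])
      (edges G) (λ {ab} _ → bothEnds-at id (X ∷ S ∷ []) ω (disjoint-S {X} noS) ab))
    (cong (δ X +_) degree)
    where
    ω : Label 2 → Bool
    ω = ∁ (in₁ ∩ in₂)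

  rest-nonempty : ∀ {X : V → Bool} {v} → v ≢ s → X v ≡ false → ∁ (X ∪ S) v ≡ true
  rest-nonempty v≢s xv rewrite xv | ⁅⁆-other v≢s = refl

  rest-s : ∀ {X : V → Bool} → ∁ (X ∪ S) s ≡ false
  rest-s {X} = cong not (∨-trueʳ {X s} (⁅⁆-self s))

  -- The vertices outside `X` and `s` form a nonempty cut with `δ X + d - 2 e X S` boundary edges.
  -- This number is at least `k`, whereas `δ X` is at most `k + 1`.
  half : ∀ {X} → D X → ∀ {u} → X u ≡ true → e X S + e X S ≤ suc d
  half {X} (dangerous noS small (v , v≢s , xv)) {u} xu =
    linear 5 (λ k δY a δX d → δY ⊕ (a ⊕ a) ≐ δX ⊕ d ⇒ k ≼ δY ⇒ δX ≼ 1+ k ⇒ ⊢ a ⊕ a ≼ 1+ d)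
      k (δ (∁ (X ∪ S))) (e X S) (δ X) d (δ-complement {X} noS)
      (cuts (∁ (X ∪ S)) (rest-s {X}) (rest-nonempty {X} v≢s xv) (∈⇒≢s {X} noS xu) (cong not (∨-trueˡ xu)))
      small

  misses : ∀ {X} → D X → ∀ {u} → X u ≡ true → ∃ λ z → X ∌ z
  misses {X} dX xu with all? (λ z → X (t z) Bool.≟ true)
  ... | no ¬all with ¬∀⟶∃¬ d _ (λ z → X (t z) Bool.≟ true) ¬all
  ...   | z , z∉ = z , ¬true⇒false z∉
  misses {X} dX xu | yes all = ⊥-elim
    (linear 2 (λ a d → a ⊕ a ≼ 1+ d ⇒ a ≐ d ⇒ # 5 ≼ d ⇒ ⊢⊥) (e X S) d (half dX xu)
      (trans (sym (countᶠ-tip G s X (avoids dX))) (trans (count-true (X ∘ t) (allFin d) all) (length-tabulate id)))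
      4<d)

  shared≤outside : ∀ {X Y : V → Bool} → X s ≡ false → Y s ≡ false → e (X ∩ Y) S ≤ e (X ∩ Y) (outside X Y)
  shared≤outside {X} {Y} xs ys = e-mono (X ∩ Y) S (outside X Y) λ v v≡s →
    trans (cong (outside X Y) (⁅⁆-true v≡s)) (cong not (∨-false xs ys))

  record Crosses (X Y : V → Bool) (x : Fin d) : Set where
    field
      δX   : δ X ≡ suc k
      δY   : δ Y ≡ suc k
      δX─Y : δ (X ─ Y) ≡ k
      δY─X : δ (Y ─ X) ≡ k
      out≡1 : e (X ∩ Y) (outside X Y) ≡ 1
      tip≡1 : e (X ∩ Y) S ≡ 1
      only : ∀ {z} → X ∋ z → Y ∋ z → z ≡ x
      balanced : e (X ∩ Y) (X ─ Y) ≡ e (X ∩ Y) (Y ─ X)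

  uncrossing-equalities : ∀ {a b c e o} → a + b ≡ c + (e + (o + o)) → a ≤ suc k → b ≤ suc k →
    k ≤ c → k ≤ e → 1 ≤ o → a ≡ suc k × b ≡ suc k × c ≡ k × e ≡ k × o ≡ 1
  uncrossing-equalities {a} {b} {c} {e} {o} eq a≤ b≤ c≥ e≥ o≥ =
    solved (λ k a b c e o → a ≐ 1+ k) , solved (λ k a b c e o → b ≐ 1+ k) , solved (λ k a b c e o → c ≐ k) ,
    solved (λ k a b c e o → e ≐ k) , solved (λ k a b c e o → o ≐ # 1)
    where
    claim : (Term → Term → Term → Term → Term → Term → Atom) → Quantified 6
    claim goal k a b c e o = a ⊕ b ≐ c ⊕ (e ⊕ (o ⊕ o)) ⇒ a ≼ 1+ k ⇒ b ≼ 1+ k ⇒ k ≼ c ⇒ k ≼ e ⇒ # 1 ≼ o ⇒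
      ⊢ goal k a b c e o
    solved : ∀ goal {ok : T (valid 6 [] (body 6 0 (claim goal)))} →
      ⟦ goal (var 0) (var 1) (var 2) (var 3) (var 4) (var 5) ⟧ᴬ (k ∷ a ∷ b ∷ c ∷ e ∷ o ∷ [])
    solved goal {ok} = linear 6 (claim goal) {ok} k a b c e o eq a≤ b≤ c≥ e≥ o≥

  -- In `uncross-─` the left side is at most `2 k + 2`. On the right each difference needs `k`, and
  -- the shared edge at `s` contributes two. So all these bounds are attained, and `δ-─` turns the
  -- resulting values into the balance.
  crossing-facts : ∀ {X Y} → D X → D Y → ∀ {x} → X ∋ x → Y ∋ x →
    ∀ {v w} → (X ─ Y) v ≡ true → (Y ─ X) w ≡ true → Crosses X Y x
  crossing-facts {X} {Y} dX dY {x} Xx Yx {v} {w} v∈ w∈ = record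
    { δX = δX′ ; δY = δY′ ; δX─Y = δX─Y′ ; δY─X = δY─X′ ; out≡1 = o≡1
    ; tip≡1 = ≤-antisym (≤-trans shared (≤-reflexive o≡1)) one
    ; only = only′
    ; balanced = linear 6 (λ k a b p q o → a ⊕ p ≐ b ⊕ (q ⊕ o) ⇒ a ≐ 1+ k ⇒ b ≐ k ⇒ o ≐ # 1 ⇒ ⊢ p ≐ q)
        k (δ X) (δ (X ─ Y)) (e (X ∩ Y) (X ─ Y)) (e (X ∩ Y) (Y ─ X)) o (δ-─ X Y) δX′ δX─Y′ o≡1
    }
    where
    o = e (X ∩ Y) (outside X Y)
    noS : (X ∩ Y) s ≡ false
    noS = ∧-falseˡ (avoids dX)
    parts : ∀ {A B : V → Bool} {v w} → A s ≡ false → B s ≡ false → (A ─ B) v ≡ true → (B ─ A) w ≡ true → k ≤ δ (A ─ B)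
    parts {A} {B} {v} {w} as bs v∈ w∈ = cuts (A ─ B) (∧-falseˡ as) v∈
      (∈⇒≢s {B} bs (proj₁ (∧-true {B w} w∈))) (∧-falseˡ (not-true (proj₂ (∧-true {B w} w∈))))
    shared : e (X ∩ Y) S ≤ o
    shared = shared≤outside {X} {Y} (avoids dX) (avoids dY)
    one : 1 ≤ e (X ∩ Y) S
    one = tip≤ {X ∩ Y} noS (∩-intro Xx Yx)
    equalities : δ X ≡ suc k × δ Y ≡ suc k × δ (X ─ Y) ≡ k × δ (Y ─ X) ≡ k × o ≡ 1
    equalities = uncrossing-equalities {δ X} {δ Y} {δ (X ─ Y)} {δ (Y ─ X)} {o} (uncross-─ X Y) (small dX) (small dY)
      (parts {X} {Y} (avoids dX) (avoids dY) v∈ w∈) (parts {Y} {X} (avoids dY) (avoids dX) w∈ v∈) (≤-trans one shared)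
    δX′ = proj₁ equalities
    δY′ = proj₁ (proj₂ equalities)
    δX─Y′ = proj₁ (proj₂ (proj₂ equalities))
    δY─X′ = proj₁ (proj₂ (proj₂ (proj₂ equalities)))
    o≡1 = proj₂ (proj₂ (proj₂ (proj₂ equalities)))
    only′ : ∀ {z} → X ∋ z → Y ∋ z → z ≡ x
    only′ {z} Xz Yz with z ≟ x
    ... | yes z≡x = z≡x
    ... | no z≢x = ⊥-elim (<⇒≱ (s≤s (≤-trans shared (≤-reflexive o≡1)))
            (tips≤ {X ∩ Y} noS (z ∷ x ∷ []) ((z≢x ∷ []) ∷ [] ∷ []) (∩-intro Xz Yz ∷ ∩-intro Xx Yx ∷ [])))

  -- The same count as for two dangerous sets, with one edge fewer on the left: `2 k + 1` cannot
  -- reach `2 k + 2`.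
  tight-comparable : ∀ {A Z} → A s ≡ false → δ A ≡ k → D Z → ∀ {x} → A ∋ x → Z ∋ x →
    ∀ {v w} → (A ─ Z) v ≡ true → (Z ─ A) w ≡ true → ⊥
  tight-comparable {A} {Z} as δA dZ Ax Zx {v} {w} v∈ w∈ =
    linear 6 (λ k a z c d o → a ⊕ z ≐ c ⊕ (d ⊕ (o ⊕ o)) ⇒ a ≐ k ⇒ z ≼ 1+ k ⇒ k ≼ c ⇒ k ≼ d ⇒ # 1 ≼ o ⇒ ⊢⊥)
      k (δ A) (δ Z) (δ (A ─ Z)) (δ (Z ─ A)) (e (A ∩ Z) (outside A Z)) (uncross-─ A Z) δA (small dZ)
      (cuts (A ─ Z) (∧-falseˡ as) v∈ (∈⇒≢s {Z} (avoids dZ) (proj₁ (∧-true {Z w} w∈)))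
        (∧-falseˡ (not-true (proj₂ (∧-true {Z w} w∈)))))
      (cuts (Z ─ A) (∧-falseˡ (avoids dZ)) w∈ (∈⇒≢s {A} as (proj₁ (∧-true {A v} v∈)))
        (∧-falseˡ (not-true (proj₂ (∧-true {A v} v∈)))))
      (≤-trans (tip≤ {A ∩ Z} (∧-falseˡ as) (∩-intro Ax Zx)) (shared≤outside {A} {Z} as (avoids dZ)))

  -- If A ∩ B were nonempty it would be tight with equally many edges to A ─ B and to B ─ A and no
  -- others, so k would be even.
  tight-disjoint : ∀ {p} → k ≡ suc (2 * p) → ∀ {A B} → A s ≡ false → B s ≡ false → δ A ≡ k → δ B ≡ k →
    ∀ {a b m} → (A ─ B) a ≡ true → (B ─ A) b ≡ true → m ≢ s → A m ≡ false → B m ≡ false →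
    ∀ {v} → A v ≡ true → B v ≡ true → ⊥
  tight-disjoint {p} odd {A} {B} as bs δA δB {a} {b} {m} a∈ b∈ m≢s Am Bm {v} Av Bv =
    even≢odd (e (A ∩ B) (A ─ B)) p (trans
      (linear 10 (λ k a b amb bma o i u p q → a ≐ k ⇒ b ≐ k ⇒ k ≼ amb ⇒ k ≼ bma ⇒ k ≼ i ⇒ k ≼ u ⇒
          a ⊕ b ≐ amb ⊕ (bma ⊕ (o ⊕ o)) ⇒ i ⊕ u ≼ a ⊕ b ⇒ a ⊕ p ≐ amb ⊕ (q ⊕ o) ⇒ i ≐ p ⊕ (q ⊕ o) ⇒
          ⊢ 2 ⊛ p ≐ k)
        k (δ A) (δ B) (δ (A ─ B)) (δ (B ─ A)) (e (A ∩ B) (outside A B)) (δ (A ∩ B)) (δ (A ∪ B))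
        (e (A ∩ B) (A ─ B)) (e (A ∩ B) (B ─ A)) δA δB
        (cuts (A ─ B) (∧-falseˡ as) a∈ m≢s (∧-falseˡ Am)) (cuts (B ─ A) (∧-falseˡ bs) b∈ m≢s (∧-falseˡ Bm))
        (cuts (A ∩ B) (∧-falseˡ as) (∩-intro Av Bv) m≢s (∧-falseˡ Am))
        (cuts (A ∪ B) (∨-false as bs) (∨-trueˡ Av) m≢s (∨-false Am Bm))
        (uncross-─ A B) (uncross-∩ A B) (δ-─ A B) (δ-∩ A B))
      odd)

  -- A cut with `c` edges inside `X` splits it into two sets whose boundaries sum to `δ X + 2 c`.
  -- Each is at least `k` and `δ X` is at most `k`, so `k ≤ 2 c`.
  induced-connected : ∀ {X} → X s ≡ false → δ X ≤ k → InducedEdgeConnected G X ⌈ k /2⌉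
  induced-connected {X} noS δX≤k u v Xu Xv u≢v = menger G X ⌈ k /2⌉ u v u≢v λ U Uu Uv →
    halve (linear 5 (λ k x i m c → i ⊕ m ≐ x ⊕ (c ⊕ c) ⇒ x ≼ k ⇒ k ≼ i ⇒ k ≼ m ⇒ ⊢ k ≼ c ⊕ c)
      k (δ X) (δ (X ∩ U)) (δ (X ─ U)) (inner U)
      (regions-≡ id (X ∷ U ∷ []) (λ _ _ → true) (cut (in₁ ∩ in₂) ∷ cut (in₁ ─ in₂) ∷ [])
        (cut in₁ ∷ within ∷ within ∷ []) (edges G) (λ _ → refl))
      δX≤k
      (cuts (X ∩ U) (∧-falseˡ noS) (∩-intro Xu Uu) (∈⇒≢s {X} noS Xv) (∧-falseʳ {X v} Uv))
      (cuts (X ─ U) (∧-falseˡ noS) (─-intro Xv Uv) (∈⇒≢s {X} noS Xu) (∧-falseʳ {X u} (cong not Uu))))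
    where
    within : EdgePredicate 2
    within a b = (in₁ a ∧ in₁ b) ∧ (in₂ a xor in₂ b)
    inner : (V → Bool) → ℕ
    inner U = count (λ ab → (X (proj₁ ab) ∧ X (proj₂ ab)) ∧ (U (proj₁ ab) xor U (proj₂ ab))) (edges G)
    halve : ∀ {c} → k ≤ c + c → ⌈ k /2⌉ ≤ c
    halve {c} h = ≤-trans (⌈n/2⌉-mono h) (≤-reflexive (sym (n≡⌈n+n/2⌉ c)))

-- Shapes of graphs on Fin d

∈-split : ∀ {A : Set} (xs : List A) {ys x} (m : x ∈ xs ++ ys) →
  (Σ (x ∈ xs) λ i → toℕ (index m) ≡ toℕ (index i)) ⊎
  (Σ (x ∈ ys) λ i → toℕ (index m) ≡ length xs + toℕ (index i))
∈-split [] m = inj₂ (m , refl)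
∈-split (x ∷ xs) (here eq) = inj₁ (here eq , refl)
∈-split (x ∷ xs) (there m) with ∈-split xs m
... | inj₁ (i , eq) = inj₁ (there i , cong suc eq)
... | inj₂ (i , eq) = inj₂ (i , cong suc eq)

∈-applyUpTo : ∀ {A : Set} (f : ℕ → A) l {x} (m : x ∈ applyUpTo f l) → x ≡ f (toℕ (index m))
∈-applyUpTo f (suc l) (here eq) = eq
∈-applyUpTo f (suc l) (there m) = ∈-applyUpTo (f ∘ suc) l m

lookup-unique : ∀ {A : Set} {xs : List A} → Unique xs → ∀ {i j} → lookup xs i ≡ lookup xs j → i ≡ j
lookup-unique un {i} {j} eq with i ≟ j
... | yes i≡j = i≡j
... | no i≢j = contradiction eq (AllPairs-lookup ≢-sym un i j i≢j)

module Enumeration {d : ℕ} (xs : List (Fin d)) (un : Unique xs) (mem : ∀ x → x ∈ xs) where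

  length≡ : length xs ≡ d
  length≡ = ≤-antisym (injective⇒≤ {f = lookup xs} (lookup-unique un))
    (injective⇒≤ {f = λ x → index (mem x)} λ {x} {y} eq →
      trans (lookup-index (mem x)) (trans (cong (lookup xs) eq) (sym (lookup-index (mem y)))))

  position : Permutation′ d
  position = permutation (λ x → cast length≡ (index (mem x))) (λ i → lookup xs (cast (sym length≡) i))
    (λ i → toℕ-injective (trans (toℕ-cast length≡ _) (trans
      (cong toℕ (lookup-unique un (sym (lookup-index (mem (lookup xs (cast (sym length≡) i)))))))
      (toℕ-cast (sym length≡) i))))
    (λ x → trans (cong (lookup xs) (cast-involutive (sym length≡) length≡ (index (mem x))))
      (sym (lookup-index (mem x))))

  toℕ-position : ∀ x → toℕ (position ⟨$⟩ʳ x) ≡ toℕ (index (mem x))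
  toℕ-position x = toℕ-cast length≡ (index (mem x))

  position-injective : ∀ {x y} → toℕ (position ⟨$⟩ʳ x) ≡ toℕ (position ⟨$⟩ʳ y) → x ≡ y
  position-injective {x} {y} eq = trans (lookup-index (mem x)) (trans (cong (lookup xs)
    (toℕ-injective (trans (sym (toℕ-position x)) (trans eq (toℕ-position y))))) (sym (lookup-index (mem y))))

-- The cliques are `P` together with `c 0` and `R` together with `c l`; for `l = 0` they share this
-- vertex. Primed fields are the non-adjacencies.
record CliquesAndPath {d : ℕ} (C : Fin d → Fin d → Set) (P : List (Fin d)) (c : ℕ → Fin d) (l : ℕ)
  (R : List (Fin d)) : Set where
  field
    C-sym  : ∀ {x y} → C x y → C y x
    irrefl : ∀ {x} → ¬ C x x
    PP : ∀ {x y} → x ∈ P → y ∈ P → x ≢ y → C x y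
    RR : ∀ {x y} → x ∈ R → y ∈ R → x ≢ y → C x y
    PR : ∀ {x y} → x ∈ P → y ∈ R → ¬ C x y
    Pc : ∀ {x} → x ∈ P → C x (c 0)
    Pc′ : ∀ {x i} → x ∈ P → 1 ≤ i → i ≤ l → ¬ C x (c i)
    cR : ∀ {y} → y ∈ R → C (c l) y
    cR′ : ∀ {i y} → i < l → y ∈ R → ¬ C (c i) y
    cc : ∀ {i} → i < l → C (c i) (c (suc i))
    cc′ : ∀ {i j} → suc i < j → j ≤ l → ¬ C (c i) (c j)

module _ {d : ℕ} {C : Fin d → Fin d → Set} {P R : List (Fin d)} {c : ℕ → Fin d} {l : ℕ}
  (spec : CliquesAndPath C P c l R) (un : Unique (P ++ applyUpTo c (suc l) ++ R))
  (mem : ∀ x → x ∈ P ++ applyUpTo c (suc l) ++ R) (balanced : length P ≡ length R) where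

  open CliquesAndPath spec
  open Enumeration (P ++ applyUpTo c (suc l) ++ R) un mem

  private
    p = length P

    data Place (i : ℕ) (x : Fin d) : Set where
      left   : x ∈ P → i < p → Place i x
      middle : ∀ j → j ≤ l → i ≡ p + j → x ≡ c j → Place i x
      right  : x ∈ R → p + suc l ≤ i → Place i x

    place : ∀ x → Place (toℕ (position ⟨$⟩ʳ x)) x
    place x with ∈-split P (mem x)
    ... | inj₁ (i , eq) = left i (subst (_< p) (sym (trans (toℕ-position x) eq)) (toℕ<n (index i)))
    ... | inj₂ (m , eq) with ∈-split (applyUpTo c (suc l)) m
    ...   | inj₁ (i , eq′) = middle (toℕ (index i)) (s≤s⁻¹ (subst (toℕ (index i) <_) (length-applyUpTo c (suc l)) (toℕ<n (index i))))
              (trans (toℕ-position x) (trans eq (cong (p +_) eq′))) (∈-applyUpTo c (suc l) i)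
    ...   | inj₂ (i , eq′) = right i (subst (p + suc l ≤_)
              (sym (trans (toℕ-position x) (trans eq (cong (p +_) (trans eq′ (cong (_+ toℕ (index i)) (length-applyUpTo c (suc l))))))))
              (+-monoʳ-≤ p (m≤m+n (suc l) _)))

    size : d ≡ p + (suc l + p)
    size = trans (sym length≡) (trans (length-++ P) (cong (p +_) (trans (length-++ (applyUpTo c (suc l)))
      (cong₂ _+_ (length-applyUpTo c (suc l)) (sym balanced)))))

    d∸a : d ∸ suc p ≡ p + l
    d∸a = trans (cong (_∸ suc p) (trans size (linear 2 (λ p l → ⊢ p ⊕ (1+ l ⊕ p) ≐ p ⊕ l ⊕ (1+ p)) p l)))
      (m+n∸n≡m (p + l) (suc p))

    Adjacent : ℕ → ℕ → Set
    Adjacent i j = i ≢ j × ((i < suc p × j < suc p) ⊎ (p + l ≤ i × p + l ≤ j) ⊎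
      (p ≤ i × j ≡ suc i × j ≤ p + l) ⊎ (p ≤ j × i ≡ suc j × i ≤ p + l))

    Adjacent-sym : ∀ {i j} → Adjacent i j → Adjacent j i
    Adjacent-sym (i≢j , inj₁ (a , b)) = ≢-sym i≢j , inj₁ (b , a)
    Adjacent-sym (i≢j , inj₂ (inj₁ (a , b))) = ≢-sym i≢j , inj₂ (inj₁ (b , a))
    Adjacent-sym (i≢j , inj₂ (inj₂ (inj₁ q))) = ≢-sym i≢j , inj₂ (inj₂ (inj₂ q))
    Adjacent-sym (i≢j , inj₂ (inj₂ (inj₂ q))) = ≢-sym i≢j , inj₂ (inj₂ (inj₁ q))

    -- `Adjacent` for `i < j`: each clique condition shrinks to a single bound and only one
    -- direction of the path is left, which shortens the analysis of pairs of places.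
    data Ordered (i j : ℕ) : Set where
      below  : j ≤ p → Ordered i j
      above  : p + l ≤ i → Ordered i j
      along  : p ≤ i → j ≡ suc i → j ≤ p + l → Ordered i j

    ordered⇒ : ∀ {i j} → i < j → Ordered i j → Adjacent i j
    ordered⇒ i<j (below j≤) = <⇒≢ i<j , inj₁ (≤-trans i<j (m≤n⇒m≤1+n j≤) , s≤s j≤)
    ordered⇒ i<j (above i≥) = <⇒≢ i<j , inj₂ (inj₁ (i≥ , ≤-trans i≥ (<⇒≤ i<j)))
    ordered⇒ i<j (along i≥ eq j≤) = <⇒≢ i<j , inj₂ (inj₂ (inj₁ (i≥ , eq , j≤)))

    ⇒ordered : ∀ {i j} → i < j → Adjacent i j → Ordered i j
    ⇒ordered i<j (_ , inj₁ (_ , j<)) = below (s≤s⁻¹ j<)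
    ⇒ordered i<j (_ , inj₂ (inj₁ (i≥ , _))) = above i≥
    ⇒ordered i<j (_ , inj₂ (inj₂ (inj₁ (i≥ , eq , j≤)))) = along i≥ eq j≤
    ⇒ordered i<j (_ , inj₂ (inj₂ (inj₂ (_ , refl , _)))) = contradiction i<j (<⇒≱ (m<n⇒m<1+n (n<1+n _)))

    misplaced : ∀ {i j} → i < j → p ≤ i → j < p → ⊥
    misplaced i<j p≤i j<p = <⇒≱ (<-trans i<j j<p) p≤i

    to< : ∀ {i j x y} → i < j → Place i x → Place j y → C x y → Ordered i j
    to< i<j (left _ _) (left _ j<) _ = below (<⇒≤ j<)
    to< i<j (left _ _) (middle zero _ eq refl) _ = below (≤-reflexive (trans eq (+-identityʳ p)))
    to< i<j (left x∈ _) (middle (suc j) j≤ _ refl) h = contradiction h (Pc′ x∈ (s≤s z≤n) j≤)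
    to< i<j (left x∈ _) (right y∈ _) h = contradiction h (PR x∈ y∈)
    to< i<j (middle a _ refl _) (left _ j<) _ = ⊥-elim (misplaced i<j (m≤m+n p a) j<)
    to< i<j (middle a _ refl refl) (middle b b≤ refl refl) h with suc a ℕ.≟ b
    ... | yes refl = along (m≤m+n p a) (+-suc p a) (+-monoʳ-≤ p b≤)
    ... | no a+1≢b = contradiction h (cc′ (≤∧≢⇒< (+-cancelˡ-< p a b i<j) a+1≢b) b≤)
    to< i<j (middle a a≤ refl refl) (right y∈ _) h with a ℕ.≟ l
    ... | yes refl = above ≤-refl
    ... | no a≢l = contradiction h (cR′ (≤∧≢⇒< a≤ a≢l) y∈)
    to< i<j (right _ i≥) (left _ j<) _ = ⊥-elim (misplaced i<j (≤-trans (m≤m+n p (suc l)) i≥) j<)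
    to< i<j (right _ i≥) (middle b b≤ refl _) _ =
      ⊥-elim (<⇒≱ i<j (≤-trans (+-monoʳ-≤ p (m≤n⇒m≤1+n b≤)) i≥))
    to< i<j (right _ i≥) (right _ _) _ = above (≤-trans (+-monoʳ-≤ p (n≤1+n l)) i≥)

    from< : ∀ {i j x y} → x ≢ y → i < j → Place i x → Place j y → Ordered i j → C x y
    from< x≢y i<j (left x∈ _) (left y∈ _) _ = PP x∈ y∈ x≢y
    from< x≢y i<j (left x∈ _) (middle zero _ _ refl) _ = Pc x∈
    from< x≢y i<j (left _ i<) (middle (suc b) _ refl _) (below j≤) = contradiction j≤ (<⇒≱ (m<m+n p (s≤s z≤n)))
    from< x≢y i<j (left _ i<) (middle (suc b) _ _ _) (above i≥) = contradiction (≤-trans (m≤m+n p l) i≥) (<⇒≱ i<)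
    from< x≢y i<j (left _ i<) (middle (suc b) _ _ _) (along i≥ _ _) = contradiction i≥ (<⇒≱ i<)
    from< x≢y i<j (left _ i<) (right _ j≥) (below j≤) = contradiction (≤-trans j≥ j≤) (<⇒≱ (m<m+n p (s≤s z≤n)))
    from< x≢y i<j (left _ i<) (right _ _) (above i≥) = contradiction (≤-trans (m≤m+n p l) i≥) (<⇒≱ i<)
    from< x≢y i<j (left _ i<) (right _ _) (along i≥ _ _) = contradiction i≥ (<⇒≱ i<)
    from< x≢y i<j (middle a _ refl _) (left _ j<) _ = ⊥-elim (misplaced i<j (m≤m+n p a) j<)
    from< x≢y i<j (middle a _ refl _) (middle b _ _ _) (below j≤) = contradiction (≤-trans i<j j≤) (≤⇒≯ (m≤m+n p a))
    from< x≢y i<j (middle a _ refl _) (middle b b≤ refl _) (above i≥) = contradiction (≤-trans (+-monoʳ-≤ p b≤) i≥) (<⇒≱ i<j)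
    from< x≢y i<j (middle a _ refl refl) (middle b b≤ refl refl) (along _ eq _)
      with +-cancelˡ-≡ p b (suc a) (trans eq (sym (+-suc p a)))
    ... | refl = cc b≤
    from< x≢y i<j (middle a _ refl _) (right _ _) (below j≤) = contradiction (≤-trans i<j j≤) (≤⇒≯ (m≤m+n p a))
    from< x≢y i<j (middle a a≤ refl refl) (right y∈ _) (above i≥)
      with ≤-antisym a≤ (+-cancelˡ-≤ p l a i≥)
    ... | refl = cR y∈
    from< x≢y i<j (middle a _ _ _) (right _ j≥) (along _ _ j≤) = contradiction (≤-trans j≥ j≤) (<⇒≱ (+-monoʳ-< p (n<1+n l)))
    from< x≢y i<j (right _ i≥) (left _ j<) _ = ⊥-elim (misplaced i<j (≤-trans (m≤m+n p (suc l)) i≥) j<)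
    from< x≢y i<j (right _ i≥) (middle b b≤ refl _) _ =
      ⊥-elim (<⇒≱ i<j (≤-trans (+-monoʳ-≤ p (m≤n⇒m≤1+n b≤)) i≥))
    from< x≢y i<j (right x∈ _) (right y∈ _) _ = RR x∈ y∈ x≢y

    to : ∀ {i j x y} → i ≢ j → Place i x → Place j y → C x y → Adjacent i j
    to {i} {j} i≢j x y h with <-cmp i j
    ... | tri< i<j _ _ = ordered⇒ i<j (to< i<j x y h)
    ... | tri≈ _ i≡j _ = contradiction i≡j i≢j
    ... | tri> _ _ j<i = Adjacent-sym (ordered⇒ j<i (to< j<i y x (C-sym h)))

    from : ∀ {i j x y} → x ≢ y → Place i x → Place j y → Adjacent i j → C x y
    from {i} {j} x≢y x y adj with <-cmp i j
    ... | tri< i<j _ _ = from< x≢y i<j x y (⇒ordered i<j adj)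
    ... | tri≈ _ i≡j _ = contradiction i≡j (proj₁ adj)
    ... | tri> _ _ j<i = C-sym (from< (≢-sym x≢y) j<i y x (⇒ordered j<i (Adjacent-sym adj)))

  twoCliques : TwoCliquesJoinedByPath d C
  -- A clique has the `p` members of its list and one end of the path.
  twoCliques = suc p , s≤s z≤n ,
    linear 3 (λ d p l → d ≐ p ⊕ (1+ l ⊕ p) ⇒ ⊢ 1+ p ⊕ (1+ p) ≼ 1+ d) d p l size ,
    position , λ x y → adjacency x y
    where
    adjacency : ∀ x y → C x y ⇔ twoCliquesAdj d (suc p) (toℕ (position ⟨$⟩ʳ x)) (toℕ (position ⟨$⟩ʳ y))
    adjacency x y rewrite d∸a = mk⇔
      (λ h → to (λ eq → irrefl (subst (C x) (sym (position-injective eq)) h)) (place x) (place y) h)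
      (λ adj → from (λ { refl → proj₁ adj refl }) (place x) (place y) adj)

module _ {d : ℕ} {C : Fin d → Fin d → Set} {c : ℕ → Fin d} {l : ℕ}
  (C-sym : ∀ {x y} → C x y → C y x) (irrefl : ∀ {x} → ¬ C x x)
  (cc : ∀ {i} → i < l → C (c i) (c (suc i))) (closing : C (c l) (c 0))
  (cc′ : ∀ {i j} → suc i < j → j ≤ l → i ≢ 0 ⊎ j ≢ l → ¬ C (c i) (c j))
  (un : Unique (applyUpTo c (suc l))) (mem : ∀ x → x ∈ applyUpTo c (suc l)) where

  open Enumeration (applyUpTo c (suc l)) un mem

  hamiltonCycle : HamiltonCycle d C
  hamiltonCycle = position , adjacency
    where
    size : suc l ≡ d
    size = trans (sym (length-applyUpTo c (suc l))) length≡
    at′ : ∀ x → x ≡ c (toℕ (position ⟨$⟩ʳ x))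
    at′ x = subst (λ i → x ≡ c i) (sym (toℕ-position x)) (∈-applyUpTo c (suc l) (mem x))
    bound : ∀ x → toℕ (position ⟨$⟩ʳ x) ≤ l
    bound x = s≤s⁻¹ (subst (toℕ (position ⟨$⟩ʳ x) <_) (sym size) (toℕ<n (position ⟨$⟩ʳ x)))
    to< : ∀ {i j} → i < j → j ≤ l → C (c i) (c j) → cycleAdj d i j
    to< {i} {j} i<j j≤ h with suc i ℕ.≟ j | i ℕ.≟ 0 | j ℕ.≟ l
    ... | yes eq | _ | _ = inj₁ (sym eq)
    ... | no _ | yes i≡0 | yes refl = inj₂ (inj₂ (inj₂ (size , i≡0)))
    ... | no ne | no i≢0 | _ = contradiction h (cc′ (≤∧≢⇒< i<j ne) j≤ (inj₁ i≢0))
    ... | no ne | yes _ | no j≢l = contradiction h (cc′ (≤∧≢⇒< i<j ne) j≤ (inj₂ j≢l))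
    flip : ∀ {i j} → cycleAdj d i j → cycleAdj d j i
    flip (inj₁ q) = inj₂ (inj₁ q)
    flip (inj₂ (inj₁ q)) = inj₁ q
    flip (inj₂ (inj₂ (inj₁ q))) = inj₂ (inj₂ (inj₂ q))
    flip (inj₂ (inj₂ (inj₂ q))) = inj₂ (inj₂ (inj₁ q))
    to : ∀ i j → i ≤ l → j ≤ l → C (c i) (c j) → cycleAdj d i j
    to i j i≤ j≤ h with <-cmp i j
    ... | tri< i<j _ _ = to< i<j j≤ h
    ... | tri≈ _ refl _ = contradiction h irrefl
    ... | tri> _ _ j<i = flip (to< j<i i≤ (C-sym h))
    from : ∀ i j → i ≤ l → j ≤ l → cycleAdj d i j → C (c i) (c j)
    from i j i≤ j≤ (inj₁ refl) = cc j≤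
    from i j i≤ j≤ (inj₂ (inj₁ refl)) = C-sym (cc i≤)
    from i j i≤ j≤ (inj₂ (inj₂ (inj₁ (eq , refl)))) with suc-injective (trans eq (sym size))
    ... | refl = closing
    from i j i≤ j≤ (inj₂ (inj₂ (inj₂ (eq , refl)))) with suc-injective (trans eq (sym size))
    ... | refl = C-sym closing
    adjacency : ∀ x y → C x y ⇔ cycleAdj d (toℕ (position ⟨$⟩ʳ x)) (toℕ (position ⟨$⟩ʳ y))
    adjacency x y = mk⇔
      (λ h → to _ _ (bound x) (bound y) (subst (C _) (at′ y) (subst (λ z → C z y) (at′ x) h)))
      (λ adj → subst (λ z → C z y) (sym (at′ x)) (subst (C _) (sym (at′ y)) (from _ _ (bound x) (bound y) adj)))

-- Blobs

module Blobs {m : ℕ} (s : Fin m) (nb : ℕ) (B : ℕ → Fin m → Bool)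
  (noS : ∀ {i} → i < nb → B i s ≡ false)
  (disjoint : ∀ {i j v} → i < nb → j < nb → B i v ≡ true → B j v ≡ true → i ≡ j)
  (cover : ∀ v → v ≢ s → ∃ λ i → i < nb × B i v ≡ true) where

  β : Fin m → Maybe (Fin nb)
  β v with v ≟ s
  ... | yes _ = nothing
  ... | no v≢s = just (fromℕ< (proj₁ (proj₂ (cover v v≢s))))

  β-nothing : ∀ v → (β v ≡ nothing) ⇔ (v ≡ s)
  β-nothing v with v ≟ s
  ... | yes v≡s = mk⇔ (λ _ → v≡s) (λ _ → refl)
  ... | no v≢s = mk⇔ (λ ()) (λ v≡s → contradiction v≡s v≢s)

  inBlob-β : ∀ {j} → j < nb → inBlob β j ≗ B j
  inBlob-β {j} j< v with v ≟ s
  ... | yes refl = sym (noS j<)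
  ... | no v≢s with cover v v≢s
  ...   | i , i< , Bi with i ℕ.≟ j
  ...     | yes refl = trans (≡ᵇ-true (toℕ-fromℕ< i<)) (sym Bi)
  ...     | no i≢j = trans (≡ᵇ-false (i≢j ∘ trans (sym (toℕ-fromℕ< i<))))
              (sym (¬true⇒false λ Bj → i≢j (disjoint i< j< Bi Bj)))

-- The lifting graph, and the case of two dangerous sets holding all edges at s

module SpecialCase (G : Graph) (s : Fin (n G)) (k : ℕ) (loopless : Loopless G)
  (sk : SKEdgeConnected G s k) (2≤k : 2 ≤ k) (4<d : 4 < deg G s) where

  open Dangerously G s k loopless sk 2≤k 4<d public

  L : Fin d → Fin d → Set
  L = LiftGraph G s k

  C : Fin d → Fin d → Set
  C = Complement d L

  infix 4 _~_

  _~_ : Fin d → Fin d → Set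
  _~_ = Together G s k

  ~-sym : ∀ {x y} → x ~ y → y ~ x
  ~-sym (together X dX Xx Xy) = together X dX Xy Xx

  C⇒~ : ∀ {x y} → C x y → x ~ y
  C⇒~ {x} {y} (x≢y , ¬L) = decidable-stable (together? G s k x y) λ apart →
    ¬L (apart⇒liftable G s k sk {x} {y} x≢y apart)

  ~⇒C : ∀ {x y} → x ≢ y → x ~ y → C x y
  ~⇒C {x} {y} x≢y x~y = x≢y , λ l → proj₂ (liftable⇒apart G s k sk {x} {y} l) x~y

  C-sym : ∀ {x y} → C x y → C y x
  C-sym {x} {y} h@(x≢y , _) = ~⇒C {y} {x} (≢-sym x≢y) (~-sym (C⇒~ {x} {y} h))

  C-irrefl : ∀ {x} → ¬ C x x
  C-irrefl (x≢x , _) = x≢x refl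

  e-split : ∀ (X Y : V → Bool) → e X S ≡ e (X ∩ Y) S + e (X ─ Y) S
  e-split X Y = regions-≡ id (X ∷ Y ∷ S ∷ []) ok
    (join in₁ in₃ ∷ []) (join (in₁ ∩ in₂) in₃ ∷ join (in₁ ─ in₂) in₃ ∷ []) (edges G) (λ {ab} ab∈ → okay ab∈)
    where
    ok : EdgePredicate 3
    -- Labels alone do not exclude an edge with both ends in `S` whose ends differ in `Y`; it would
    -- count once on the left and twice on the right.
    ok a b = not (in₃ a ∧ in₃ b)
    okay : ∀ {ab} → ab ∈ edges G → at id (X ∷ Y ∷ S ∷ []) ok ab ≡ true
    okay {a , b} ab∈ with a ≟ s | b ≟ s
    ... | no _ | _ = refl
    ... | yes _ | no _ = refl
    ... | yes refl | yes refl = contradiction refl (subst (λ ab → proj₁ ab ≢ proj₂ ab)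
            (sym (lookup-index ab∈)) (loopless (index ab∈)))

  tipsOf : (V → Bool) → List (Fin d)
  tipsOf A = filterᵇ (A ∘ t) (allFin d)

  ∈-tipsOf : ∀ A {x} → x ∈ tipsOf A → A ∋ x
  ∈-tipsOf A x∈ = Equivalence.to T-≡ (proj₂ (∈-filter⁻ (T? ∘ A ∘ t) {xs = allFin d} x∈))

  tipsOf-∈ : ∀ A {x} → A ∋ x → x ∈ tipsOf A
  tipsOf-∈ A {x} x∈ = ∈-filter⁺ (T? ∘ A ∘ t) (∈-allFin x) (Equivalence.from T-≡ x∈)

  -- Lets blobs be handled as plain vertex sets `B i`: edge counts carry over along `inBlob-β`, and
  -- the connectivity of a blob needs no more than `δ (B i) ≤ k`.
  structureClaim : ∀ (Str : (r nb : ℕ) → (V → Maybe (Fin nb)) → Set) {I : Set} r nb (B : ℕ → V → Bool) →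
    (noS : ∀ {i} → i < nb → B i s ≡ false)
    (disjoint : ∀ {i j v} → i < nb → j < nb → B i v ≡ true → B j v ≡ true → i ≡ j)
    (cover : ∀ v → v ≢ s → ∃ λ i → i < nb × B i v ≡ true) →
    ((∀ {i p q} → i < nb → p < nb → q < nb →
        δ (B i) ≡ suc (2 * r) → e (B i) S ≡ 1 → e (B i) (B p) ≡ r → e (B i) (B q) ≡ r →
        BlobCondition G s r (Blobs.β s nb B noS disjoint cover) i p q) →
      Str r nb (Blobs.β s nb B noS disjoint cover)) →
    (k ≡ suc (2 * r) × (∀ i → i < nb → δ (B i) ≤ k)) ⊎
    (I × k ≤ suc (2 * r) × nb ≡ 3 × (∀ i → i < nb → i ≢ 1 → δ (B i) ≤ k)) →
    StructureClaim G s k Str I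
  structureClaim Str {I} r nb B noS disjoint cover str conn =
    r , nb , (β , β-nothing) ,
    str (λ i< p< q< δB eS ep eq →
      trans (boundary-cong G (inBlob-β i<)) δB ,
      trans (e-cong (inBlob-β i<) (λ _ → refl)) eS ,
      trans (e-cong (inBlob-β i<) (inBlob-β p<)) ep ,
      trans (e-cong (inBlob-β i<) (inBlob-β q<)) eq) ,
    connect conn
    where
    open Blobs s nb B noS disjoint cover
    blob-connected : ∀ i → i < nb → δ (B i) ≤ k → InducedEdgeConnected G (inBlob β i) ⌈ k /2⌉
    blob-connected i i< small = induced-connected (trans (inBlob-β i< s) (noS i<))
      (subst (_≤ k) (sym (boundary-cong G (inBlob-β i<))) small)
    connect : (k ≡ suc (2 * r) × (∀ i → i < nb → δ (B i) ≤ k)) ⊎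
      (I × k ≤ suc (2 * r) × nb ≡ 3 × (∀ i → i < nb → i ≢ 1 → δ (B i) ≤ k)) → _
    connect (inj₁ (odd , small)) = inj₁ (odd , λ i i< → blob-connected i i< (small i i<))
    connect (inj₂ (i , k≤ , three , small)) = inj₂ (i , k≤ , three , λ i i< i≢1 → blob-connected i i< (small i i< i≢1))

  record Special : Set where
    field
      x₀ : Fin d
      X Y : V → Bool
      dX : D X
      dY : D Y
      Xx₀ : X ∋ x₀
      Yx₀ : Y ∋ x₀
      covers : ∀ z → X ∋ z ⊎ Y ∋ z

  special? : Dec Special
  special? = map′
    (λ (x , X , Y , dX , dY , p , q , c) → record { x₀ = x ; X = X ; Y = Y ; dX = dX ; dY = dY ; Xx₀ = p ; Yx₀ = q ; covers = λ z → ∨-true (c z) })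
    (λ sp → let open Special sp in x₀ , X , Y , dX , dY , Xx₀ , Yx₀ , λ z → [ ∨-trueˡ , ∨-trueʳ {X (t z)} ]′ (covers z))
    (any? λ x → anySet?
      (λ h (Y , dX , dY , p , q , c) → Y , Dangerous-cong h dX , dY , trans (sym (h _)) p , q ,
        λ z → trans (cong (_∨ Y (t z)) (sym (h (t z)))) (c z))
      λ X → anySet?
        (λ h (dX , dY , p , q , c) → dX , Dangerous-cong h dY , p , trans (sym (h _)) q ,
          λ z → trans (cong (X (t z) ∨_) (sym (h (t z)))) (c z))
        λ Y → dangerous? G s k X ×-dec dangerous? G s k Y ×-dec (X (t x) Bool.≟ true) ×-dec (Y (t x) Bool.≟ true)
          ×-dec all? (λ z → (X (t z) ∨ Y (t z)) Bool.≟ true))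

  module _ (sp : Special) where

    open Special sp

    private
      v∈ : ∃ λ z → X ∋ z × Y ∌ z
      v∈ with misses dY Yx₀
      ... | z , z∉ = z , [ id , (λ Yz → ⊥-elim (true≢false Yz z∉)) ]′ (covers z) , z∉

      w∈ : ∃ λ z → Y ∋ z × X ∌ z
      w∈ with misses dX Xx₀
      ... | z , z∉ = z , [ (λ Xz → ⊥-elim (true≢false Xz z∉)) , id ]′ (covers z) , z∉

      cr : Crosses X Y x₀
      cr = crossing-facts dX dY Xx₀ Yx₀ (─-intro (proj₁ (proj₂ v∈)) (proj₂ (proj₂ v∈)))
        (─-intro (proj₁ (proj₂ w∈)) (proj₂ (proj₂ w∈)))

      open Crosses cr

      k≤δ∩ : k ≤ δ (X ∩ Y)
      k≤δ∩ = cuts (X ∩ Y) (∧-falseˡ (avoids dX)) (∩-intro Xx₀ Yx₀) (t≢s (proj₁ v∈))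
        (∧-falseʳ {X (t (proj₁ v∈))} (proj₂ (proj₂ v∈)))

      all-tips : e (X ∪ Y) S ≡ d
      all-tips = trans (sym (countᶠ-tip G s (X ∪ Y) (∨-false (avoids dX) (avoids dY))))
        (trans (count-true ((X ∪ Y) ∘ t) (allFin d) (λ z → [ ∨-trueˡ , ∨-trueʳ {X (t z)} ]′ (covers z))) (length-tabulate id))

    -- Vertices outside `X ∪ Y` and `s` would form a cut with `δ (X ∪ Y) - d` boundary edges, as all
    -- edges at `s` end in the union. Submodularity bounds `δ (X ∪ Y)` by `k + 2`, so this cut would
    -- have fewer than `k`.
    covers-V : ∀ v → v ≢ s → X v ≡ true ⊎ Y v ≡ true
    covers-V v v≢s with (X ∪ Y) v in eq
    ... | true = ∨-true eq
    ... | false = ⊥-elim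
      (linear 7 (λ k w u d i a b → w ⊕ (d ⊕ d) ≐ u ⊕ d ⇒ k ≼ w ⇒ i ⊕ u ≼ a ⊕ b ⇒ a ≐ 1+ k ⇒ b ≐ 1+ k ⇒ k ≼ i ⇒ # 5 ≼ d ⇒ ⊢⊥)
        k (δ (∁ ((X ∪ Y) ∪ S))) (δ (X ∪ Y)) d (δ (X ∩ Y)) (δ X) (δ Y)
        (trans (cong (λ a → δ (∁ ((X ∪ Y) ∪ S)) + (a + a)) (sym all-tips))
          (δ-complement {X ∪ Y} (∨-false (avoids dX) (avoids dY))))
        (cuts (∁ ((X ∪ Y) ∪ S)) (rest-s {X ∪ Y}) (rest-nonempty {X ∪ Y} v≢s eq) (t≢s x₀) (cong not (∨-trueˡ (∨-trueˡ Xx₀))))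
        (uncross-∩ X Y) δX δY k≤δ∩ 4<d)

    private
      split-X : e X S ≡ e (X ∩ Y) S + e (X ─ Y) S
      split-X = e-split X Y

      split-Y : e Y S ≡ e (X ∩ Y) S + e (Y ─ X) S
      split-Y = trans (e-split Y X) (cong (_+ e (Y ─ X) S) (e-cong (λ v → Bool.∧-comm (Y v) (X v)) (λ _ → refl)))

      split-∪ : e (X ∪ Y) S ≡ e X S + e (Y ─ X) S
      split-∪ = trans (e-split (X ∪ Y) X) (cong₂ _+_
        (e-cong (λ v → absorb (X v) (Y v)) (λ _ → refl)) (e-cong (λ v → remove′ (X v) (Y v)) (λ _ → refl)))
        where
        absorb : ∀ a b → (a ∨ b) ∧ a ≡ a
        absorb true _ = refl
        absorb false b = Bool.∧-zeroʳ b
        remove′ : ∀ a b → (a ∨ b) ∧ not a ≡ b ∧ not a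
        remove′ true b = sym (Bool.∧-zeroʳ b)
        remove′ false b = refl

    -- `X` and `Y` together hold `d + 1` edges at `s`, the shared one counting twice, and each holds
    -- at most half of `d + 1`. So both hold exactly half.
    sides-equal : e (X ─ Y) S ≡ e (Y ─ X) S
    sides-equal = linear 7 (λ x y i xy yx u d → x ≐ i ⊕ xy ⇒ y ≐ i ⊕ yx ⇒ u ≐ x ⊕ yx ⇒ u ≐ d ⇒ i ≐ # 1 ⇒ x ⊕ x ≼ 1+ d ⇒ y ⊕ y ≼ 1+ d ⇒ ⊢ xy ≐ yx)
      (e X S) (e Y S) (e (X ∩ Y) S) (e (X ─ Y) S) (e (Y ─ X) S) (e (X ∪ Y) S) d
      split-X split-Y split-∪ all-tips tip≡1 (half dX Xx₀) (half dY Yx₀)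

    degree-odd : Odd d
    degree-odd = e (X ─ Y) S , linear 6 (λ x i xy yx u d → x ≐ i ⊕ xy ⇒ u ≐ x ⊕ yx ⇒ u ≐ d ⇒ i ≐ # 1 ⇒ xy ≐ yx ⇒ ⊢ d ≐ 1+ (2 ⊛ xy))
      (e X S) (e (X ∩ Y) S) (e (X ─ Y) S) (e (Y ─ X) S) (e (X ∪ Y) S) d
      split-X split-∪ all-tips tip≡1 sides-equal

    private
      -- Such a set would hold all edges at `s` except possibly the shared one, which is too many
      -- for `half`.
      swallows : ∀ {Z} → D Z → (∀ v → (X ─ Y) v ≡ true → Z v ≡ true) → (∀ v → (Y ─ X) v ≡ true → Z v ≡ true) →
        ∀ {u} → Z u ≡ true → ⊥
      swallows {Z} dZ A⊆ B⊆ Zu =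
        linear 3 (λ z i d → d ≼ z ⊕ i ⇒ i ≐ # 1 ⇒ z ⊕ z ≼ 1+ d ⇒ # 5 ≼ d ⇒ ⊢⊥) (e Z S) (e (X ∩ Y) S) d
          (≤-trans (≤-reflexive (sym degree))
            (regions-≤ id Xs (bothEnds ω) (join (∁ in₄) in₄ ∷ []) (join in₃ in₄ ∷ join (in₁ ∩ in₂) in₄ ∷ [])
              (edges G) (λ {ab} _ → bothEnds-at id Xs ω ok ab)))
          tip≡1 (half dZ Zu) 4<d
        where
        Xs = X ∷ Y ∷ Z ∷ S ∷ []
        ω : Label 4 → Bool
        ω = in₄ ∪ in₃ ∪ (in₁ ∩ in₂)
        ok : ∀ v → ω (label Xs v) ≡ true
        ok v with v ≟ s
        ... | yes _ = refl
        ... | no v≢s with X v in xv | Y v in yv | Z v in zv | covers-V v v≢s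
        ...   | _ | _ | true | _ = refl
        ...   | true | true | false | _ = refl
        ...   | true | false | false | _ = ⊥-elim (true≢false (A⊆ v (─-intro xv yv)) zv)
        ...   | false | true | false | _ = ⊥-elim (true≢false (B⊆ v (─-intro yv xv)) zv)
        ...   | false | false | false | inj₁ ()
        ...   | false | false | false | inj₂ ()

      absorbs : ∀ {A Z} → A s ≡ false → δ A ≡ k → D Z → ∀ {x w} → A ∋ x → Z ∋ x → (Z ─ A) w ≡ true →
        ∀ v → A v ≡ true → Z v ≡ true
      absorbs {A} {Z} as δA dZ Ax Zx w∈ v Av with Z v in zv
      ... | true = refl
      ... | false = ⊥-elim (tight-comparable {A} as δA dZ Ax Zx {v} (─-intro Av zv) w∈)

      -- A dangerous set with an end on each side meets both tight differences and is contained in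
      -- neither. By `tight-comparable` it contains both.
      apart : ∀ {x y} → X ∋ x → Y ∌ x → Y ∋ y → X ∌ y → ¬ x ~ y
      apart {x} {y} Xx Yx Yy Xy (together Z dZ Zx Zy) = swallows dZ
        (absorbs {X ─ Y} (∧-falseˡ (avoids dX)) δX─Y dZ {x} {t y} (─-intro Xx Yx) Zx (─-intro Zy (∧-falseˡ Xy)))
        (absorbs {Y ─ X} (∧-falseˡ (avoids dY)) δY─X dZ {y} {t x} (─-intro Yy Xy) Zy (─-intro Zx (∧-falseˡ Yx)))
        Zx

      in-Y : ∀ {z} → X ∌ z → Y ∋ z
      in-Y {z} z∉ = [ (λ z∈ → ⊥-elim (true≢false z∈ z∉)) , id ]′ (covers z)

      not-Y : ∀ {z} → z ≢ x₀ → X ∋ z → Y ∌ z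
      not-Y z≢ z∈ = ¬true⇒false λ Yz → z≢ (only z∈ Yz)

      x₀~ : ∀ z → x₀ ~ z
      x₀~ z = [ together X dX Xx₀ , together Y dY Yx₀ ]′ (covers z)

      same-side : ∀ {x y} b → X (t x) ≡ b → X (t y) ≡ b → x ~ y
      same-side true xx yy = together X dX xx yy
      same-side false xx yy = together Y dY (in-Y xx) (in-Y yy)

      sides-differ : ∀ {x y} → ¬ x ~ y → x ≢ x₀ × y ≢ x₀ × X (t x) ≢ X (t y)
      sides-differ {x} {y} ¬x~y = (λ { refl → ¬x~y (x₀~ y) }) , (λ { refl → ¬x~y (~-sym (x₀~ x)) }) ,
        λ eq → ¬x~y (same-side (X (t y)) eq refl)

      sides-apart : ∀ {x y} → x ≢ x₀ → y ≢ x₀ → ∀ a b → X (t x) ≡ a → X (t y) ≡ b → X (t x) ≢ X (t y) → ¬ x ~ y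
      sides-apart x≢ y≢ true false xx yy _ = apart xx (not-Y x≢ xx) (in-Y yy) yy
      sides-apart x≢ y≢ false true xx yy _ = apart yy (not-Y y≢ yy) (in-Y xx) xx ∘ ~-sym
      sides-apart x≢ y≢ true true xx yy differ = contradiction (trans xx (sym yy)) differ
      sides-apart x≢ y≢ false false xx yy differ = contradiction (trans xx (sym yy)) differ

    private
      left : ∀ x → not ⌊ x ≟ x₀ ⌋ ∧ X (t x) ≡ (X ─ Y) (t x)
      left x with x ≟ x₀
      ... | yes refl rewrite Xx₀ | Yx₀ = refl
      ... | no x≢ with X (t x) in xx
      ...   | false = refl
      ...   | true = sym (cong not (not-Y x≢ xx))

      right : ∀ x → not ⌊ x ≟ x₀ ⌋ ∧ not (X (t x)) ≡ (Y ─ X) (t x)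
      right x with x ≟ x₀
      ... | yes refl rewrite Xx₀ | Yx₀ = refl
      ... | no x≢ with X (t x) in xx
      ...   | true = sym (Bool.∧-zeroʳ (Y (t x)))
      ...   | false = sym (∩-intro (in-Y xx) refl)

      count-left : countᶠ d (λ x → not ⌊ x ≟ x₀ ⌋ ∧ X (t x)) ≡ e (X ─ Y) S
      count-left = trans (count-cong {p = λ x → not ⌊ x ≟ x₀ ⌋ ∧ X (t x)} {q = (X ─ Y) ∘ t} left (allFin d))
        (countᶠ-tip G s (X ─ Y) (∧-falseˡ (avoids dX)))

      count-right : countᶠ d (λ x → not ⌊ x ≟ x₀ ⌋ ∧ not (X (t x))) ≡ e (Y ─ X) S
      count-right = trans (count-cong {p = λ x → not ⌊ x ≟ x₀ ⌋ ∧ not (X (t x))} {q = (Y ─ X) ∘ t} right (allFin d))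
        (countᶠ-tip G s (Y ─ X) (∧-falseˡ (avoids dY)))

    adjacency : ∀ x y → L x y ⇔ (x ≢ x₀ × y ≢ x₀ × X (t x) ≢ X (t y))
    adjacency x y = mk⇔
      (λ l → sides-differ {x} {y} (proj₂ (liftable⇒apart G s k sk {x} {y} l)))
      (λ (x≢ , y≢ , differ) → apart⇒liftable G s k sk {x} {y} (differ ∘ cong (X ∘ t))
        (sides-apart {x} {y} x≢ y≢ (X (t x)) (X (t y)) refl refl differ))

    isolatedPlusBipartite : IsolatedPlusBalancedBipartite d L
    isolatedPlusBipartite = x₀ , (λ x → X (t x)) , adjacency ,
      trans count-left (trans sides-equal (sym count-right))

    private
      P = tipsOf (X ─ Y)
      R = tipsOf (Y ─ X)

      XY : ∀ {x} → x ∈ P → X ∋ x × Y ∌ x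
      XY {x} x∈ with ∧-true {X (t x)} (∈-tipsOf (X ─ Y) x∈)
      ... | p , q = p , not-true q

      YX : ∀ {x} → x ∈ R → Y ∋ x × X ∌ x
      YX {x} x∈ with ∧-true {Y (t x)} (∈-tipsOf (Y ─ X) x∈)
      ... | p , q = p , not-true q

      x₀∉P : ∀ {x} → x ∈ P → x ≢ x₀
      x₀∉P x∈ refl = true≢false Yx₀ (proj₂ (XY x∈))

      x₀∉R : ∀ {x} → x ∈ R → x ≢ x₀
      x₀∉R x∈ refl = true≢false Xx₀ (proj₂ (YX x∈))

    cliques : TwoCliquesJoinedByPath d C
    cliques = twoCliques {P = P} {R = R} {c = λ _ → x₀} {l = 0} spec
      (Unique.++⁺ (Unique.filter⁺ (T? ∘ (X ─ Y) ∘ t) (Unique.allFin⁺ d))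
        (All.tabulate (λ y∈ → ≢-sym (x₀∉R y∈)) ∷ Unique.filter⁺ (T? ∘ (Y ─ X) ∘ t) (Unique.allFin⁺ d))
        (λ { (x∈ , here refl) → x₀∉P x∈ refl
           ; (x∈ , there y∈) → true≢false (proj₁ (XY x∈)) (proj₂ (YX y∈)) }))
      complete
      (trans (countᶠ-tip G s (X ─ Y) (∧-falseˡ (avoids dX)))
        (trans sides-equal (sym (countᶠ-tip G s (Y ─ X) (∧-falseˡ (avoids dY))))))
      where
      complete : ∀ x → x ∈ P ++ x₀ ∷ R
      complete x with x ≟ x₀ | X (t x) in xx
      ... | yes refl | _ = ∈-++⁺ʳ P (here refl)
      ... | no x≢ | true = ∈-++⁺ˡ (tipsOf-∈ (X ─ Y) (─-intro xx (not-Y x≢ xx)))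
      ... | no x≢ | false = ∈-++⁺ʳ P (there (tipsOf-∈ (Y ─ X) (─-intro (in-Y xx) xx)))
      spec : CliquesAndPath C P (λ _ → x₀) 0 R
      spec = record
        { C-sym = C-sym ; irrefl = C-irrefl
        ; PP = λ x∈ y∈ x≢y → ~⇒C x≢y (together X dX (proj₁ (XY x∈)) (proj₁ (XY y∈)))
        ; RR = λ x∈ y∈ x≢y → ~⇒C x≢y (together Y dY (proj₁ (YX x∈)) (proj₁ (YX y∈)))
        ; PR = λ x∈ y∈ h → apart (proj₁ (XY x∈)) (proj₂ (XY x∈)) (proj₁ (YX y∈)) (proj₂ (YX y∈)) (C⇒~ h)
        ; Pc = λ x∈ → ~⇒C (x₀∉P x∈) (~-sym (x₀~ _))
        ; Pc′ = λ { _ (s≤s _) () }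
        ; cR = λ y∈ → ~⇒C (≢-sym (x₀∉R y∈)) (x₀~ _)
        ; cR′ = λ ()
        ; cc = λ ()
        ; cc′ = λ { (s≤s (s≤s _)) () }
        }

    -- The outer blobs are tight for either parity of `k`. For the middle one only
    -- `k ≤ δ (X ∩ Y) = 2 r + 1` is available, hence the second alternative of the claim.
    structure : StructureClaim G s k (PathStructure G s) (IsolatedPlusBalancedBipartite d L)
    structure = structureClaim (PathStructure G s) r 3 B noS disjoint cover str
      (inj₂ (isolatedPlusBipartite , subst (k ≤_) δM k≤δ∩ , refl , small′))
      where
      r = e (X ∩ Y) (X ─ Y)
      B : ℕ → V → Bool
      B 0 = X ─ Y
      B 1 = X ∩ Y
      B _ = Y ─ X
      δM : δ (X ∩ Y) ≡ suc (2 * r)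
      δM = linear 4 (λ m r q o → m ≐ r ⊕ (q ⊕ o) ⇒ r ≐ q ⇒ o ≐ # 1 ⇒ ⊢ m ≐ 1+ (2 ⊛ r))
        (δ (X ∩ Y)) r (e (X ∩ Y) (Y ─ X)) (e (X ∩ Y) (outside X Y)) (δ-∩ X Y) balanced out≡1
      noS : ∀ {i} → i < 3 → B i s ≡ false
      noS {0} _ = ∧-falseˡ (avoids dX)
      noS {1} _ = ∧-falseˡ (avoids dX)
      noS {suc (suc _)} _ = ∧-falseˡ (avoids dY)
      excl : ∀ a b → a ∧ not b ≡ true → b ≡ true → ⊥
      excl a b p q = true≢false q (not-true (proj₂ (∧-true {a} p)))
      disjoint : ∀ {i j v} → i < 3 → j < 3 → B i v ≡ true → B j v ≡ true → i ≡ j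
      disjoint {0} {0} _ _ _ _ = refl
      disjoint {1} {1} _ _ _ _ = refl
      disjoint {2} {2} _ _ _ _ = refl
      disjoint {0} {1} {v} _ _ p q = ⊥-elim (excl (X v) (Y v) p (proj₂ (∧-true {X v} q)))
      disjoint {0} {2} {v} _ _ p q = ⊥-elim (excl (X v) (Y v) p (proj₁ (∧-true {Y v} q)))
      disjoint {1} {0} {v} _ _ p q = ⊥-elim (excl (X v) (Y v) q (proj₂ (∧-true {X v} p)))
      disjoint {1} {2} {v} _ _ p q = ⊥-elim (excl (Y v) (X v) q (proj₁ (∧-true {X v} p)))
      disjoint {2} {0} {v} _ _ p q = ⊥-elim (excl (X v) (Y v) q (proj₁ (∧-true {Y v} p)))
      disjoint {2} {1} {v} _ _ p q = ⊥-elim (excl (Y v) (X v) p (proj₁ (∧-true {X v} q)))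
      disjoint {suc (suc (suc _))} (s≤s (s≤s (s≤s ()))) _ _ _
      disjoint {_} {suc (suc (suc _))} _ (s≤s (s≤s (s≤s ()))) _ _
      cover : ∀ v → v ≢ s → ∃ λ i → i < 3 × B i v ≡ true
      cover v v≢s with X v in xv | Y v in yv | covers-V v v≢s
      ... | true | true | _ = 1 , s≤s (s≤s z≤n) , ∩-intro xv yv
      ... | true | false | _ = 0 , s≤s z≤n , ─-intro xv yv
      ... | false | true | _ = 2 , s≤s (s≤s (s≤s z≤n)) , ─-intro yv xv
      ... | false | false | inj₁ ()
      ... | false | false | inj₂ ()
      str : (∀ {i p q} → i < 3 → p < 3 → q < 3 →
        δ (B i) ≡ suc (2 * r) → e (B i) S ≡ 1 → e (B i) (B p) ≡ r → e (B i) (B q) ≡ r →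
        BlobCondition G s r (Blobs.β s 3 B noS disjoint cover) i p q) →
        PathStructure G s r 3 (Blobs.β s 3 B noS disjoint cover)
      str cond = positive′ , s≤s (s≤s (s≤s z≤n)) , λ
        { 1 _ _ → cond (s≤s (s≤s z≤n)) (s≤s z≤n) (s≤s (s≤s (s≤s z≤n))) δM tip≡1 refl (sym balanced)
        ; (suc (suc i)) _ (s≤s (s≤s (s≤s ()))) }
        where
        positive′ : 1 ≤ r
        positive′ with r in eq
        ... | suc _ = s≤s z≤n
        ... | zero = ⊥-elim (<⇒≱ 2≤k (≤-trans k≤δ∩ (≤-reflexive (trans δM (cong (λ r → suc (2 * r)) eq)))))
      small′ : ∀ i → i < 3 → i ≢ 1 → δ (B i) ≤ k
      small′ 0 _ _ = ≤-reflexive δX─Y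
      small′ 1 _ i≢1 = contradiction refl i≢1
      small′ (suc (suc _)) _ _ = ≤-reflexive δY─X

-- Maximal dangerous sets

infix 4 _⊑_

_⊑_ : {A : Set} → (A → Bool) → (A → Bool) → Set
X ⊑ Y = ∀ v → X v ≡ true → Y v ≡ true

-- A one-sided condition that carries its witness. Between maximal dangerous sets it is symmetric,
-- by `distinct-sym`.
Distinct : {A : Set} → (A → Bool) → (A → Bool) → Set
Distinct X Y = ∃ λ v → (X ─ Y) v ≡ true

distinct-or-⊑ : ∀ {m} (X Y : Fin m → Bool) → Distinct X Y ⊎ X ⊑ Y
distinct-or-⊑ X Y with any? (λ v → (X ─ Y) v Bool.≟ true)
... | yes dist = inj₁ dist
... | no none = inj₂ λ v Xv → inside v Xv
  where
  inside : X ⊑ Y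
  inside v Xv with Y v in yv
  ... | true = refl
  ... | false = contradiction (v , ─-intro Xv yv) none

distinct⇒¬⊑ : ∀ {A : Set} {X Y : A → Bool} → Distinct X Y → ¬ X ⊑ Y
distinct⇒¬⊑ {X = X} (v , v∈) sub with ∧-true {X v} v∈
... | p , q = true≢false (sub v p) (not-true q)

module MaximalSets (G : Graph) (s : Fin (n G)) (k : ℕ) (loopless : Loopless G)
  (sk : SKEdgeConnected G s k) (2≤k : 2 ≤ k) (4<d : 4 < deg G s) where

  open SpecialCase G s k loopless sk 2≤k 4<d public

  record Line (X : V → Bool) : Set where
    constructor line
    field
      isD     : D X
      maximal : ∀ {Y} → D Y → X ⊑ Y → Y ⊑ X

  open Line public

  extend : ∀ {X} → D X → ∃ λ M → Line M × X ⊑ M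
  extend {X} dX = go (countᶠ (n G) (∁ X)) X ≤-refl dX
    where
    go : ∀ N X → countᶠ (n G) (∁ X) ≤ N → D X → ∃ λ M → Line M × X ⊑ M
    go N X size dX with anySet? {P = λ Y → D Y × (∀ v → (X ─ Y) v ≡ false) × ∃ λ v → (Y ─ X) v ≡ true}
      (λ h (dY , p , v , q) → Dangerous-cong h dY , (λ v → trans (cong (λ b → X v ∧ not b) (sym (h v))) (p v)) ,
        v , trans (cong (_∧ not (X v)) (sym (h v))) q)
      (λ Y → dangerous? G s k Y ×-dec all? (λ v → (X ─ Y) v Bool.≟ false) ×-dec any? (λ v → (Y ─ X) v Bool.≟ true))
    ... | no none = X , line dX max , (λ _ Xv → Xv)
      where
      max : ∀ {Y} → D Y → X ⊑ Y → Y ⊑ X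
      max {Y} dY sub with distinct-or-⊑ Y X
      ... | inj₂ Y⊑X = Y⊑X
      ... | inj₁ (v , v∈) = ⊥-elim (none (Y , dY ,
              (λ w → ¬true⇒false λ q → distinct⇒¬⊑ {X = X} {Y} (w , q) sub) , v , v∈))
    go zero X size dX | yes (Y , dY , X⊑Y , v , v∈) =
      contradiction (≤-trans (count-positive (∁ X) (allFin (n G)) (∈-allFin v) (proj₂ (∧-true {Y v} v∈))) size) λ ()
    go (suc N) X size dX | yes (Y , dY , X─Y , v , v∈) with go N Y
      (s≤s⁻¹ (≤-trans (count-strict {p = ∁ Y} {q = ∁ X} (allFin (n G))
        (λ w Yw → cong not (¬true⇒false λ Xw → true≢false (─-intro Xw (not-true Yw)) (X─Y w)))
        (∈-allFin v) (cong not (proj₁ (∧-true {Y v} v∈))) (proj₂ (∧-true {Y v} v∈))) size)) dY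
    ... | M , lM , Y⊑M = M , lM , λ w Xw → Y⊑M w (inside w Xw)
      where
      inside : X ⊑ Y
      inside w Xw with Y w in yw
      ... | true = refl
      ... | false = ⊥-elim (true≢false (─-intro Xw yw) (X─Y w))

  distinct-sym : ∀ {X Y} → Line X → Line Y → Distinct X Y → Distinct Y X
  distinct-sym {X} {Y} lX lY dist with distinct-or-⊑ Y X
  ... | inj₁ dist′ = dist′
  ... | inj₂ Y⊑X = ⊥-elim (distinct⇒¬⊑ {X = X} {Y} dist (maximal lY (isD lX) Y⊑X))

  line-through : ∀ {x y} → x ~ y → ∃ λ M → Line M × M ∋ x × M ∋ y
  line-through (together X dX Xx Xy) with extend dX
  ... | M , lM , X⊑M = M , lM , X⊑M _ Xx , X⊑M _ Xy

  -- When distinct lines cross at `x`, this second edge lies in only one of them, so it witnesses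
  -- that the part of `X` outside the other lines is nonempty.
  Pointed : (V → Bool) → Fin d → Set
  Pointed X x = ∃ λ y → y ≢ x × X ∋ y

  module Nonspecial (nonspecial : ¬ Special) where

    avoided : ∀ {X Y x} → D X → D Y → X ∋ x → Y ∋ x → ∃ λ z → X ∌ z × Y ∌ z
    avoided {X} {Y} {x} dX dY Xx Yx with any? (λ z → (X (t z) ∨ Y (t z)) Bool.≟ false)
    ... | yes (z , z∉) = z , split (X (t z)) (Y (t z)) z∉
      where
      split : ∀ a b → a ∨ b ≡ false → a ≡ false × b ≡ false
      split false false _ = refl , refl
    ... | no none = ⊥-elim (nonspecial record
      { x₀ = x ; X = X ; Y = Y ; dX = dX ; dY = dY ; Xx₀ = Xx ; Yx₀ = Yx
      ; covers = λ z → ∨-true (covered z (X (t z) ∨ Y (t z)) refl) })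
      where
      covered : ∀ z b → X (t z) ∨ Y (t z) ≡ b → X (t z) ∨ Y (t z) ≡ true
      covered z true eq = eq
      covered z false eq = contradiction (z , eq) none

    record LinesCross (X Y : V → Bool) (x : Fin d) : Set where
      field
        crosses : Crosses X Y x
        δ∩      : δ (X ∩ Y) ≡ k
        halves  : k ≡ suc (2 * e (X ∩ Y) (X ─ Y))
      open Crosses crosses public

    -- The union misses the end of some edge at `s`, so by maximality it is not dangerous and has at
    -- least `k + 2` boundary edges. Submodularity leaves at most `k` for the intersection: equally
    -- many to either difference and a single one beyond, which makes `k` odd.
    lines-cross : ∀ {X Y x} → Line X → Line Y → X ∋ x → Y ∋ x → Distinct X Y → LinesCross X Y x
    lines-cross {X} {Y} {x} lX lY Xx Yx dist@(v , v∈) = record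
      { crosses = cr
      ; δ∩ = δ∩
      ; halves = linear 5 (λ k m r q o → m ≐ k ⇒ m ≐ r ⊕ (q ⊕ o) ⇒ r ≐ q ⇒ o ≐ # 1 ⇒ ⊢ k ≐ 1+ (2 ⊛ r))
          k (δ (X ∩ Y)) (e (X ∩ Y) (X ─ Y)) (e (X ∩ Y) (Y ─ X)) (e (X ∩ Y) (outside X Y))
          δ∩ (δ-∩ X Y) balanced out≡1
      }
      where
      dist′ = distinct-sym lX lY dist
      cr : Crosses X Y x
      cr = crossing-facts (isD lX) (isD lY) Xx Yx v∈ (proj₂ dist′)
      open Crosses cr
      z = proj₁ (avoided (isD lX) (isD lY) Xx Yx)
      Xz = proj₁ (proj₂ (avoided (isD lX) (isD lY) Xx Yx))
      Yz = proj₂ (proj₂ (avoided (isD lX) (isD lY) Xx Yx))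
      large : 2 + k ≤ δ (X ∪ Y)
      large = ≰⇒> λ small → distinct⇒¬⊑ {X = Y} {X} dist′ λ w Yw →
        maximal lX (dangerous (∨-false (avoids (isD lX)) (avoids (isD lY))) small (t z , t≢s z , ∨-false Xz Yz))
          (λ _ → ∨-trueˡ) w (∨-trueʳ {X w} Yw)
      δ∩ : δ (X ∩ Y) ≡ k
      δ∩ = linear 5 (λ k a b i u → i ⊕ u ≼ a ⊕ b ⇒ a ≐ 1+ k ⇒ b ≐ 1+ k ⇒ # 2 ⊕ k ≼ u ⇒ k ≼ i ⇒ ⊢ i ≐ k)
        k (δ X) (δ Y) (δ (X ∩ Y)) (δ (X ∪ Y)) (uncross-∩ X Y) δX δY large
        (cuts (X ∩ Y) (∧-falseˡ (avoids (isD lX))) (∩-intro Xx Yx) (t≢s z) (∧-falseˡ Xz))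

    same-line : ∀ {X Y x y} → Line X → Line Y → x ≢ y → X ∋ x → Y ∋ x → X ∋ y → Y ∋ y → X ⊑ Y
    same-line {X} {Y} lX lY x≢y Xx Yx Xy Yy with distinct-or-⊑ X Y
    ... | inj₂ sub = sub
    ... | inj₁ dist = contradiction (sym (LinesCross.only (lines-cross lX lY Xx Yx dist) Xy Yy)) x≢y

    -- The common part and the three private parts need `k` boundary edges each, and the edge at `s`
    -- counts twice: `4 k + 2 ≤ 3 (k + 1)` contradicts `k ≥ 2`.
    at-most-two-lines : ∀ {X Y Z x} → Line X → Line Y → Line Z → X ∋ x → Y ∋ x → Z ∋ x →
      Pointed X x → Pointed Y x → Pointed Z x → Distinct X Y → Distinct X Z → Distinct Y Z → ⊥
    at-most-two-lines {X} {Y} {Z} {x} lX lY lZ Xx Yx Zx (x′ , x′≢ , Xx′) (y′ , y′≢ , Yy′) (z′ , z′≢ , Zz′) XY XZ YZ =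
      linear 9 (λ k a b c m xx yy zz o → m ⊕ (xx ⊕ (yy ⊕ (zz ⊕ (o ⊕ o)))) ≼ a ⊕ (b ⊕ c) ⇒
          a ≼ 1+ k ⇒ b ≼ 1+ k ⇒ c ≼ 1+ k ⇒ k ≼ m ⇒ k ≼ xx ⇒ k ≼ yy ⇒ k ≼ zz ⇒ # 1 ≼ o ⇒ # 2 ≼ k ⇒ ⊢⊥)
        k (δ X) (δ Y) (δ Z) (δ (X ∩ Y ∩ Z)) (δ (X ─ (Y ∪ Z))) (δ (Y ─ (X ∪ Z))) (δ (Z ─ (X ∪ Y)))
        (e (X ∩ Y ∩ Z) (∁ (X ∪ Y ∪ Z)))
        (uncross-three X Y Z) (small (isD lX)) (small (isD lY)) (small (isD lZ))
        (cuts (X ∩ Y ∩ Z) (∧-falseˡ sX) (∩-intro Xx (∩-intro Yx Zx)) (t≢s x′)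
          (∧-falseʳ {X (t x′)} (∧-falseˡ (apart X Y XY.only x′≢ Xx′))))
        (private-part {X} {Y} {Z} sX Xx′ (apart X Y XY.only x′≢ Xx′) (apart X Z XZ.only x′≢ Xx′) Xx (∨-trueˡ Yx))
        (private-part {Y} {X} {Z} sY Yy′ (apart′ Y X XY.only y′≢ Yy′) (apart Y Z YZ.only y′≢ Yy′) Yx (∨-trueˡ Xx))
        (private-part {Z} {X} {Y} sZ Zz′ (apart′ Z X XZ.only z′≢ Zz′) (apart′ Z Y YZ.only z′≢ Zz′) Zx (∨-trueˡ Xx))
        (≤-trans (tip≤ {X ∩ Y ∩ Z} (∧-falseˡ sX) (∩-intro Xx (∩-intro Yx Zx)))
          (e-mono (X ∩ Y ∩ Z) S (∁ (X ∪ Y ∪ Z)) λ v v≡s → trans (cong (∁ (X ∪ Y ∪ Z)) (⁅⁆-true v≡s))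
            (cong not (∨-false sX (∨-false sY sZ)))))
        2≤k
      where
      module XY = LinesCross (lines-cross lX lY Xx Yx XY)
      module XZ = LinesCross (lines-cross lX lZ Xx Zx XZ)
      module YZ = LinesCross (lines-cross lY lZ Yx Zx YZ)
      sX = avoids (isD lX)
      sY = avoids (isD lY)
      sZ = avoids (isD lZ)
      apart : ∀ A B → (∀ {z} → A ∋ z → B ∋ z → z ≡ x) → ∀ {z} → z ≢ x → A ∋ z → B ∌ z
      apart A B only z≢ Az = ¬true⇒false λ Bz → z≢ (only Az Bz)
      apart′ : ∀ A B → (∀ {z} → B ∋ z → A ∋ z → z ≡ x) → ∀ {z} → z ≢ x → A ∋ z → B ∌ z
      apart′ A B only z≢ Az = ¬true⇒false λ Bz → z≢ (only Bz Az)
      private-part : ∀ {A B C : V → Bool} {z} → A s ≡ false → A ∋ z → B ∌ z → C ∌ z → A ∋ x → (B ∪ C) ∋ x → k ≤ δ (A ─ (B ∪ C))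
      private-part {A} {B} {C} sA Az Bz Cz Ax BCx = cuts (A ─ (B ∪ C)) (∧-falseˡ sA) (─-intro Az (∨-false Bz Cz))
        (t≢s x) (∧-falseʳ {A (t x)} (cong not BCx))

    third-line : ∀ {X Y Z x} → Line X → Line Y → Line Z → X ∋ x → Y ∋ x → Z ∋ x →
      Pointed X x → Pointed Y x → Pointed Z x → Distinct X Y → Z ⊑ X ⊎ Z ⊑ Y
    third-line {X} {Y} {Z} lX lY lZ Xx Yx Zx pX pY pZ XY with distinct-or-⊑ Z X | distinct-or-⊑ Z Y
    ... | inj₂ sub | _ = inj₁ sub
    ... | inj₁ _ | inj₂ sub = inj₂ sub
    ... | inj₁ ZX | inj₁ ZY = ⊥-elim (at-most-two-lines lX lY lZ Xx Yx Zx pX pY pZ XY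
            (distinct-sym lZ lX ZX) (distinct-sym lZ lY ZY))

    neighbours : ∀ {X Y x} → Line X → Line Y → X ∋ x → Y ∋ x → Pointed X x → Pointed Y x → Distinct X Y →
      ∀ {z} → x ~ z → X ∋ z ⊎ Y ∋ z
    neighbours {X} {Y} {x} lX lY Xx Yx pX pY XY {z} x~z with z ≟ x
    ... | yes refl = inj₁ Xx
    ... | no z≢x with line-through x~z
    ...   | Z , lZ , Zx , Zz with third-line lX lY lZ Xx Yx Zx pX pY (z , z≢x , Zz) XY
    ...     | inj₁ sub = inj₁ (sub (t z) Zz)
    ...     | inj₂ sub = inj₂ (sub (t z) Zz)

    record Middle (X Y₁ Y₂ : V → Bool) (x y : Fin d) : Set where
      field
        pair     : ∀ {z} → X ∋ z → z ≡ x ⊎ z ≡ y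
        covers   : ∀ {v} → X v ≡ true → Y₁ v ≡ true ⊎ Y₂ v ≡ true
        disjoint : ∀ {v} → X v ≡ true → Y₁ v ≡ true → Y₂ v ≡ true → ⊥
        joined   : e (X ∩ Y₁) (X ∩ Y₂) ≡ e (X ∩ Y₁) (X ─ Y₁)

    -- Two of the k + 1 edges leaving X go to s, and the two tight sets X ∩ Y₁ and X ∩ Y₂ account
    -- for (k - 1) / 2 of the remaining ones each.
    middle : ∀ {X Y₁ Y₂ x y} → Line X → Line Y₁ → Line Y₂ → x ≢ y → X ∋ x → Y₁ ∋ x → X ∋ y → Y₂ ∋ y →
      Distinct X Y₁ → Distinct X Y₂ → Middle X Y₁ Y₂ x y
    middle {X} {Y₁} {Y₂} {x} {y} lX l₁ l₂ x≢y Xx Y₁x Xy Y₂y XY₁ XY₂ = record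
      { pair = pair′ ; covers = λ {v} → covers′ v ; disjoint = λ {v} → disjoint′ v
      ; joined = e-cong {X ∩ Y₁} {X ∩ Y₁} {X ∩ Y₂} {X ─ Y₁} (λ _ → refl) λ v → same v (X v) (Y₁ v) (Y₂ v) refl refl refl }
      where
      module X₁ = LinesCross (lines-cross lX l₁ Xx Y₁x XY₁)
      module X₂ = LinesCross (lines-cross lX l₂ Xy Y₂y XY₂)
      A = X ∩ Y₁
      B = X ∩ Y₂
      sX = avoids (isD lX)
      Y₂x : Y₂ ∌ x
      Y₂x = ¬true⇒false λ Y₂x → x≢y (X₂.only Xx Y₂x)
      Y₁y : Y₁ ∌ y
      Y₁y = ¬true⇒false λ Y₁y → x≢y (sym (X₁.only Xy Y₁y))
      miss = missed (isD lX)
      disjoint′ : ∀ v → X v ≡ true → Y₁ v ≡ true → Y₂ v ≡ true → ⊥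
      disjoint′ v Xv Y₁v Y₂v = tight-disjoint {e A (X ─ Y₁)} X₁.halves {A} {B} (∧-falseˡ sX) (∧-falseˡ sX) X₁.δ∩ X₂.δ∩
        {t x} {t y} {proj₁ miss} (─-intro (∩-intro Xx Y₁x) (∧-falseʳ {X (t x)} Y₂x)) (─-intro (∩-intro Xy Y₂y) (∧-falseʳ {X (t y)} Y₁y))
        (proj₁ (proj₂ miss)) (∧-falseˡ (proj₂ (proj₂ miss))) (∧-falseˡ (proj₂ (proj₂ miss)))
        (∩-intro Xv Y₁v) (∩-intro Xv Y₂v)
      Xs = X ∷ Y₁ ∷ Y₂ ∷ S ∷ []
      ω : Label 4 → Bool
      ω = ∁ (in₄ ∩ (in₁ ∪ in₂ ∪ in₃)) ∩ ∁ (in₁ ∩ in₂ ∩ in₃)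
      ok : ∀ v → ω (label Xs v) ≡ true
      ok v with v ≟ s
      ... | yes refl rewrite sX | avoids (isD l₁) | avoids (isD l₂) = refl
      ... | no _ with X v in xv | Y₁ v in y₁v | Y₂ v in y₂v
      ...   | false | _ | _ = refl
      ...   | true | false | _ = refl
      ...   | true | true | false = refl
      ...   | true | true | true = ⊥-elim (disjoint′ v xv y₁v y₂v)
      okay : ∀ {ab} → ab ∈ edges G → at id Xs (bothEnds ω) ab ≡ true
      okay {ab} _ = bothEnds-at id Xs ω ok ab
      few-tips : e X S + (e A (Y₁ ─ X) + e B (Y₂ ─ X)) ≤ δ X
      few-tips = regions-≤ id Xs (bothEnds ω)
        (join in₁ in₄ ∷ join (in₁ ∩ in₂) (in₂ ─ in₁) ∷ join (in₁ ∩ in₃) (in₃ ─ in₁) ∷ []) (cut in₁ ∷ []) (edges G) okay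
      pair′ : ∀ {z} → X ∋ z → z ≡ x ⊎ z ≡ y
      pair′ {z} Xz with z ≟ x | z ≟ y
      ... | yes z≡x | _ = inj₁ z≡x
      ... | no _ | yes z≡y = inj₂ z≡y
      ... | no z≢x | no z≢y = ⊥-elim
        (linear 7 (λ k a x₁ r₁ x₂ r₂ δX → # 3 ≼ a ⇒ a ⊕ (x₁ ⊕ x₂) ≼ δX ⇒ δX ≐ 1+ k ⇒ r₁ ≐ x₁ ⇒ r₂ ≐ x₂ ⇒
            k ≐ 1+ (2 ⊛ r₁) ⇒ k ≐ 1+ (2 ⊛ r₂) ⇒ ⊢⊥)
          k (e X S) (e A (Y₁ ─ X)) (e A (X ─ Y₁)) (e B (Y₂ ─ X)) (e B (X ─ Y₂)) (δ X)
          (tips≤ {X} sX (z ∷ x ∷ y ∷ []) ((z≢x ∷ z≢y ∷ []) ∷ (x≢y ∷ []) ∷ [] ∷ []) (Xz ∷ Xx ∷ Xy ∷ []))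
          few-tips X₁.δX X₁.balanced X₂.balanced X₁.halves X₂.halves)
      -- The balanced terms cancel and the two edges to `s` lower the bound from `k + 1` to `k - 1`,
      -- too few for a nonempty remainder.
      remainder : δ (X ─ (Y₁ ∪ Y₂)) + (e A (Y₁ ─ X) + (e B (Y₂ ─ X) + (e A S + e B S))) ≤
        δ X + (e A (X ─ Y₁) + e B (X ─ Y₂))
      remainder = regions-≤ id Xs (bothEnds ω)
        (cut (in₁ ─ (in₂ ∪ in₃)) ∷ join (in₁ ∩ in₂) (in₂ ─ in₁) ∷ join (in₁ ∩ in₃) (in₃ ─ in₁) ∷
          join (in₁ ∩ in₂) in₄ ∷ join (in₁ ∩ in₃) in₄ ∷ [])
        (cut in₁ ∷ join (in₁ ∩ in₂) (in₁ ─ in₂) ∷ join (in₁ ∩ in₃) (in₁ ─ in₃) ∷ []) (edges G) okay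
      covers′ : ∀ v → X v ≡ true → Y₁ v ≡ true ⊎ Y₂ v ≡ true
      covers′ v Xv with (Y₁ ∪ Y₂) v in eq
      ... | true = ∨-true eq
      ... | false = ⊥-elim
        (linear 9 (λ k R x₁ r₁ x₂ r₂ s₁ s₂ δX → k ≼ R ⇒ R ⊕ (x₁ ⊕ (x₂ ⊕ (s₁ ⊕ s₂))) ≼ δX ⊕ (r₁ ⊕ r₂) ⇒ δX ≐ 1+ k ⇒
            r₁ ≐ x₁ ⇒ r₂ ≐ x₂ ⇒ k ≐ 1+ (2 ⊛ r₁) ⇒ k ≐ 1+ (2 ⊛ r₂) ⇒ s₁ ≐ # 1 ⇒ s₂ ≐ # 1 ⇒ ⊢⊥)
          k (δ (X ─ (Y₁ ∪ Y₂))) (e A (Y₁ ─ X)) (e A (X ─ Y₁)) (e B (Y₂ ─ X)) (e B (X ─ Y₂)) (e A S) (e B S) (δ X)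
          (cuts (X ─ (Y₁ ∪ Y₂)) (∧-falseˡ sX) (─-intro Xv eq) (proj₁ (proj₂ miss)) (∧-falseˡ (proj₂ (proj₂ miss))))
          remainder X₁.δX X₁.balanced X₂.balanced X₁.halves X₂.halves X₁.tip≡1 X₂.tip≡1)
      same : ∀ v a b c → X v ≡ a → Y₁ v ≡ b → Y₂ v ≡ c → X v ∧ Y₂ v ≡ X v ∧ not (Y₁ v)
      same v false b c xv _ _ rewrite xv = refl
      same v true true true xv p q = ⊥-elim (disjoint′ v xv p q)
      same v true true false xv p q rewrite xv | p | q = refl
      same v true false true xv p q rewrite xv | p | q = refl
      same v true false false xv p q =
        ⊥-elim ([ (λ r → true≢false r p) , (λ r → true≢false r q) ]′ (covers′ v xv))

-- Partitions into classes

firstIn : ∀ {d} → (Fin d → Bool) → List (Fin d) → ℕ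
firstIn p [] = 0
firstIn p (x ∷ xs) = if p x then toℕ x else firstIn p xs

firstIn-cong : ∀ {d} {p q : Fin d → Bool} → p ≗ q → ∀ xs → firstIn p xs ≡ firstIn q xs
firstIn-cong h [] = refl
firstIn-cong h (x ∷ xs) rewrite h x | firstIn-cong h xs = refl

firstIn-found : ∀ {d} (p : Fin d → Bool) {x} xs → x ∈ xs → p x ≡ true →
  ∃ λ y → p y ≡ true × firstIn p xs ≡ toℕ y
firstIn-found p (x ∷ xs) (here refl) px rewrite px = x , px , refl
firstIn-found p (y ∷ xs) (there x∈) px with p y in py
... | true = y , py , refl
... | false = firstIn-found p xs x∈ px

module Classes {d : ℕ} {R : Fin d → Fin d → Set} (R? : ∀ x y → Dec (R x y)) (R-refl : ∀ x → R x x)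
  (R-sym : ∀ {x y} → R x y → R y x) (R-trans : ∀ {x y z} → R x y → R y z → R x z) where

  -- The number of the first element of the class. As `R` is reflexive, the search always succeeds
  -- and the default of `firstIn` is not reached.
  class : Fin d → ℕ
  class x = firstIn (λ y → ⌊ R? x y ⌋) (allFin d)

  private
    holds : ∀ {P : Set} (P? : Dec P) → ⌊ P? ⌋ ≡ true → P
    holds (yes p) _ = p

    holds⁻ : ∀ {P : Set} (P? : Dec P) → P → ⌊ P? ⌋ ≡ true
    holds⁻ (yes _) _ = refl
    holds⁻ (no ¬p) p = contradiction p ¬p

    ⌊⌋-cong : ∀ {P Q : Set} (P? : Dec P) (Q? : Dec Q) → (P → Q) → (Q → P) → ⌊ P? ⌋ ≡ ⌊ Q? ⌋
    ⌊⌋-cong (yes p) Q? f g = sym (holds⁻ Q? (f p))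
    ⌊⌋-cong (no ¬p) (yes q) f g = contradiction (g q) ¬p
    ⌊⌋-cong (no _) (no _) f g = refl

  R⇒class : ∀ {x y} → R x y → class x ≡ class y
  R⇒class {x} {y} r = firstIn-cong (λ z → ⌊⌋-cong (R? x z) (R? y z) (R-trans (R-sym r)) (R-trans r)) (allFin d)

  class⇒R : ∀ {x y} → class x ≡ class y → R x y
  class⇒R {x} {y} eq
    with firstIn-found (λ z → ⌊ R? x z ⌋) (allFin d) (∈-allFin x) (holds⁻ (R? x x) (R-refl x))
       | firstIn-found (λ z → ⌊ R? y z ⌋) (allFin d) (∈-allFin y) (holds⁻ (R? y y) (R-refl y))
  ... | a , pa , ea | b , pb , eb with toℕ-injective (trans (sym ea) (trans eq eb))
  ...   | refl = R-trans (holds (R? x a) pa) (R-sym (holds (R? y a) pb))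

cover-bound : ∀ {d} (xs : List (Fin d)) → (∀ x → x ∈ xs) → d ≤ length xs
cover-bound xs mem = injective⇒≤ {f = λ x → index (mem x)} λ {x} {y} eq →
  trans (lookup-index (mem x)) (trans (cong (lookup xs) eq) (sym (lookup-index (mem y))))

module Chains (G : Graph) (s : Fin (n G)) (k : ℕ) (loopless : Loopless G)
  (sk : SKEdgeConnected G s k) (2≤k : 2 ≤ k) (4<d : 4 < deg G s)
  (nonspecial : ¬ SpecialCase.Special G s k loopless sk 2≤k 4<d) where

  open MaximalSets G s k loopless sk 2≤k 4<d public
  open Nonspecial nonspecial public

  _~?_ : ∀ x y → Dec (x ~ y)
  _~?_ = together? G s k

  L-intro : ∀ {x y} → x ≢ y → ¬ x ~ y → L x y
  L-intro {x} {y} = apart⇒liftable G s k sk {x} {y}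

  escapes : ∀ X x → (∃ λ z → x ~ z × X ∌ z) ⊎ (∀ {z} → x ~ z → X ∋ z)
  escapes X x with any? (λ z → (x ~? z) ×-dec (X (t z) Bool.≟ false))
  ... | yes found = inj₁ found
  ... | no none = inj₂ λ {z} x~z → inside z x~z (X (t z)) refl
    where
    inside : ∀ z → x ~ z → ∀ b → X (t z) ≡ b → X ∋ z
    inside z x~z true eq = eq
    inside z x~z false eq = contradiction (z , x~z , eq) none

  ∌⇒≢ : ∀ {X : V → Bool} {x z} → X ∋ x → X ∌ z → z ≢ x
  ∌⇒≢ Xx Xz refl = true≢false Xx Xz

  distinct-by : ∀ {X Y : V → Bool} {z} → Y ∋ z → X ∌ z → Distinct Y X
  distinct-by {z = z} Yz Xz = t z , ─-intro Yz Xz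

  -- Connectivity of the lifting graph

  record Reach (x y : Fin d) : Set where
    constructor reach
    field
      path : Star L x y

  via : ∀ x y {z} → x ≢ y → ¬ x ~ y → Reach y z → Reach x z
  via x y x≢y x≁y (reach p) = reach (L-intro {x} {y} x≢y x≁y ◅ p)

  -- A common neighbour in the lifting graph, which gives a path of length two.
  Bridge : Fin d → Fin d → Fin d → Set
  Bridge x y z = z ≢ x × z ≢ y × ¬ x ~ z × ¬ y ~ z

  -- If `x` and `y` are not liftable and have no common neighbour, both must lie in further lines
  -- `Y` and `Z`. Edges `z₁` of `Y` and `z₂` of `Z` outside `X` then give the path `x`, `z₂`, `z₁`,
  -- `y`.
  module NoBridge {x y : Fin d} (x≢y : x ≢ y) {X : V → Bool} (lX : Line X) (Xx : X ∋ x) (Xy : X ∋ y)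
    (none : ∀ z → ¬ Bridge x y z) where

    both-stay : (∀ {z} → x ~ z → X ∋ z) → (∀ {z} → y ~ z → X ∋ z) → ⊥
    both-stay stay-x stay-y with misses (isD lX) Xx
    ... | z , Xz = none z (∌⇒≢ {X} Xx Xz , ∌⇒≢ {X} Xy Xz ,
            (λ x~z → true≢false (stay-x x~z) Xz) , λ y~z → true≢false (stay-y y~z) Xz)

    -- Everything related to `x` lies in the two lines `X` and `Y`, and some edge at `s` avoids both
    -- because they are not special.
    one-stays : ∀ {z₁} → x ~ z₁ → X ∌ z₁ → (∀ {z} → y ~ z → X ∋ z) → ⊥
    one-stays {z₁} x~z₁ Xz₁ stay-y with line-through x~z₁
    ... | Y , lY , Yx , Yz₁ with avoided (isD lX) (isD lY) Xx Yx
    ...   | z , Xz , Yz = none z (∌⇒≢ {X} Xx Xz , ∌⇒≢ {X} Xy Xz ,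
              (λ x~z → [ (λ h → true≢false h Xz) , (λ h → true≢false h Yz) ]′
                (neighbours lX lY Xx Yx (y , ≢-sym x≢y , Xy) (z₁ , ∌⇒≢ {X} Xx Xz₁ , Yz₁)
                  (distinct-sym lY lX (distinct-by {X} {Y} Yz₁ Xz₁)) x~z)) ,
              λ y~z → true≢false (stay-y y~z) Xz)

    module _ {z₁ z₂ : Fin d} {Y Z : V → Bool} (lY : Line Y) (Yx : Y ∋ x) (Yz₁ : Y ∋ z₁) (Xz₁ : X ∌ z₁)
      (lZ : Line Z) (Zy : Z ∋ y) (Zz₂ : Z ∋ z₂) (Xz₂ : X ∌ z₂) where

      private
        YX : Distinct Y X
        YX = distinct-by {X} {Y} Yz₁ Xz₁
        ZX : Distinct Z X
        ZX = distinct-by {X} {Z} Zz₂ Xz₂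
        XY : Distinct X Y
        XY = distinct-sym lY lX YX
        XZ : Distinct X Z
        XZ = distinct-sym lZ lX ZX
        z₁≢x : z₁ ≢ x
        z₁≢x = ∌⇒≢ {X} Xx Xz₁
        z₁≢y : z₁ ≢ y
        z₁≢y = ∌⇒≢ {X} Xy Xz₁
        z₂≢x : z₂ ≢ x
        z₂≢x = ∌⇒≢ {X} Xx Xz₂
        z₂≢y : z₂ ≢ y
        z₂≢y = ∌⇒≢ {X} Xy Xz₂
        Y∌y : Y ∌ y
        Y∌y = ¬true⇒false λ Yy → x≢y (sym (LinesCross.only (lines-cross lX lY Xx Yx XY) Xy Yy))
        Z∌x : Z ∌ x
        Z∌x = ¬true⇒false λ Zx → x≢y (LinesCross.only (lines-cross lX lZ Xy Zy XZ) Xx Zx)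
        not-in-X : ∀ {w} → Y ∌ w → Z ∌ w → X ∋ w → ⊥
        not-in-X {w} Yw Zw Xw with Middle.pair (middle lX lY lZ x≢y Xx Yx Xy Zy XY XZ) {w} Xw
        ... | inj₁ refl = true≢false Yx Yw
        ... | inj₂ refl = true≢false Zy Zw
        bridging : ∀ {w} → Y ∌ w → Z ∌ w → Bridge x y w
        bridging {w} Yw Zw = ∌⇒≢ {Y} Yx Yw , ∌⇒≢ {Z} Zy Zw ,
          (λ x~w → [ not-in-X {w} Yw Zw , (λ h → true≢false h Yw) ]′
            (neighbours lX lY Xx Yx (y , ≢-sym x≢y , Xy) (z₁ , z₁≢x , Yz₁) XY {w} x~w)) ,
          λ y~w → [ not-in-X {w} Yw Zw , (λ h → true≢false h Zw) ]′
            (neighbours lX lZ Xy Zy (x , x≢y , Xx) (z₂ , z₂≢y , Zz₂) XZ {w} y~w)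
        all-in : ∀ w → Y ∋ w ⊎ Z ∋ w
        all-in w = decide (Y (t w)) (Z (t w)) refl refl
          where
          decide : ∀ a b → Y (t w) ≡ a → Z (t w) ≡ b → Y ∋ w ⊎ Z ∋ w
          decide true _ Yw _ = inj₁ Yw
          decide false true _ Zw = inj₂ Zw
          decide false false Yw Zw = ⊥-elim (none w (bridging {w} Yw Zw))
        listed : ∀ {y′ z′ w} → (w ≡ x ⊎ w ≡ y′) ⊎ (w ≡ y ⊎ w ≡ z′) → w ∈ x ∷ y′ ∷ y ∷ z′ ∷ []
        listed (inj₁ (inj₁ eq)) = here eq
        listed (inj₁ (inj₂ eq)) = there (here eq)
        listed (inj₂ (inj₁ eq)) = there (there (here eq))
        listed (inj₂ (inj₂ eq)) = there (there (there (here eq)))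
        -- An edge at `s` outside `Y` and `Z` would be a bridge, so these two lines hold everything;
        -- four edges are too few.
        few : ∀ {y′ z′} → (∀ {w} → Y ∋ w → w ≡ x ⊎ w ≡ y′) → (∀ {w} → Z ∋ w → w ≡ y ⊎ w ≡ z′) → ⊥
        few {y′} {z′} pY pZ = <⇒≱ 4<d (cover-bound {d} (x ∷ y′ ∷ y ∷ z′ ∷ [])
          (λ w → listed {y′} {z′} {w} (Sum.map pY pZ (all-in w))))

      -- `Y` and `Z` would each meet two other lines, one at `w` and `X` elsewhere, so `middle`
      -- leaves them two edges each.
      common-impossible : ∀ {w} → w ≢ x → w ≢ y → Y ∋ w → Z ∋ w → ⊥
      common-impossible w≢x w≢y Yw Zw = few
        (Middle.pair (middle lY lX lZ (≢-sym w≢x) Yx Xx Yw Zw YX (distinct-by {Z} {Y} Yx Z∌x)))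
        (Middle.pair (middle lZ lX lY (≢-sym w≢y) Zy Xy Zw Yw ZX (distinct-by {Y} {Z} Zy Y∌y)))

      -- A line through `z₁` and `z₂` would be a second line crossing both `Y` and `Z`, reducing
      -- them again to two edges each.
      ends-apart : ¬ z₁ ~ z₂
      ends-apart z₁~z₂ with line-through z₁~z₂
      ... | W , lW , Wz₁ , Wz₂ = few
        (Middle.pair (middle lY lX lW (≢-sym z₁≢x) Yx Xx Yz₁ Wz₁ YX
          (distinct-sym lW lY (distinct-by {Y} {W} Wz₂ (¬true⇒false λ Yz₂ → common-impossible z₂≢x z₂≢y Yz₂ Zz₂)))))
        (Middle.pair (middle lZ lX lW (≢-sym z₂≢y) Zy Xy Zz₂ Wz₂ ZX
          (distinct-sym lW lZ (distinct-by {Z} {W} Wz₁ (¬true⇒false λ Zz₁ → common-impossible z₁≢x z₁≢y Yz₁ Zz₁)))))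

      detour : Reach x y
      detour = via x z₂ (≢-sym z₂≢x)
          (λ x~z₂ → [ (λ h → true≢false h Xz₂) , (λ h → common-impossible z₂≢x z₂≢y h Zz₂) ]′
            (neighbours lX lY Xx Yx (y , ≢-sym x≢y , Xy) (z₁ , z₁≢x , Yz₁) XY x~z₂))
        (via z₂ z₁ (λ { refl → common-impossible z₂≢x z₂≢y Yz₁ Zz₂ }) (ends-apart ∘ ~-sym)
          (via z₁ y z₁≢y
            (λ z₁~y → [ (λ h → true≢false h Xz₁) , (λ h → common-impossible z₁≢x z₁≢y Yz₁ h) ]′
              (neighbours lX lZ Xy Zy (x , x≢y , Xx) (z₂ , z₂≢y , Zz₂) XZ (~-sym z₁~y))) (reach ε)))

  bridge? : ∀ x y → Dec (∃ (Bridge x y))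
  bridge? x y = any? λ z → ¬? (z ≟ x) ×-dec ¬? (z ≟ y) ×-dec ¬? (x ~? z) ×-dec ¬? (y ~? z)

  reachable : ∀ x y → Reach x y
  reachable x y with x ≟ y
  ... | yes refl = reach ε
  ... | no x≢y with x ~? y
  ...   | no x≁y = via x y x≢y x≁y (reach ε)
  ...   | yes x~y with bridge? x y
  ...     | yes (z , z≢x , z≢y , x≁z , y≁z) =
            via x z (≢-sym z≢x) x≁z (via z y z≢y (y≁z ∘ ~-sym) (reach ε))
  ...     | no none with line-through x~y
  ...       | X , lX , Xx , Xy with escapes X x | escapes X y
  ...         | inj₂ stay-x | inj₂ stay-y =
                ⊥-elim (NoBridge.both-stay x≢y lX Xx Xy (λ z b → none (z , b)) stay-x stay-y)
  ...         | inj₁ (z₁ , x~z₁ , Xz₁) | inj₂ stay-y =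
                ⊥-elim (NoBridge.one-stays x≢y lX Xx Xy (λ z b → none (z , b)) x~z₁ Xz₁ stay-y)
  ...         | inj₂ stay-x | inj₁ (z₂ , y~z₂ , Xz₂) =
                ⊥-elim (NoBridge.one-stays (≢-sym x≢y) lX Xy Xx
                  (λ z (p , q , r , u) → none (z , q , p , u , r)) y~z₂ Xz₂ stay-x)
  ...         | inj₁ (z₁ , x~z₁ , Xz₁) | inj₁ (z₂ , y~z₂ , Xz₂) with line-through x~z₁ | line-through y~z₂
  ...           | Y , lY , Yx , Yz₁ | Z , lZ , Zy , Zz₂ =
                  NoBridge.detour x≢y lX Xx Xy (λ z b → none (z , b)) lY Yx Yz₁ Xz₁ lZ Zy Zz₂ Xz₂

  lifting-connected : Connected d L
  lifting-connected x y = Reach.path (reachable x y)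

  multipartite : Even k → CompleteMultipartite d L
  multipartite (m , k≡2m) = class , λ x y → mk⇔
    (λ l eq → [ proj₁ (liftable⇒apart G s k sk {x} {y} l) , proj₂ (liftable⇒apart G s k sk {x} {y} l) ]′ (class⇒R {x} {y} eq))
    (λ ne → L-intro {x} {y} (λ x≡y → ne (R⇒class {x} {y} (inj₁ x≡y))) (λ x~y → ne (R⇒class {x} {y} (inj₂ x~y))))
    where
    R : Fin d → Fin d → Set
    R x y = x ≡ y ⊎ x ~ y
    R? : ∀ x y → Dec (R x y)
    R? x y with x ≟ y | x ~? y
    ... | yes p | _ = yes (inj₁ p)
    ... | no _ | yes q = yes (inj₂ q)
    ... | no p | no q = no [ p , q ]′
    ~-trans : ∀ {x y z} → x ~ y → y ~ z → x ~ z
    ~-trans x~y y~z with line-through x~y | line-through y~z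
    ... | X , lX , Xx , Xy | Y , lY , Yy , Yz with distinct-or-⊑ X Y
    ...   | inj₂ sub = together Y (isD lY) (sub _ Xx) Yz
    ...   | inj₁ dist = ⊥-elim (even≢odd m (e (X ∩ Y) (X ─ Y)) (trans (sym k≡2m) (LinesCross.halves (lines-cross lX lY Xy Yy dist))))
    R-trans : ∀ {x y z} → R x y → R y z → R x z
    R-trans (inj₁ refl) q = q
    R-trans (inj₂ p) (inj₁ refl) = inj₂ p
    R-trans (inj₂ p) (inj₂ q) = inj₂ (~-trans p q)
    R-sym : ∀ {x y} → R x y → R y x
    R-sym (inj₁ eq) = inj₁ (sym eq)
    R-sym (inj₂ r) = inj₂ (~-sym r)
    open Classes R? (λ _ → inj₁ refl) R-sym R-trans

  -- Chains of lines

  -- There are `l + 2` lines and `l + 1` crossing points; values at larger indices are arbitrary.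
  -- Only the end lines need `front` and `back`, since an inner line has its second edge at the
  -- neighbouring crossing point.
  record LineSeq (l : ℕ) : Set where
    field
      c : ℕ → Fin d
      E : ℕ → V → Bool
      isLine    : ∀ {i} → i ≤ suc l → Line (E i)
      on-left   : ∀ {i} → i ≤ l → E i ∋ c i
      on-right  : ∀ {i} → i ≤ l → E (suc i) ∋ c i
      distinct  : ∀ {i} → i ≤ l → Distinct (E i) (E (suc i))
      injective : ∀ {i j} → i ≤ l → j ≤ l → c i ≡ c j → i ≡ j
      front     : Pointed (E 0) (c 0)
      back      : Pointed (E (suc l)) (c l)

    -- The chain cannot be continued at this end: only through `c j` does the relation `~` lead out
    -- of `E i`.
    Closed : ℕ → ℕ → Set
    Closed i j = ∀ y z → E i ∋ y → y ≢ c j → y ~ z → E i ∋ z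

    FrontClosed BackClosed Cyclic : Set
    FrontClosed = Closed 0 0
    BackClosed  = Closed (suc l) l
    Cyclic      = 1 ≤ l × E 0 ⊑ E (suc l) × E (suc l) ⊑ E 0

    c≢ : ∀ {i j} → i ≤ l → j ≤ l → i ≢ j → c i ≢ c j
    c≢ i≤ j≤ i≢j = i≢j ∘ injective i≤ j≤

    pointed-left : ∀ {i} → i ≤ l → Pointed (E i) (c i)
    pointed-left {zero} _ = front
    pointed-left {suc i} i≤ = c i , c≢ (<⇒≤ i≤) i≤ (<⇒≢ (n<1+n i)) , on-right (<⇒≤ i≤)

    pointed-right : ∀ {i} → i ≤ l → Pointed (E (suc i)) (c i)
    pointed-right {i} i≤ with i ℕ.≟ l
    ... | yes refl = back
    ... | no i≢l = c (suc i) , c≢ (≤∧≢⇒< i≤ i≢l) i≤ (>⇒≢ (n<1+n i)) , on-left (≤∧≢⇒< i≤ i≢l)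

    inner-line : ∀ {i} → i < l → Middle (E (suc i)) (E i) (E (2 + i)) (c i) (c (suc i))
    inner-line {i} i< = middle (isLine (m≤n⇒m≤1+n i<)) (isLine (m≤n⇒m≤1+n (<⇒≤ i<))) (isLine (s≤s i<))
      (c≢ (<⇒≤ i<) i< (<⇒≢ (n<1+n i))) (on-right (<⇒≤ i<)) (on-left (<⇒≤ i<)) (on-left i<) (on-right i<)
      (distinct-sym (isLine (m≤n⇒m≤1+n (<⇒≤ i<))) (isLine (m≤n⇒m≤1+n i<)) (distinct (<⇒≤ i<))) (distinct i<)

    inner-points : ∀ {i z} → i < l → E (suc i) ∋ z → z ≡ c i ⊎ z ≡ c (suc i)
    inner-points i< = Middle.pair (inner-line i<)

    chain-neighbours : ∀ {i z} → i ≤ l → c i ~ z → E i ∋ z ⊎ E (suc i) ∋ z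
    chain-neighbours i≤ = neighbours (isLine (m≤n⇒m≤1+n i≤)) (isLine (s≤s i≤)) (on-left i≤) (on-right i≤)
      (pointed-left i≤) (pointed-right i≤) (distinct i≤)

    length-bound : suc l ≤ d
    length-bound = injective⇒≤ {f = λ (i : Fin (suc l)) → c (toℕ i)} λ {i} {j} eq →
      toℕ-injective (injective (s≤s⁻¹ (toℕ<n i)) (s≤s⁻¹ (toℕ<n j)) eq)

    member? : ∀ y → (∃ λ i → i ≤ l × y ≡ c i) ⊎ (∀ i → i ≤ l → y ≢ c i)
    member? y with any? (λ (i : Fin (suc l)) → y ≟ c (toℕ i))
    ... | yes (i , eq) = inj₁ (toℕ i , s≤s⁻¹ (toℕ<n i) , eq)
    ... | no none = inj₂ λ i i≤ eq → none (fromℕ< (s≤s i≤) , trans eq (cong c (sym (toℕ-fromℕ< (s≤s i≤)))))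

    -- The lines `E i` and `E (i + 1)` already pass through `c i`, so `E 0` lies in one of them. The
    -- edges of an inner line are two consecutive crossing points; among these lines only `E 1`
    -- holds `c 0`, and it is distinct from `E 0`. What remains is the last line.
    front-meets-chain : ∀ {i} → 1 ≤ i → i ≤ l → E 0 ∋ c i → Cyclic
    front-meets-chain {suc i} _ i≤ E₀ with third-line (isLine (m≤n⇒m≤1+n i≤)) (isLine (s≤s i≤)) (isLine z≤n)
      (on-left i≤) (on-right i≤) E₀ (pointed-left i≤) (pointed-right i≤) (c 0 , c≢ z≤n i≤ (λ ()) , on-left z≤n) (distinct i≤)
    ... | inj₁ sub with inner-points i≤ (sub _ (on-left z≤n))
    ...   | inj₂ eq = contradiction eq (c≢ z≤n i≤ (λ ()))
    ...   | inj₁ eq with injective z≤n (<⇒≤ i≤) eq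
    ...     | refl = ⊥-elim (distinct⇒¬⊑ {X = E 0} {E 1} (distinct z≤n) sub)
    front-meets-chain {suc i} _ i≤ E₀ | inj₂ sub with suc i ℕ.≟ l
    ... | yes refl = s≤s z≤n , sub , maximal (isLine z≤n) (isD (isLine ≤-refl)) sub
    ... | no i≢l with inner-points (≤∧≢⇒< i≤ i≢l) (sub _ (on-left z≤n))
    ...   | inj₁ eq = contradiction eq (c≢ z≤n i≤ (λ ()))
    ...   | inj₂ eq = contradiction eq (c≢ z≤n (≤∧≢⇒< i≤ i≢l) (λ ()))

  open LineSeq

  prepend : ∀ {l} (q : LineSeq l) {y z} → (∀ i → i ≤ l → y ≢ c q i) → E q 0 ∋ y → y ~ z → E q 0 ∌ z →
    Σ (LineSeq (suc l)) λ r → BackClosed q → BackClosed r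
  prepend {l} q {y} {z} fresh E₀y y~z E₀z with line-through y~z
  ... | Y , lY , Yy , Yz = record
    { c = c′ ; E = E′ ; isLine = λ { {zero} _ → lY ; {suc i} (s≤s i≤) → isLine q i≤ }
    ; on-left = λ { {zero} _ → Yy ; {suc i} (s≤s i≤) → on-left q i≤ }
    ; on-right = λ { {zero} _ → E₀y ; {suc i} (s≤s i≤) → on-right q i≤ }
    ; distinct = λ { {zero} _ → distinct-by {E q 0} {Y} Yz E₀z ; {suc i} (s≤s i≤) → distinct q i≤ }
    ; injective = inj
    ; front = z , ∌⇒≢ {E q 0} E₀y E₀z , Yz
    ; back = back q } , id
    where
    c′ : ℕ → Fin d
    c′ zero = y
    c′ (suc i) = c q i
    E′ : ℕ → V → Bool
    E′ zero = Y
    E′ (suc i) = E q i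
    inj : ∀ {i j} → i ≤ suc l → j ≤ suc l → c′ i ≡ c′ j → i ≡ j
    inj {zero} {zero} _ _ _ = refl
    inj {zero} {suc j} _ (s≤s j≤) eq = contradiction eq (fresh j j≤)
    inj {suc i} {zero} (s≤s i≤) _ eq = contradiction (sym eq) (fresh i i≤)
    inj {suc i} {suc j} (s≤s i≤) (s≤s j≤) eq = cong suc (injective q i≤ j≤ eq)

  reverse : ∀ {l} → LineSeq l → LineSeq l
  reverse {l} q = record
    { c = λ i → c q (l ∸ i) ; E = λ i → E q (suc l ∸ i)
    ; isLine = λ {i} _ → isLine q (m∸n≤m (suc l) i)
    ; on-left = λ {i} i≤ → subst (λ j → E q j ∋ c q (l ∸ i)) (sym (+-∸-assoc 1 i≤)) (on-right q (m∸n≤m l i))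
    ; on-right = λ {i} i≤ → on-left q (m∸n≤m l i)
    ; distinct = λ {i} i≤ → subst (λ j → Distinct (E q j) (E q (l ∸ i))) (sym (+-∸-assoc 1 i≤))
        (distinct-sym (isLine q (m≤n⇒m≤1+n (m∸n≤m l i))) (isLine q (s≤s (m∸n≤m l i))) (distinct q (m∸n≤m l i)))
    ; injective = λ {i} {j} i≤ j≤ eq → ∸-cancelˡ-≡ i≤ j≤ (injective q (m∸n≤m l i) (m∸n≤m l j) eq)
    ; front = back q
    ; back = subst (λ j → Pointed (E q j) (c q j)) (sym (n∸n≡0 l)) (front q) }

  reverse-back : ∀ {l} (q : LineSeq l) → FrontClosed q → BackClosed (reverse q)
  reverse-back {l} q = subst (λ j → Closed q j j) (sym (n∸n≡0 l))

  Closing : Set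
  Closing = ∃ λ l → Σ (LineSeq l) Cyclic

  Escaping : ∀ {l} → LineSeq l → Set
  Escaping q = ∃ λ y → E q 0 ∋ y × y ≢ c q 0 × ∃ λ z → y ~ z × E q 0 ∌ z

  escaping? : ∀ {l} (q : LineSeq l) → Escaping q ⊎ FrontClosed q
  escaping? q with any? (λ y → (E q 0 (t y) Bool.≟ true) ×-dec ¬? (y ≟ c q 0) ×-dec
      any? (λ z → (y ~? z) ×-dec (E q 0 (t z) Bool.≟ false)))
  ... | yes found = inj₁ found
  ... | no none = inj₂ λ y z Ey y≢ y~z → inside y z Ey y≢ y~z (E q 0 (t z)) refl
    where
    inside : ∀ y z → E q 0 ∋ y → y ≢ c q 0 → y ~ z → ∀ b → E q 0 (t z) ≡ b → E q 0 ∋ z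
    inside y z Ey y≢ y~z true eq = eq
    inside y z Ey y≢ y~z false eq = contradiction (y , Ey , y≢ , z , y~z , eq) none

  Grown : ∀ {l} → LineSeq l → Set
  Grown q = ∃ λ m → Σ (LineSeq m) λ r → FrontClosed r × (BackClosed q → BackClosed r)

  extendable : ∀ {l} (q : LineSeq l) → Escaping q →
    Cyclic q ⊎ Σ (LineSeq (suc l)) λ r → BackClosed q → BackClosed r
  extendable q (y , Ey , y≢ , z , y~z , Ez) = decide (member? q y)
    where
    decide : (∃ λ i → i ≤ _ × y ≡ c q i) ⊎ (∀ i → i ≤ _ → y ≢ c q i) → _
    decide (inj₁ (zero , _ , eq)) = contradiction eq y≢
    decide (inj₁ (suc i , i≤ , eq)) = inj₁ (front-meets-chain q (s≤s z≤n) i≤ (subst (E q 0 ∋_) eq Ey))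
    decide (inj₂ fresh) = inj₂ (prepend q fresh Ey y~z Ez)

  -- The fuel `f` makes up for the growth of `l`; since crossing points are distinct edges at `s`,
  -- it cannot run out.
  grow : ∀ f {l} (q : LineSeq l) → d ≤ f + l → Closing ⊎ Grown q
  grow zero q d≤ = contradiction (≤-trans (length-bound q) d≤) (<⇒≱ (n<1+n _))
  grow (suc f) {l} q d≤ = [ continue , (λ closed → inj₂ (l , q , closed , id)) ]′ (escaping? q)
    where
    continue : Escaping q → Closing ⊎ Grown q
    continue esc with extendable q esc
    ... | inj₁ cyclic = inj₁ (l , q , cyclic)
    ... | inj₂ (r , keep) with grow f r (subst (d ≤_) (sym (+-suc f l)) d≤)
    ...   | inj₁ closing = inj₁ closing
    ...   | inj₂ (m , r′ , closed , keep′) = inj₂ (m , r′ , closed , keep′ ∘ keep)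

  Open : Set
  Open = ∃ λ l → Σ (LineSeq l) λ q → FrontClosed q × BackClosed q

  -- Growing at the front does not touch the last line, so closedness at the back persists. Hence
  -- one reversal, after the front is closed, suffices.
  close-both : ∀ {l} → LineSeq l → Closing ⊎ Open
  close-both {l} q = [ inj₁ , (λ (m , r , closed , _) → second r closed) ]′ (grow d q (m≤m+n d l))
    where
    second : ∀ {m} (r : LineSeq m) → FrontClosed r → Closing ⊎ Open
    second {m} r closed = [ inj₁ , (λ (m′ , r′ , closed′ , keep) → inj₂ (m′ , r′ , closed′ , keep (reverse-back r closed))) ]′
      (grow d (reverse r) (m≤m+n d m))

  two-lines : ∀ {X Y w z} → Line X → Line Y → X ∋ w → Pointed X w → Y ∋ w → Y ∋ z → X ∌ z → LineSeq 0
  two-lines {X} {Y} {w} {z} lX lY Xw other Yw Yz Xz = record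
    { c = λ _ → w ; E = E′ ; isLine = λ { {zero} _ → lX ; {suc _} _ → lY }
    ; on-left = λ { z≤n → Xw } ; on-right = λ _ → Yw
    ; distinct = λ { z≤n → distinct-sym lY lX (distinct-by {X} {Y} Yz Xz) }
    ; injective = λ { z≤n z≤n _ → refl }
    ; front = other
    ; back = z , ∌⇒≢ {X} Xw Xz , Yz }
    where
    E′ : ℕ → V → Bool
    E′ zero = X
    E′ (suc _) = Y

  module Linked (linked : ∀ x y → Star _~_ x y) where

    closed⇒all : ∀ (Q : Fin d → Set) → (∀ x y → Q x → x ~ y → Q y) → ∀ {x} → Q x → ∀ y → Q y
    closed⇒all Q closed {x} Qx y = along Qx (linked x y)
      where
      along : ∀ {x} → Q x → Star _~_ x y → Q y
      along Qx ε = Qx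
      along Qx (h ◅ hs) = along (closed _ _ Qx h) hs

    leaving : ∀ {X x} → D X → X ∋ x → ∃ λ w → X ∋ w × ∃ λ z → w ~ z × X ∌ z
    leaving {X} {x} dX Xx with any? (λ w → (X (t w) Bool.≟ true) ×-dec any? (λ z → (w ~? z) ×-dec (X (t z) Bool.≟ false)))
    ... | yes found = found
    ... | no none = ⊥-elim (true≢false (closed⇒all (X ∋_) inside Xx (proj₁ (misses dX Xx))) (proj₂ (misses dX Xx)))
      where
      stays : ∀ w z → X ∋ w → w ~ z → ∀ b → X (t z) ≡ b → X ∋ z
      stays w z Xw w~z true eq = eq
      stays w z Xw w~z false eq = contradiction (w , Xw , z , w~z , eq) none
      inside : ∀ w z → X ∋ w → w ~ z → X ∋ z
      inside w z Xw w~z = stays w z Xw w~z (X (t z)) refl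

    has-neighbour : ∀ x → ∃ λ y → y ≢ x × x ~ y
    has-neighbour x with any? (λ y → ¬? (y ≟ x) ×-dec (x ~? y))
    ... | yes found = found
    ... | no none = contradiction (cover-bound (x ∷ []) λ y → here (closed⇒all (_≡ x) alone refl y))
            (<⇒≱ (≤-trans (s≤s (s≤s z≤n)) 4<d))
      where
      alone : ∀ w y → w ≡ x → w ~ y → y ≡ x
      alone .x y refl x~y = decidable-stable (y ≟ x) λ y≢x → none (y , y≢x , x~y)

    start-at : Fin d → LineSeq 0
    start-at x with has-neighbour x
    ... | y , y≢x , x~y with line-through x~y
    ...   | X , lX , Xx , Xy with leaving {X} (isD lX) Xx
    ...     | w , Xw , z , w~z , Xz with line-through w~z
    ...       | Y , lY , Yw , Yz = two-lines lX lY Xw (other (y ≟ w)) Yw Yz Xz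
      where
      -- The line `X` holds both `x` and `y`, and one of them differs from `w`.
      other : Dec (y ≡ w) → Pointed X w
      other (no y≢w) = y , y≢w , Xy
      other (yes y≡w) = x , (λ x≡w → y≢x (trans y≡w (sym x≡w))) , Xx

    start : LineSeq 0
    start = start-at (fromℕ< {0} (≤-trans (s≤s z≤n) 4<d))

    chain : Closing ⊎ Open
    chain = close-both start

-- Families of tight sets

count-zero : ∀ {A : Set} (p : A → Bool) {x} xs → count p xs ≡ 0 → x ∈ xs → p x ≡ false
count-zero p xs none x∈ = ¬true⇒false λ px → <⇒≱ (count-positive p xs x∈ px) (≤-reflexive none)

Disj : {A : Set} → (A → Bool) → (A → Bool) → Set
Disj X Y = ∀ v → X v ≡ true → Y v ≡ true → ⊥

DisjAll : {A : Set} {m : ℕ} → (A → Bool) → Vec (A → Bool) m → Set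
DisjAll X [] = ⊤
DisjAll X (Y ∷ Ys) = Disj X Y × DisjAll X Ys

PairwiseDisj : {A : Set} {m : ℕ} → Vec (A → Bool) m → Set
PairwiseDisj [] = ⊤
PairwiseDisj (X ∷ Xs) = DisjAll X Xs × PairwiseDisj Xs

noneᵇ atMostOneᵇ : ∀ {m} → Label m → Bool
noneᵇ [] = true
noneᵇ (b ∷ l) = not b ∧ noneᵇ l
atMostOneᵇ [] = true
atMostOneᵇ (true ∷ l) = noneᵇ l
atMostOneᵇ (false ∷ l) = atMostOneᵇ l

DisjAll⇒none : ∀ {A : Set} {m} {X : A → Bool} (Ys : Vec (A → Bool) m) → DisjAll X Ys → ∀ v → X v ≡ true →
  noneᵇ (label Ys v) ≡ true
DisjAll⇒none [] _ v Xv = refl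
DisjAll⇒none (Y ∷ Ys) (XY , dis) v Xv =
  ∩-intro (cong not (¬true⇒false (XY v Xv))) (DisjAll⇒none Ys dis v Xv)

PairwiseDisj⇒atMostOne : ∀ {A : Set} {m} (Xs : Vec (A → Bool) m) → PairwiseDisj Xs → ∀ v →
  atMostOneᵇ (label Xs v) ≡ true
PairwiseDisj⇒atMostOne [] _ v = refl
PairwiseDisj⇒atMostOne (X ∷ Xs) (dis , diss) v with X v in Xv
... | true = DisjAll⇒none Xs dis v Xv
... | false = PairwiseDisj⇒atMostOne Xs diss v

in₅ : ∀ {m} → Label (5 + m) → Bool
in₅ (_ ∷ _ ∷ _ ∷ _ ∷ x ∷ _) = x

third-index : ∀ i j → ∃ λ h → h < 3 × h ≢ i × h ≢ j
third-index i j with 0 ℕ.≟ i | 0 ℕ.≟ j | 1 ℕ.≟ i | 1 ℕ.≟ j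
... | no p | no q | _ | _ = 0 , s≤s z≤n , p , q
... | _ | _ | no p | no q = 1 , s≤s (s≤s z≤n) , p , q
... | yes refl | _ | _ | yes refl = 2 , s≤s (s≤s (s≤s z≤n)) , (λ ()) , (λ ())
... | _ | yes refl | yes refl | _ = 2 , s≤s (s≤s (s≤s z≤n)) , (λ ()) , (λ ())
... | yes refl | _ | yes () | _
... | _ | yes refl | _ | yes ()

module TightFamilies (G : Graph) (s : Fin (n G)) (k : ℕ) (loopless : Loopless G)
  (sk : SKEdgeConnected G s k) (2≤k : 2 ≤ k) (4<d : 4 < deg G s) where

  open MaximalSets G s k loopless sk 2≤k 4<d

  spread₃ : ∀ H A B C → PairwiseDisj (H ∷ A ∷ B ∷ C ∷ []) → e H A + (e H B + e H C) ≤ δ H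
  spread₃ H A B C dis = regions-≤ id (H ∷ A ∷ B ∷ C ∷ []) (bothEnds atMostOneᵇ)
    (join in₁ in₂ ∷ join in₁ in₃ ∷ join in₁ in₄ ∷ []) (cut in₁ ∷ []) (edges G)
    (λ {ab} _ → bothEnds-at id (H ∷ A ∷ B ∷ C ∷ []) atMostOneᵇ (PairwiseDisj⇒atMostOne _ dis) ab)

  spread₄ : ∀ H A B C E → PairwiseDisj (H ∷ A ∷ B ∷ C ∷ E ∷ []) → e H A + (e H B + (e H C + e H E)) ≤ δ H
  spread₄ H A B C E dis = regions-≤ id (H ∷ A ∷ B ∷ C ∷ E ∷ []) (bothEnds atMostOneᵇ)
    (join in₁ in₂ ∷ join in₁ in₃ ∷ join in₁ in₄ ∷ join in₁ in₅ ∷ []) (cut in₁ ∷ []) (edges G)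
    (λ {ab} _ → bothEnds-at id (H ∷ A ∷ B ∷ C ∷ E ∷ []) atMostOneᵇ (PairwiseDisj⇒atMostOne _ dis) ab)

  -- Used with the blobs as the sets `A`: those known to be unconnected with `H` are discarded, and
  -- the far end of a leaving edge can only be in `N`.
  boundary-within : ∀ H N → (∀ v → H v ≡ true ⊎ N v ≡ true ⊎ ∃ λ A → A v ≡ true × e H A ≡ 0) → δ H ≤ e H N
  boundary-within H N only = regions-≤ id (H ∷ N ∷ []) ok (cut in₁ ∷ []) (join in₁ in₂ ∷ []) (edges G) okay
    where
    ok : EdgePredicate 2
    ok a b = not (in₁ a xor in₁ b) ∨ join in₁ in₂ a b
    inN : ∀ {a b} → (a , b) ∈ edges G ⊎ (b , a) ∈ edges G → H a ≡ true → H b ≡ false → N b ≡ true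
    inN {a} {b} ab∈ Ha Hb with only b
    ... | inj₁ Hb′ = ⊥-elim (true≢false Hb′ Hb)
    ... | inj₂ (inj₁ Nb) = Nb
    ... | inj₂ (inj₂ (A , Ab , none)) = ⊥-elim ([
            (λ ab∈ → true≢false (∨-trueˡ (∩-intro Ha Ab)) (count-zero _ (edges G) none ab∈)) ,
            (λ ba∈ → true≢false (∨-trueʳ {H b ∧ A a} (∩-intro Ha Ab)) (count-zero _ (edges G) none ba∈)) ]′ ab∈)
    okay : ∀ {ab} → ab ∈ edges G → at id (H ∷ N ∷ []) ok ab ≡ true
    okay {a , b} ab∈ with H a in Ha | H b in Hb
    ... | true | true = refl
    ... | false | false = refl
    ... | true | false rewrite inN (inj₁ ab∈) Ha Hb = refl
    ... | false | true rewrite inN (inj₂ ab∈) Hb Ha = refl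

  e-∅ : ∀ H → e H (λ _ → false) ≡ 0
  e-∅ H = regions-≡ id (H ∷ []) (λ _ _ → true) (join in₁ (λ _ → false) ∷ []) [] (edges G) (λ _ → refl)

  e-∪ : ∀ H A B → e H (A ∪ B) ≤ e H A + e H B
  e-∪ H A B = regions-≤ id (H ∷ A ∷ B ∷ []) (λ _ _ → true) (join in₁ (in₂ ∪ in₃) ∷ [])
    (join in₁ in₂ ∷ join in₁ in₃ ∷ []) (edges G) (λ _ → refl)

  Disj-S : ∀ {X : V → Bool} → X s ≡ false → Disj X S
  Disj-S {X} Xs v Xv v≡s = true≢false (subst (λ w → X w ≡ true) (⁅⁆-true v≡s) Xv) Xs

  module TightBlobs (nb : ℕ) (3≤nb : 3 ≤ nb) (B : ℕ → V → Bool) (rep : ℕ → Fin d) {p : ℕ} (odd : k ≡ suc (2 * p))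
    (noS : ∀ {i} → i < nb → B i s ≡ false) (tight : ∀ {i} → i < nb → δ (B i) ≡ k)
    (own : ∀ {i} → i < nb → B i ∋ rep i) (foreign : ∀ {i j} → i < nb → j < nb → i ≢ j → B i ∌ rep j)
    (tips-covered : ∀ z → ∃ λ i → i < nb × B i ∋ z) where

    disjoint : ∀ {i j v} → i < nb → j < nb → B i v ≡ true → B j v ≡ true → i ≡ j
    disjoint {i} {j} {v} i< j< Bi Bj with i ℕ.≟ j
    ... | yes i≡j = i≡j
    ... | no i≢j with third-index i j
    -- The representative of a third blob is the vertex outside both sets that `tight-disjoint`
    -- requires.
    ...   | h , h<3 , h≢i , h≢j = ⊥-elim (tight-disjoint {p} odd {B i} {B j} (noS i<) (noS j<) (tight i<) (tight j<)
              {t (rep i)} {t (rep j)} {t (rep h)}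
              (─-intro (own i<) (foreign j< i< (≢-sym i≢j))) (─-intro (own j<) (foreign i< j< i≢j))
              (t≢s (rep h)) (foreign i< h< (≢-sym h≢i)) (foreign j< h< (≢-sym h≢j)) {v} Bi Bj)
      where
      h< : h < nb
      h< = ≤-trans h<3 3≤nb

    Disj-B : ∀ {i j} → i < nb → j < nb → i ≢ j → Disj (B i) (B j)
    Disj-B i< j< i≢j v Bi Bj = i≢j (disjoint {v = v} i< j< Bi Bj)

    -- A blob with p edges to each of two others and one to s has no further edges, as its degree
    -- is 2p + 1.
    isolated : ∀ {i a b} → i < nb → a < nb → b < nb → i ≢ a → i ≢ b → a ≢ b →
      e (B i) S ≡ 1 → e (B i) (B a) ≡ p → e (B i) (B b) ≡ p →
      ∀ Z → Disj (B i) Z → Disj (B a) Z → Disj (B b) Z → Disj S Z → e (B i) Z ≡ 0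
    isolated {i} {a} {b} i< a< b< i≢a i≢b a≢b eS ea eb Z iZ aZ bZ sZ =
      linear 7 (λ k p ea eb es ez δ → ea ⊕ (eb ⊕ (es ⊕ ez)) ≼ δ ⇒ δ ≐ k ⇒ k ≐ 1+ (2 ⊛ p) ⇒ ea ≐ p ⇒ eb ≐ p ⇒ es ≐ # 1 ⇒ ⊢ ez ≐ # 0)
        k p (e (B i) (B a)) (e (B i) (B b)) (e (B i) S) (e (B i) Z) (δ (B i))
        (spread₄ (B i) (B a) (B b) S Z
          ((Disj-B i< a< i≢a , Disj-B i< b< i≢b , Disj-S {B i} (noS i<) , iZ , tt) ,
           (Disj-B a< b< a≢b , Disj-S {B a} (noS a<) , aZ , tt) ,
           (Disj-S {B b} (noS b<) , bZ , tt) , (sZ , tt) , tt , tt))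
        (tight i<) odd ea eb eS

    covered : V → Bool
    covered v = ⌊ any? (λ (i : Fin nb) → B (toℕ i) v Bool.≟ true) ⌋

    rest : V → Bool
    rest = ∁ (covered ∪ S)

    covered-true : ∀ {v} → covered v ≡ true → ∃ λ i → i < nb × B i v ≡ true
    covered-true {v} _ with any? (λ (i : Fin nb) → B (toℕ i) v Bool.≟ true)
    covered-true {v} _ | yes (i , Bi) = toℕ i , toℕ<n i , Bi

    true-covered : ∀ {v i} → i < nb → B i v ≡ true → covered v ≡ true
    true-covered {v} {i} i< Bi with any? (λ (i : Fin nb) → B (toℕ i) v Bool.≟ true)
    ... | yes _ = refl
    ... | no none = contradiction (fromℕ< i< , subst (λ j → B j v ≡ true) (sym (toℕ-fromℕ< i<)) Bi) none

    Disj-rest : ∀ {i} → i < nb → Disj (B i) rest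
    Disj-rest i< v Bi r = true≢false (∨-trueˡ (true-covered {v} i< Bi)) (not-true r)

    Disj-S-rest : Disj S rest
    Disj-S-rest v sv r = true≢false (∨-trueʳ {covered v} sv) (not-true r)

    rest-noS : rest s ≡ false
    rest-noS = rest-s {covered}

    no-tips : e rest S ≡ 0
    no-tips = trans (sym (countᶠ-tip G s rest rest-noS)) (n≤0⇒n≡0 (Σcount-mono (rest ∘ t ∷ []) [] (allFin d)
      λ {z} _ → none z))
      where
      none : ∀ z → bit (rest (t z)) ≤ 0
      none z with rest (t z) in r
      ... | false = z≤n
      ... | true with tips-covered z
      ...   | i , i< , Bz = ⊥-elim (Disj-rest i< (t z) Bz r)

    -- Leftover vertices have no edge to `s`, because every edge at `s` ends in a blob. So their
    -- whole boundary goes to `N`, and fewer than `k` edges do not suffice for a nonempty set.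
    covers-all : ∀ N → (∀ {i} → i < nb → e rest (B i) ≡ 0 ⊎ B i ⊑ N) → e rest N < k →
      ∀ v → v ≢ s → ∃ λ i → i < nb × B i v ≡ true
    covers-all N joins few v v≢s with covered v in cv
    ... | true = covered-true cv
    ... | false = ⊥-elim (<⇒≱ few (≤-trans
        (cuts rest rest-noS (rest-nonempty {covered} v≢s cv) (t≢s (rep 0))
          (cong not (∨-trueˡ (true-covered {t (rep 0)} 0< (own 0<)))))
        (boundary-within rest N within)))
      where
      0< : 0 < nb
      0< = ≤-trans (s≤s z≤n) 3≤nb
      blob : ∀ {w i} → B i w ≡ true → e rest (B i) ≡ 0 ⊎ B i ⊑ N → rest w ≡ true ⊎ N w ≡ true ⊎ ∃ λ A → A w ≡ true × e rest A ≡ 0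
      blob {w} {i} Bw (inj₁ none) = inj₂ (inj₂ (B i , Bw , none))
      blob {w} Bw (inj₂ sub) = inj₂ (inj₁ (sub w Bw))
      within : ∀ w → rest w ≡ true ⊎ N w ≡ true ⊎ ∃ λ A → A w ≡ true × e rest A ≡ 0
      within w with covered w in cw | S w in sw
      ... | false | false = inj₁ refl
      ... | false | true = inj₂ (inj₂ (S , sw , no-tips))
      ... | true | _ with covered-true {w} cw
      ...   | i , i< , Bw = keep (blob {w} {i} Bw (joins i<))
        where
        keep : rest w ≡ true ⊎ N w ≡ true ⊎ (∃ λ A → A w ≡ true × e rest A ≡ 0) → false ≡ true ⊎ N w ≡ true ⊎ ∃ λ A → A w ≡ true × e rest A ≡ 0
        keep (inj₁ r) = ⊥-elim (Disj-rest i< w Bw r)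
        keep (inj₂ q) = inj₂ q

-- The two shapes

-- The numbering of the blobs of a path: `0` and `l + 2` are the ends, and `suc i` belongs to the
-- crossing point `c i`.
select : {A : Set} → ℕ → A → (ℕ → A) → A → ℕ → A
select l a f b zero = a
select l a f b (suc i) = if i ≤ᵇ l then f i else b

select-middle : ∀ {A : Set} {l i} (a : A) f b → i ≤ l → select l a f b (suc i) ≡ f i
select-middle {l = l} {i} a f b i≤ rewrite Equivalence.to T-≡ (≤⇒≤ᵇ {i} {l} i≤) = refl

select-last : ∀ {A : Set} l (a : A) f b → select l a f b (2 + l) ≡ b
select-last l a f b rewrite ¬true⇒false {suc l ≤ᵇ l} (λ q → <⇒≱ (n<1+n l) (≤ᵇ⇒≤ (suc l) l (Equivalence.from T-≡ q))) = refl

data Spot (l : ℕ) : ℕ → Set where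
  first  : Spot l 0
  inside : ∀ {i} → i ≤ l → Spot l (suc i)
  last   : Spot l (2 + l)

spot : ∀ {l i} → i < 3 + l → Spot l i
spot {l} {zero} _ = first
spot {l} {suc i} (s≤s i<) with i ℕ.≟ suc l
... | yes refl = last
... | no i≢ = inside (s≤s⁻¹ (≤∧≢⇒< (s≤s⁻¹ i<) i≢))

module NonspecialCase (G : Graph) (s : Fin (n G)) (k : ℕ) (loopless : Loopless G)
  (sk : SKEdgeConnected G s k) (2≤k : 2 ≤ k) (4<d : 4 < deg G s)
  (nonspecial : ¬ SpecialCase.Special G s k loopless sk 2≤k 4<d) where

  open Chains G s k loopless sk 2≤k 4<d nonspecial public
  open TightFamilies G s k loopless sk 2≤k 4<d

  module Sequence {l : ℕ} (q : LineSeq l) where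

    open LineSeq q public

    M : ℕ → V → Bool
    M i = E i ∩ E (suc i)

    cross : ∀ {i} → i ≤ l → LinesCross (E i) (E (suc i)) (c i)
    cross i≤ = lines-cross (isLine (m≤n⇒m≤1+n i≤)) (isLine (s≤s i≤)) (on-left i≤) (on-right i≤) (distinct i≤)

    p : ℕ
    p = e (M 0) (E 0 ─ E 1)

    odd : k ≡ suc (2 * p)
    odd = LinesCross.halves (cross z≤n)

    1≤p : 1 ≤ p
    1≤p = linear 2 (λ k p → k ≐ 1+ (2 ⊛ p) ⇒ # 2 ≼ k ⇒ ⊢ # 1 ≼ p) k p odd 2≤k

    to-left : ∀ {i} → i ≤ l → e (M i) (E i ─ E (suc i)) ≡ p
    to-left {i} i≤ = linear 3 (λ k p r → k ≐ 1+ (2 ⊛ p) ⇒ k ≐ 1+ (2 ⊛ r) ⇒ ⊢ r ≐ p) k p (e (M i) (E i ─ E (suc i)))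
      odd (LinesCross.halves (cross i≤))

    to-right : ∀ {i} → i ≤ l → e (M i) (E (suc i) ─ E i) ≡ p
    to-right i≤ = trans (sym (LinesCross.balanced (cross i≤))) (to-left i≤)

    swap-∩ : ∀ (X Y : V → Bool) → (X ∩ Y) ≗ (Y ∩ X)
    swap-∩ X Y v = Bool.∧-comm (X v) (Y v)

    joined : ∀ {i} → i < l → e (M i) (M (suc i)) ≡ p
    joined {i} i< = trans
      (e-cong {M i} {E (suc i) ∩ E i} {M (suc i)} {M (suc i)} (swap-∩ (E i) (E (suc i))) (λ _ → refl))
      (trans (Middle.joined (inner-line i<))
      (trans (e-cong {E (suc i) ∩ E i} {M i} {E (suc i) ─ E i} {E (suc i) ─ E i} (swap-∩ (E (suc i)) (E i)) (λ _ → refl))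
        (to-right (<⇒≤ i<))))

    M-noS : ∀ {i} → i ≤ l → M i s ≡ false
    M-noS i≤ = ∧-falseˡ (avoids (isD (isLine (m≤n⇒m≤1+n i≤))))

    M-own : ∀ {i} → i ≤ l → M i ∋ c i
    M-own i≤ = ∩-intro (on-left i≤) (on-right i≤)

    M-only : ∀ {i z} → i ≤ l → M i ∋ z → z ≡ c i
    M-only {i} {z} i≤ z∈ = LinesCross.only (cross i≤) (proj₁ (∧-true {E i (t z)} z∈)) (proj₂ (∧-true {E i (t z)} z∈))

    Member : Fin d → Set
    Member z = ∃ λ i → i ≤ l × z ≡ c i

    inner-member : ∀ {i z} → i < l → E (suc i) ∋ z → Member z
    inner-member {i} i< z∈ = [ (λ eq → i , <⇒≤ i< , eq) , (λ eq → suc i , i< , eq) ]′ (inner-points i< z∈)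

    chain-unique : Unique (applyUpTo c (suc l))
    chain-unique = Unique.applyUpTo⁺₁ c (suc l) λ i<j j< → c≢ (≤-trans (<⇒≤ i<j) (s≤s⁻¹ j<)) (s≤s⁻¹ j<) (<⇒≢ i<j)

    consecutive : ∀ {i} → i < l → C (c i) (c (suc i))
    consecutive {i} i< = ~⇒C (c≢ (<⇒≤ i<) i< (<⇒≢ (n<1+n i)))
      (together (E (suc i)) (isD (isLine (m≤n⇒m≤1+n i<))) (on-right (<⇒≤ i<)) (on-left i<))

    far-right : ∀ {i j} → suc i < j → j ≤ l → E (suc i) ∋ c j → ⊥
    far-right {i} {j} i<j j≤ z∈ = [ c≢ j≤ (<⇒≤ (<⇒≤ i<l)) (>⇒≢ (<⇒≤ i<j)) , c≢ j≤ (<⇒≤ i<l) (>⇒≢ i<j) ]′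
      (inner-points (<⇒≤ i<l) z∈)
      where
      i<l : suc (suc i) ≤ l
      i<l = ≤-trans i<j j≤

    far-left : ∀ {i j} → suc (suc i) < j → j ≤ l → E (suc i) ∋ c j → ⊥
    far-left i<j = far-right (<⇒≤ i<j)

  module Cycle {l : ℕ} (q : LineSeq l) (cyclic : LineSeq.Cyclic q) (linked : ∀ x y → Star _~_ x y) where

    open Sequence q
    open Linked linked

    1≤l : 1 ≤ l
    1≤l = proj₁ cyclic

    same : ∀ v → E 0 v ≡ E (suc l) v
    same v = decide (E 0 v) (E (suc l) v) (proj₁ (proj₂ cyclic) v) (proj₂ (proj₂ cyclic) v)
      where
      decide : ∀ a b → (a ≡ true → b ≡ true) → (b ≡ true → a ≡ true) → a ≡ b
      decide true b f g = sym (f refl)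
      decide false true f g = g refl
      decide false false f g = refl

    E₀∋cl : E 0 ∋ c l
    E₀∋cl = proj₂ (proj₂ cyclic) (t (c l)) (on-right ≤-refl)

    -- As `E 0` and `E (l + 1)` agree, this line also lies between two others, and the analysis of
    -- inner lines applies at the place where the cycle closes.
    first-line : Middle (E 0) (E l) (E 1) (c l) (c 0)
    first-line = middle (isLine z≤n) (isLine (n≤1+n l)) (isLine (s≤s z≤n)) (c≢ ≤-refl z≤n (>⇒≢ 1≤l))
      E₀∋cl (on-left ≤-refl) (on-left z≤n) (on-right z≤n) E₀≠El (distinct z≤n)
      where
      E₀≠El : Distinct (E 0) (E l)
      E₀≠El with distinct-sym (isLine (n≤1+n l)) (isLine ≤-refl) (distinct ≤-refl)
      ... | v , v∈ = v , trans (cong (_∧ not (E l v)) (same v)) v∈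

    first-member : ∀ {z} → E 0 ∋ z → Member z
    first-member z∈ = [ (λ eq → l , ≤-refl , eq) , (λ eq → 0 , z≤n , eq) ]′ (Middle.pair first-line z∈)

    left-member : ∀ {i z} → i ≤ l → E i ∋ z → Member z
    left-member {zero} _ z∈ = first-member z∈
    left-member {suc i} i≤ z∈ = inner-member i≤ z∈

    right-member : ∀ {i z} → i ≤ l → E (suc i) ∋ z → Member z
    right-member {i} {z} i≤ z∈ with i ℕ.≟ l
    ... | yes refl = first-member (proj₂ (proj₂ cyclic) (t z) z∈)
    ... | no i≢l = inner-member (≤∧≢⇒< i≤ i≢l) z∈

    all-members : ∀ z → Member z
    all-members = closed⇒all Member (λ { _ y (i , i≤ , refl) x~y → [ left-member i≤ , right-member i≤ ]′ (chain-neighbours i≤ x~y) })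
      (0 , z≤n , refl)

    listed : ∀ z → z ∈ applyUpTo c (suc l)
    listed z with all-members z
    ... | i , i≤ , refl = ∈-applyUpTo⁺ c (s≤s i≤)

    -- All edges at `s` are crossing points, so there are at least five. In particular the blobs
    -- before and after a given one are different.
    long : 4 ≤ l
    long = s≤s⁻¹ (≤-trans 4<d (subst (d ≤_) (length-applyUpTo c (suc l)) (cover-bound {d} (applyUpTo c (suc l)) listed)))

    hamilton : HamiltonCycle d C
    hamilton = hamiltonCycle {c = c} {l = l} (λ {x} {y} → C-sym {x} {y}) (λ {x} → C-irrefl {x}) consecutive
      (~⇒C (c≢ ≤-refl z≤n (>⇒≢ 1≤l)) (together (E 0) (isD (isLine z≤n)) E₀∋cl (on-left z≤n)))
      (λ {i} {j} i<j j≤ ne h → apart i<j j≤ ne (chain-neighbours (≤-trans (<⇒≤ (<⇒≤ i<j)) j≤) (C⇒~ {c i} {c j} h)))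
      chain-unique listed
      where
      apart : ∀ {i j} → suc i < j → j ≤ l → i ≢ 0 ⊎ j ≢ l → ¬ (E i ∋ c j ⊎ E (suc i) ∋ c j)
      apart i<j j≤ _ (inj₂ z∈) = far-right i<j j≤ z∈
      apart {suc i} i<j j≤ _ (inj₁ z∈) = far-left i<j j≤ z∈
      apart {zero} i<j j≤ (inj₁ 0≢0) (inj₁ z∈) = contradiction refl 0≢0
      apart {zero} {j} i<j j≤ (inj₂ j≢l) (inj₁ z∈) =
        [ c≢ j≤ ≤-refl j≢l , c≢ j≤ z≤n (>⇒≢ (<⇒≤ i<j)) ]′ (Middle.pair first-line z∈)

    closing-edges : e (M l) (M 0) ≡ p
    closing-edges = trans
      (e-cong {M l} {E 0 ∩ E l} {M 0} {M 0} (λ v → trans (swap-∩ (E l) (E (suc l)) v) (cong (_∧ E l v) (sym (same v)))) (λ _ → refl))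
      (trans (Middle.joined first-line)
      (trans (e-cong {E 0 ∩ E l} {M l} {E 0 ─ E l} {E (suc l) ─ E l}
          (λ v → trans (cong (_∧ E l v) (same v)) (swap-∩ (E (suc l)) (E l) v)) (λ v → cong (_∧ not (E l v)) (same v)))
        (to-right ≤-refl)))

    open TightBlobs (suc l) (s≤s (≤-trans (s≤s (s≤s z≤n)) long)) M c {p} odd (λ i< → M-noS (s≤s⁻¹ i<))
      (λ i< → LinesCross.δ∩ (cross (s≤s⁻¹ i<))) (λ i< → M-own (s≤s⁻¹ i<))
      (λ i< j< i≢j → ¬true⇒false λ z∈ → c≢ (s≤s⁻¹ j<) (s≤s⁻¹ i<) (≢-sym i≢j) (M-only (s≤s⁻¹ i<) z∈))
      (λ z → proj₁ (all-members z) , s≤s (proj₁ (proj₂ (all-members z))) ,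
        subst (M (proj₁ (all-members z)) ∋_) (sym (proj₂ (proj₂ (all-members z)))) (M-own (proj₁ (proj₂ (all-members z)))))

    prev next : ℕ → ℕ
    prev = predMod (suc l)
    next = succMod (suc l)

    next-last : next l ≡ 0
    next-last rewrite ≡ᵇ-true {l} refl = refl

    next-inner : ∀ {i} → i < l → next i ≡ suc i
    next-inner i< rewrite ≡ᵇ-false (<⇒≢ i<) = refl

    record Neighbours (i : ℕ) : Set where
      field
        prev<  : prev i < suc l
        next<  : next i < suc l
        i≢prev : i ≢ prev i
        i≢next : i ≢ next i
        prev≢next : prev i ≢ next i
        e-prev : e (M i) (M (prev i)) ≡ p
        e-next : e (M i) (M (next i)) ≡ p

    e-before : ∀ {i} → i ≤ l → e (M i) (M (prev i)) ≡ p
    e-before {zero} _ = trans (e-comm (M 0) (M l)) closing-edges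
    e-before {suc i} i≤ = trans (e-comm (M (suc i)) (M i)) (joined i≤)

    around : ∀ i → i ≤ l → Neighbours i
    around zero _ = record
      { prev< = ≤-refl ; next< = subst (_< suc l) (sym (next-inner 1≤l)) (s≤s 1≤l)
      ; i≢prev = <⇒≢ 1≤l ; i≢next = λ eq → 0≢1+n (trans eq (next-inner 1≤l))
      ; prev≢next = λ eq → >⇒≢ (≤-trans (s≤s (s≤s z≤n)) long) (trans eq (next-inner 1≤l))
      ; e-prev = e-before z≤n ; e-next = subst (λ j → e (M 0) (M j) ≡ p) (sym (next-inner 1≤l)) (joined 1≤l) }
    around (suc i) i≤ with suc i ℕ.≟ l
    ... | yes refl = record
      { prev< = s≤s (n≤1+n i) ; next< = subst (_< suc l) (sym next-last) (s≤s z≤n)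
      ; i≢prev = >⇒≢ (n<1+n i) ; i≢next = λ eq → 0≢1+n (trans (sym next-last) (sym eq))
      ; prev≢next = λ eq → >⇒≢ (s≤s⁻¹ (≤-trans (s≤s (s≤s z≤n)) long)) (trans eq next-last)
      ; e-prev = e-before i≤ ; e-next = subst (λ j → e (M (suc i)) (M j) ≡ p) (sym next-last) closing-edges }
    ... | no ne = record
      { prev< = s≤s (<⇒≤ i≤) ; next< = subst (_< suc l) (sym (next-inner i<)) (s≤s i<)
      ; i≢prev = >⇒≢ (n<1+n i) ; i≢next = λ eq → <⇒≢ (n<1+n (suc i)) (trans eq (next-inner i<))
      ; prev≢next = λ eq → <⇒≢ (m<n⇒m<1+n (n<1+n i)) (trans eq (next-inner i<))
      ; e-prev = e-before i≤ ; e-next = subst (λ j → e (M (suc i)) (M j) ≡ p) (sym (next-inner i<)) (joined i<) }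
      where
      i< : suc i < l
      i< = ≤∧≢⇒< i≤ ne

    cycle-structure : StructureClaim G s k (CycleStructure G s) (IsolatedPlusBalancedBipartite d L)
    cycle-structure = structureClaim (CycleStructure G s) p (suc l) M (λ i< → M-noS (s≤s⁻¹ i<)) disjoint
      (covers-all (λ _ → false) (λ i< → inj₁ (alone i<)) (subst (_< k) (sym (e-∅ rest)) (≤-trans (s≤s z≤n) 2≤k)))
      (λ cond → 1≤p , s≤s (≤-trans (s≤s (s≤s z≤n)) long) , λ i i< → let open Neighbours (around i (s≤s⁻¹ i<)) in
        cond i< prev< next< (trans (LinesCross.δ∩ (cross (s≤s⁻¹ i<))) odd) (LinesCross.tip≡1 (cross (s≤s⁻¹ i<))) e-prev e-next)
      (inj₁ (odd , λ i i< → ≤-reflexive (LinesCross.δ∩ (cross (s≤s⁻¹ i<)))))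
      where
      alone : ∀ {i} → i < suc l → e rest (M i) ≡ 0
      alone {i} i< = trans (e-comm rest (M i)) (isolated i< prev< next< i≢prev i≢next prev≢next
        (LinesCross.tip≡1 (cross (s≤s⁻¹ i<))) e-prev e-next rest (Disj-rest i<) (Disj-rest prev<) (Disj-rest next<) Disj-S-rest)
        where open Neighbours (around i (s≤s⁻¹ i<))

  module Front {l : ℕ} (q : LineSeq l) (closed : LineSeq.FrontClosed q) where

    open Sequence q

    -- If `z` were a later crossing point, the second edge of each of its two lines would be related
    -- to `z` and so lie in `E 0` by closedness. Sharing two edges with `E 0`, both lines would
    -- coincide with it, although they are distinct.
    off-chain : ∀ {i z} → E 0 ∋ z → z ≢ c 0 → i ≤ l → z ≢ c i
    off-chain {zero} _ z≢ _ = z≢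
    off-chain {suc i} {z} z∈ z≢ i≤ z≡ = distinct⇒¬⊑ {X = E (suc i)} {E (2 + i)} (distinct i≤) λ v v∈ →
      maximal (isLine (s≤s i≤)) (isD (isLine z≤n)) E₂⊑E₀ v (E₁⊑E₀ v v∈)
      where
      on₁ : E (suc i) ∋ z
      on₁ = subst (E (suc i) ∋_) (sym z≡) (on-left i≤)
      on₂ : E (2 + i) ∋ z
      on₂ = subst (E (2 + i) ∋_) (sym z≡) (on-right i≤)
      inherit : ∀ {X u} → Line X → X ∋ z → X ∋ u → u ≢ z → X ⊑ E 0
      inherit {X} {u} lX Xz Xu u≢z = same-line lX (isLine z≤n) (≢-sym u≢z) Xz z∈ Xu
        (closed z u z∈ z≢ (together X (isD lX) Xz Xu))
      E₁⊑E₀ : E (suc i) ⊑ E 0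
      E₁⊑E₀ = inherit (isLine (m≤n⇒m≤1+n i≤)) on₁ (on-right (<⇒≤ i≤))
        (λ eq → c≢ (<⇒≤ i≤) i≤ (<⇒≢ (n<1+n i)) (trans eq z≡))
      E₂⊑E₀ : E (2 + i) ⊑ E 0
      E₂⊑E₀ = inherit (isLine (s≤s i≤)) on₂ (proj₂ (proj₂ (pointed-right i≤)))
        (λ eq → proj₁ (proj₂ (pointed-right i≤)) (trans eq z≡))

    -- Otherwise `z` would be related to `c l`, which closedness then puts into `E 0` against
    -- `off-chain`; for `l = 0` the two lines share only `c 0`.
    off-back : ∀ {z} → E 0 ∋ z → z ≢ c 0 → E (suc l) ∌ z
    off-back {z} z∈ z≢ = ¬true⇒false λ El → meet l ≤-refl El
      where
      meet : ∀ j → j ≤ l → E (suc j) ∋ z → ⊥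
      meet zero _ E₁ = z≢ (LinesCross.only (cross z≤n) z∈ E₁)
      meet (suc j) j≤ Ej = off-chain {suc j} (closed z (c (suc j)) z∈ z≢
          (together (E (2 + j)) (isD (isLine (s≤s j≤))) Ej (on-right j≤))) (c≢ j≤ z≤n (λ ())) j≤ refl

    front-apart : ∀ {i z} → E 0 ∋ z → z ≢ c 0 → 1 ≤ i → i ≤ l → ¬ z ~ c i
    front-apart {i} {z} z∈ z≢ 1≤i i≤ z~c = off-chain {i} (closed z (c i) z∈ z≢ z~c) (c≢ i≤ z≤n (>⇒≢ 1≤i)) i≤ refl

    private-tip : ∀ {z} → (E 0 ─ E 1) ∋ z → E 0 ∋ z × z ≢ c 0
    private-tip {z} z∈ with ∧-true {E 0 (t z)} z∈
    ... | p , q = p , λ { refl → true≢false (on-right z≤n) (not-true q) }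

    tip-private : ∀ {z} → E 0 ∋ z → z ≢ c 0 → (E 0 ─ E 1) ∋ z
    tip-private z∈ z≢ = ─-intro z∈ (¬true⇒false λ E₁ → z≢ (LinesCross.only (cross z≤n) z∈ E₁))

  module PathCase {l : ℕ} (q : LineSeq l) (frontClosed : LineSeq.FrontClosed q) (backClosed : LineSeq.BackClosed q)
    (linked : ∀ x y → Star _~_ x y) where

    open Sequence q
    open Linked linked
    module F = Front q frontClosed
    -- Indices `0` of the reversed chain reduce to `l + 1` for lines and `l` for points, so
    -- `backClosed` is front-closedness of the reversal as it stands.
    module R = Front (reverse q) backClosed

    H₀ Hₗ : V → Bool
    H₀ = E 0 ─ E 1
    Hₗ = E (suc l) ─ E l

    back-off-chain : ∀ {i z} → E (suc l) ∋ z → z ≢ c l → i ≤ l → z ≢ c i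
    back-off-chain {i} {z} z∈ z≢ i≤ = subst (λ j → z ≢ c j) (m∸[m∸n]≡n i≤) (R.off-chain {l ∸ i} z∈ z≢ (m∸n≤m l i))

    back-off-front : ∀ {z} → E (suc l) ∋ z → z ≢ c l → E 0 ∌ z
    back-off-front {z} z∈ z≢ = subst (λ j → E j ∌ z) (n∸n≡0 l) (R.off-back z∈ z≢)

    back-apart : ∀ {i z} → E (suc l) ∋ z → z ≢ c l → i < l → ¬ z ~ c i
    back-apart {i} {z} z∈ z≢ i< = subst (λ j → ¬ z ~ c j) (m∸[m∸n]≡n (<⇒≤ i<))
      (R.front-apart {l ∸ i} z∈ z≢ (m<n⇒0<n∸m i<) (m∸n≤m l i))

    back-tip : ∀ {z} → Hₗ ∋ z → E (suc l) ∋ z × z ≢ c l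
    back-tip = R.private-tip

    tip-back : ∀ {z} → E (suc l) ∋ z → z ≢ c l → Hₗ ∋ z
    tip-back = R.tip-private

    Located : Fin d → Set
    Located z = E 0 ∋ z ⊎ Member z ⊎ E (suc l) ∋ z

    left-located : ∀ {i z} → i ≤ l → E i ∋ z → Located z
    left-located {zero} _ z∈ = inj₁ z∈
    left-located {suc i} i≤ z∈ = inj₂ (inj₁ (inner-member i≤ z∈))

    right-located : ∀ {i z} → i ≤ l → E (suc i) ∋ z → Located z
    right-located {i} i≤ z∈ with i ℕ.≟ l
    ... | yes refl = inj₂ (inj₂ z∈)
    ... | no i≢l = inj₂ (inj₁ (inner-member (≤∧≢⇒< i≤ i≢l) z∈))

    chain-closed : ∀ {i z} → i ≤ l → c i ~ z → Located z
    chain-closed i≤ h = [ left-located i≤ , right-located i≤ ]′ (chain-neighbours i≤ h)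

    located-closed : ∀ x y → Located x → x ~ y → Located y
    located-closed x y (inj₁ x∈) x~y with x ≟ c 0
    ... | yes refl = chain-closed z≤n x~y
    ... | no x≢ = inj₁ (frontClosed x y x∈ x≢ x~y)
    located-closed x y (inj₂ (inj₁ (i , i≤ , refl))) x~y = chain-closed i≤ x~y
    located-closed x y (inj₂ (inj₂ x∈)) x~y with x ≟ c l
    ... | yes refl = chain-closed ≤-refl x~y
    ... | no x≢ = inj₂ (inj₂ (backClosed x y x∈ x≢ x~y))

    located : ∀ z → Located z
    located = closed⇒all Located located-closed (inj₁ (on-left z≤n))

    data Position (z : Fin d) : Set where
      atFront : E 0 ∋ z → z ≢ c 0 → Position z
      onChain : ∀ i → i ≤ l → z ≡ c i → Position z
      atBack  : E (suc l) ∋ z → z ≢ c l → Position z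

    positioned : ∀ z → Position z
    positioned z with located z
    ... | inj₂ (inj₁ (i , i≤ , eq)) = onChain i i≤ eq
    ... | inj₁ z∈ with z ≟ c 0
    ...   | yes eq = onChain 0 z≤n eq
    ...   | no z≢ = atFront z∈ z≢
    positioned z | inj₂ (inj₂ z∈) with z ≟ c l
    ...   | yes eq = onChain l ≤-refl eq
    ...   | no z≢ = atBack z∈ z≢

    B : ℕ → V → Bool
    B = select l H₀ M Hₗ

    rep : ℕ → Fin d
    rep = select l (proj₁ front) c (proj₁ back)

    B-middle : ∀ {i} → i ≤ l → B (suc i) ≡ M i
    B-middle = select-middle H₀ M Hₗ

    B-last : B (2 + l) ≡ Hₗ
    B-last = select-last l H₀ M Hₗ

    private
      E₀s = avoids (isD (isLine {0} z≤n))
      Eₗs = avoids (isD (isLine {suc l} ≤-refl))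

    noS : ∀ {i} → i < 3 + l → B i s ≡ false
    noS i< with spot i<
    ... | first = ∧-falseˡ E₀s
    ... | inside i≤ = subst (λ X → X s ≡ false) (sym (B-middle i≤)) (M-noS i≤)
    ... | last = subst (λ X → X s ≡ false) (sym B-last) (∧-falseˡ Eₗs)

    tight : ∀ {i} → i < 3 + l → δ (B i) ≡ k
    tight i< with spot i<
    ... | first = LinesCross.δX─Y (cross z≤n)
    ... | inside i≤ = subst (λ X → δ X ≡ k) (sym (B-middle i≤)) (LinesCross.δ∩ (cross i≤))
    ... | last = subst (λ X → δ X ≡ k) (sym B-last) (LinesCross.δY─X (cross ≤-refl))

    data RepSpot (i : ℕ) : Set where
      rep-front : i ≡ 0 → E 0 ∋ rep i → rep i ≢ c 0 → RepSpot i
      rep-chain : ∀ j → j ≤ l → i ≡ suc j → rep i ≡ c j → RepSpot i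
      rep-back  : i ≡ 2 + l → E (suc l) ∋ rep i → rep i ≢ c l → RepSpot i

    rep-spot : ∀ {i} → i < 3 + l → RepSpot i
    rep-spot i< with spot i<
    ... | first = rep-front refl (proj₂ (proj₂ front)) (proj₁ (proj₂ front))
    ... | inside {i} i≤ = rep-chain i i≤ refl (select-middle (proj₁ front) c (proj₁ back) i≤)
    ... | last = rep-back refl (subst (E (suc l) ∋_) (sym (select-last l (proj₁ front) c (proj₁ back))) (proj₂ (proj₂ back)))
      (subst (_≢ c l) (sym (select-last l (proj₁ front) c (proj₁ back))) (proj₁ (proj₂ back)))

    own : ∀ {i} → i < 3 + l → B i ∋ rep i
    own {i} i< with rep-spot i<
    ... | rep-front refl z∈ z≢ = F.tip-private z∈ z≢
    ... | rep-chain j j≤ refl eq = subst (λ X → X ∋ rep i) (sym (B-middle j≤)) (subst (M j ∋_) (sym eq) (M-own j≤))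
    ... | rep-back refl z∈ z≢ = subst (λ X → X ∋ rep i) (sym B-last) (tip-back z∈ z≢)

    foreign : ∀ {i j} → i < 3 + l → j < 3 + l → i ≢ j → B i ∌ rep j
    foreign {i} {j} i< j< i≢j = ¬true⇒false (excluded (spot i<) (rep-spot j<) i≢j)
      where
      excluded : ∀ {i} → Spot l i → RepSpot j → i ≢ j → B i ∋ rep j → ⊥
      excluded first (rep-front refl _ _) i≢j _ = i≢j refl
      excluded first (rep-chain a a≤ _ eq) _ z∈ with F.private-tip z∈
      ... | p , z≢ = F.off-chain p z≢ a≤ eq
      excluded first (rep-back _ z∈′ z≢′) _ z∈ = true≢false (proj₁ (F.private-tip z∈)) (back-off-front z∈′ z≢′)
      excluded (inside {b} b≤) r i≢j z∈ = in-middle r (M-only b≤ (subst (λ X → X ∋ rep j) (B-middle b≤) z∈))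
        where
        in-middle : RepSpot j → rep j ≡ c b → ⊥
        in-middle (rep-front _ w∈ w≢) eq = F.off-chain w∈ w≢ b≤ eq
        in-middle (rep-chain a a≤ refl eq′) eq = i≢j (cong suc (injective b≤ a≤ (trans (sym eq) eq′)))
        in-middle (rep-back _ w∈ w≢) eq = back-off-chain w∈ w≢ b≤ eq
      excluded last r i≢j z∈ = at-last r (back-tip (subst (λ X → X ∋ rep j) B-last z∈))
        where
        at-last : RepSpot j → E (suc l) ∋ rep j × rep j ≢ c l → ⊥
        at-last (rep-front _ w∈ w≢) (p , _) = true≢false p (F.off-back w∈ w≢)
        at-last (rep-chain a a≤ _ eq) (p , z≢) = back-off-chain p z≢ a≤ eq
        at-last (rep-back refl _ _) _ = i≢j refl

    mid< : ∀ {i} → i ≤ l → suc i < 3 + l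
    mid< i≤ = s≤s (s≤s (m≤n⇒m≤1+n i≤))

    last< : 2 + l < 3 + l
    last< = ≤-refl

    tips-covered : ∀ z → ∃ λ i → i < 3 + l × B i ∋ z
    tips-covered z with positioned z
    ... | atFront z∈ z≢ = 0 , s≤s z≤n , F.tip-private z∈ z≢
    ... | onChain i i≤ refl = suc i , mid< i≤ , subst (λ X → X ∋ c i) (sym (B-middle i≤)) (M-own i≤)
    ... | atBack z∈ z≢ = 2 + l , last< , subst (λ X → X ∋ z) (sym B-last) (tip-back z∈ z≢)

    open TightBlobs (3 + l) (m≤m+n 3 l) B rep {p} odd noS tight own foreign tips-covered

    middle-tip : ∀ {i} → i ≤ l → e (B (suc i)) S ≡ 1
    middle-tip i≤ = subst (λ X → e X S ≡ 1) (sym (B-middle i≤)) (LinesCross.tip≡1 (cross i≤))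

    e-before : ∀ {i} → i ≤ l → e (B (suc i)) (B i) ≡ p
    e-before {zero} i≤ = subst (λ X → e X H₀ ≡ p) (sym (B-middle i≤)) (to-left i≤)
    e-before {suc i} i≤ = subst₂ (λ X Y → e X Y ≡ p) (sym (B-middle i≤)) (sym (B-middle (<⇒≤ i≤))) (trans (e-comm (M (suc i)) (M i)) (joined i≤))

    e-after : ∀ {i} → i ≤ l → e (B (suc i)) (B (2 + i)) ≡ p
    e-after {i} i≤ with i ℕ.≟ l
    ... | yes refl = trans (cong₂ e (B-middle i≤) B-last) (to-right i≤)
    ... | no i≢l = trans (cong₂ e (B-middle i≤) (B-middle (≤∧≢⇒< i≤ i≢l))) (joined (≤∧≢⇒< i≤ i≢l))

    middle-isolated : ∀ {i} → i ≤ l → ∀ Z → Disj (B (suc i)) Z → Disj (B i) Z → Disj (B (2 + i)) Z → Disj S Z → e (B (suc i)) Z ≡ 0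
    middle-isolated {i} i≤ Z = isolated (mid< i≤) (<⇒≤ (mid< i≤)) (s≤s (s≤s (s≤s i≤)))
      (>⇒≢ (n<1+n i)) (<⇒≢ (n<1+n (suc i))) (<⇒≢ (m<n⇒m<1+n (n<1+n i))) (middle-tip i≤) (e-before i≤) (e-after i≤) Z

    end-tips : ∀ {i} → i < 3 + l → 1 ≤ e (B i) S
    end-tips {i} i< = tip≤ {B i} (noS i<) {rep i} (own i<)

    -- Of its `2 p + 1` boundary edges an end blob spends `p` on its neighbour and at least one on
    -- `s`. So both ends together give the leftover vertices at most `2 p` edges, fewer than `k`.
    rest-end : ∀ {i j} → i < 3 + l → j < 3 + l → i ≢ j → e (B i) (B j) ≡ p → e rest (B i) ≤ p
    rest-end {i} {j} i< j< i≢j ep =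
      linear 6 (λ k p r m a δ → r ⊕ (m ⊕ a) ≼ δ ⇒ δ ≐ k ⇒ k ≐ 1+ (2 ⊛ p) ⇒ m ≐ p ⇒ # 1 ≼ a ⇒ ⊢ r ≼ p)
        k p (e rest (B i)) (e (B i) (B j)) (e (B i) S) (δ (B i))
        (subst (λ x → x + (e (B i) (B j) + e (B i) S) ≤ δ (B i)) (e-comm (B i) rest)
          (spread₃ (B i) rest (B j) S
            ((Disj-rest i< , Disj-B i< j< i≢j , Disj-S {B i} (noS i<) , tt) ,
             ((λ v r b → Disj-rest j< v b r) , (λ v r sv → Disj-S-rest v sv r) , tt) , (Disj-S {B j} (noS j<) , tt) , tt , tt)))
        (tight i<) odd ep (end-tips i<)

    0< : 0 < 3 + l
    0< = s≤s z≤n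

    e-first : e (B 0) (B 1) ≡ p
    e-first = trans (e-comm (B 0) (B 1)) (e-before z≤n)

    e-last : e (B (2 + l)) (B (suc l)) ≡ p
    e-last = trans (e-comm (B (2 + l)) (B (suc l))) (e-after ≤-refl)

    cover : ∀ v → v ≢ s → ∃ λ i → i < 3 + l × B i v ≡ true
    cover = covers-all (B 0 ∪ B (2 + l)) (λ i< → joins (spot i<))
      (linear 5 (λ k p n a b → n ≼ a ⊕ b ⇒ a ≼ p ⇒ b ≼ p ⇒ k ≐ 1+ (2 ⊛ p) ⇒ ⊢ 1+ n ≼ k)
        k p (e rest (B 0 ∪ B (2 + l))) (e rest (B 0)) (e rest (B (2 + l))) (e-∪ rest (B 0) (B (2 + l)))
        (rest-end 0< (mid< z≤n) (λ ()) e-first)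
        (rest-end last< (mid< ≤-refl) (>⇒≢ (n<1+n (suc l))) e-last) odd)
      where
      joins : ∀ {i} → Spot l i → e rest (B i) ≡ 0 ⊎ B i ⊑ (B 0 ∪ B (2 + l))
      joins first = inj₂ λ v → ∨-trueˡ
      joins last = inj₂ λ v → ∨-trueʳ {B 0 v}
      joins (inside {i} i≤) = inj₁ (trans (e-comm rest (B (suc i))) (middle-isolated i≤ rest
        (Disj-rest (mid< i≤)) (Disj-rest (<⇒≤ (mid< i≤))) (Disj-rest (s≤s (s≤s (s≤s i≤)))) Disj-S-rest))

    -- The boundary of an end blob goes to its neighbour `m`, to `s` and to the opposite end `z′`.
    -- Edges between the two ends cannot be excluded, but their number is the same seen from either
    -- end.
    end-degree : ∀ {z m z′} → z < 3 + l → m < 3 + l → z′ < 3 + l → z ≢ m → z ≢ z′ → m ≢ z′ → e (B z) (B m) ≡ p →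
      (∀ {i} → i < 3 + l → i ≡ z ⊎ i ≡ m ⊎ i ≡ z′ ⊎ e (B z) (B i) ≡ 0) → k ≡ p + (e (B z) S + e (B z) (B z′))
    end-degree {z} {m} {z′} z< m< z′< z≢m z≢z′ m≢z′ em others = ≤-antisym
      (subst₂ _≤_ (tight z<) (cong (_+ (e (B z) S + e (B z) (B z′))) em)
        (≤-trans (boundary-within (B z) N within) (≤-trans (e-∪ (B z) (B m) (S ∪ B z′)) (+-monoʳ-≤ _ (e-∪ (B z) S (B z′))))))
      (subst₂ _≤_ (cong (_+ (e (B z) S + e (B z) (B z′))) em) (tight z<)
        (spread₃ (B z) (B m) S (B z′)
          ((Disj-B z< m< z≢m , Disj-S {B z} (noS z<) , Disj-B z< z′< z≢z′ , tt) ,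
           (Disj-S {B m} (noS m<) , Disj-B m< z′< m≢z′ , tt) , ((λ v sv b → Disj-S {B z′} (noS z′<) v b sv) , tt) , tt , tt)))
      where
      N = B m ∪ S ∪ B z′
      Within : V → Set
      Within v = B z v ≡ true ⊎ N v ≡ true ⊎ ∃ λ A → A v ≡ true × e (B z) A ≡ 0
      place : ∀ {v i} → B i v ≡ true → i ≡ z ⊎ i ≡ m ⊎ i ≡ z′ ⊎ e (B z) (B i) ≡ 0 → Within v
      place b (inj₁ refl) = inj₁ b
      place b (inj₂ (inj₁ refl)) = inj₂ (inj₁ (∨-trueˡ b))
      place {v} b (inj₂ (inj₂ (inj₁ refl))) = inj₂ (inj₁ (∨-trueʳ {B m v} (∨-trueʳ {S v} b)))
      place {i = i} b (inj₂ (inj₂ (inj₂ none))) = inj₂ (inj₂ (B i , b , none))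
      within : ∀ v → Within v
      within v = decide (v ≟ s)
        where
        decide : Dec (v ≡ s) → Within v
        decide (yes v≡s) = inj₂ (inj₁ (∨-trueʳ {B m v} (∨-trueˡ (subst (λ w → S w ≡ true) (sym v≡s) (⁅⁆-self s)))))
        decide (no v≢s) = place {v} (proj₂ (proj₂ (cover v v≢s))) (others (proj₁ (proj₂ (cover v v≢s))))

    -- This makes the two cliques equal in size: subtracting from `k` the `p` edges to the neighbour
    -- and the edges between the two ends leaves the same number on both sides.
    ends-equal : e H₀ S ≡ e Hₗ S
    ends-equal = linear 6 (λ k p a b x y → k ≐ p ⊕ (a ⊕ x) ⇒ k ≐ p ⊕ (b ⊕ y) ⇒ x ≐ y ⇒ ⊢ a ≐ b)
      k p (e H₀ S) (e Hₗ S) (e (B 0) (B (2 + l))) (e (B (2 + l)) (B 0))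
      (end-degree 0< (mid< z≤n) last< (λ ()) (λ ()) (<⇒≢ (s≤s (s≤s z≤n))) e-first (λ i< → from-first (spot i<)))
      (subst (λ X → k ≡ p + (e X S + e (B (2 + l)) (B 0))) B-last
        (end-degree last< (mid< ≤-refl) 0< (>⇒≢ (n<1+n (suc l))) (λ ()) (λ ()) e-last (λ i< → from-last (spot i<))))
      (e-comm (B 0) (B (2 + l)))
      where
      from-first : ∀ {i} → Spot l i → i ≡ 0 ⊎ i ≡ 1 ⊎ i ≡ 2 + l ⊎ e (B 0) (B i) ≡ 0
      from-first first = inj₁ refl
      from-first last = inj₂ (inj₂ (inj₁ refl))
      from-first (inside {zero} _) = inj₂ (inj₁ refl)
      from-first (inside {suc i} i≤) = inj₂ (inj₂ (inj₂ (trans (e-comm (B 0) (B (2 + i)))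
        (middle-isolated i≤ (B 0) (Disj-B (mid< i≤) 0< (λ ())) (Disj-B (<⇒≤ (mid< i≤)) 0< (λ ()))
          (Disj-B (s≤s (s≤s (s≤s i≤))) 0< (λ ())) (λ v sv b → Disj-S {B 0} (noS 0<) v b sv)))))
      from-last : ∀ {i} → Spot l i → i ≡ 2 + l ⊎ i ≡ suc l ⊎ i ≡ 0 ⊎ e (B (2 + l)) (B i) ≡ 0
      from-last first = inj₂ (inj₂ (inj₁ refl))
      from-last last = inj₁ refl
      from-last (inside {i} i≤) with i ℕ.≟ l
      ... | yes refl = inj₂ (inj₁ refl)
      ... | no i≢l = inj₂ (inj₂ (inj₂ (trans (e-comm (B (2 + l)) (B (suc i)))
        (middle-isolated i≤ (B (2 + l)) (Disj-B (mid< i≤) last< (<⇒≢ (s≤s (s≤s i≤)))) (Disj-B (<⇒≤ (mid< i≤)) last< (<⇒≢ (s≤s (m≤n⇒m≤1+n i≤))))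
          (Disj-B (s≤s (s≤s (s≤s i≤))) last< (<⇒≢ (s≤s (s≤s (≤∧≢⇒< i≤ i≢l))))) (λ v sv b → Disj-S {B (2 + l)} (noS last<) v b sv)))))

    P Q : List (Fin d)
    P = tipsOf H₀
    Q = tipsOf Hₗ

    front-tip : ∀ {x} → x ∈ P → E 0 ∋ x × x ≢ c 0
    front-tip x∈ = F.private-tip (∈-tipsOf H₀ x∈)

    last-tip : ∀ {x} → x ∈ Q → E (suc l) ∋ x × x ≢ c l
    last-tip x∈ = back-tip (∈-tipsOf Hₗ x∈)

    spec : CliquesAndPath C P c l Q
    spec = record
      { C-sym = λ {x} {y} → C-sym {x} {y} ; irrefl = λ {x} → C-irrefl {x}
      ; PP = λ {x} {y} x∈ y∈ x≢y → ~⇒C {x} {y} x≢y (together (E 0) (isD (isLine z≤n)) (proj₁ (front-tip x∈)) (proj₁ (front-tip y∈)))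
      ; RR = λ {x} {y} x∈ y∈ x≢y → ~⇒C {x} {y} x≢y (together (E (suc l)) (isD (isLine ≤-refl)) (proj₁ (last-tip x∈)) (proj₁ (last-tip y∈)))
      ; PR = λ {x} {y} x∈ y∈ h → true≢false (frontClosed x y (proj₁ (front-tip x∈)) (proj₂ (front-tip x∈)) (C⇒~ {x} {y} h))
          (back-off-front (proj₁ (last-tip y∈)) (proj₂ (last-tip y∈)))
      ; Pc = λ {x} x∈ → ~⇒C {x} {c 0} (proj₂ (front-tip x∈)) (together (E 0) (isD (isLine z≤n)) (proj₁ (front-tip x∈)) (on-left z≤n))
      ; Pc′ = λ {x} {i} x∈ 1≤i i≤ h → F.front-apart {i} (proj₁ (front-tip x∈)) (proj₂ (front-tip x∈)) 1≤i i≤ (C⇒~ {x} {c i} h)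
      ; cR = λ {y} y∈ → ~⇒C {c l} {y} (≢-sym (proj₂ (last-tip y∈))) (together (E (suc l)) (isD (isLine ≤-refl)) (on-right ≤-refl) (proj₁ (last-tip y∈)))
      ; cR′ = λ {i} {y} i< y∈ h → back-apart {i} (proj₁ (last-tip y∈)) (proj₂ (last-tip y∈)) i< (~-sym (C⇒~ {c i} {y} h))
      ; cc = consecutive
      ; cc′ = λ {i} {j} i<j j≤ h → apart i<j j≤ (chain-neighbours (≤-trans (<⇒≤ (<⇒≤ i<j)) j≤) (C⇒~ {c i} {c j} h))
      }
      where
      apart : ∀ {i j} → suc i < j → j ≤ l → ¬ (E i ∋ c j ⊎ E (suc i) ∋ c j)
      apart i<j j≤ (inj₂ z∈) = far-right i<j j≤ z∈
      apart {suc i} i<j j≤ (inj₁ z∈) = far-left i<j j≤ z∈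
      apart {zero} {j} i<j j≤ (inj₁ z∈) = F.off-chain {j} z∈ (c≢ j≤ z≤n (>⇒≢ (<⇒≤ i<j))) j≤ refl

    path-cliques : TwoCliquesJoinedByPath d C
    path-cliques = twoCliques spec
      (Unique.++⁺ (tipsOf-unique H₀) (Unique.++⁺ chain-unique (tipsOf-unique Hₗ) chain∩Q) P∩rest)
      complete
      (trans (countᶠ-tip G s H₀ (∧-falseˡ E₀s)) (trans ends-equal (sym (countᶠ-tip G s Hₗ (∧-falseˡ Eₗs)))))
      where
      tipsOf-unique : ∀ A → Unique (tipsOf A)
      tipsOf-unique A = Unique.filter⁺ (T? ∘ A ∘ t) (Unique.allFin⁺ d)
      chain∩Q : ∀ {x} → x ∈ applyUpTo c (suc l) × x ∈ Q → ⊥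
      chain∩Q (x∈ , y∈) with ∈-applyUpTo⁻ c x∈
      ... | i , i< , eq = back-off-chain (proj₁ (last-tip y∈)) (proj₂ (last-tip y∈)) (s≤s⁻¹ i<) eq
      P∩rest : ∀ {x} → x ∈ P × x ∈ applyUpTo c (suc l) ++ Q → ⊥
      P∩rest (x∈ , y∈) with ∈-++⁻ (applyUpTo c (suc l)) y∈
      ... | inj₂ y∈Q = true≢false (proj₁ (front-tip x∈)) (back-off-front (proj₁ (last-tip y∈Q)) (proj₂ (last-tip y∈Q)))
      ... | inj₁ y∈c with ∈-applyUpTo⁻ c y∈c
      ...   | i , i< , eq = F.off-chain (proj₁ (front-tip x∈)) (proj₂ (front-tip x∈)) (s≤s⁻¹ i<) eq
      complete : ∀ x → x ∈ P ++ applyUpTo c (suc l) ++ Q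
      complete x with positioned x
      ... | atFront z∈ z≢ = ∈-++⁺ˡ (tipsOf-∈ H₀ (F.tip-private z∈ z≢))
      ... | onChain i i≤ refl = ∈-++⁺ʳ P (∈-++⁺ˡ (∈-applyUpTo⁺ c (s≤s i≤)))
      ... | atBack z∈ z≢ = ∈-++⁺ʳ P (∈-++⁺ʳ (applyUpTo c (suc l)) (tipsOf-∈ Hₗ (tip-back z∈ z≢)))

    path-structure : StructureClaim G s k (PathStructure G s) (IsolatedPlusBalancedBipartite d L)
    path-structure = structureClaim (PathStructure G s) p (3 + l) B noS disjoint cover
      (λ cond → 1≤p , m≤m+n 3 l , λ { (suc i) _ i< → cond (<⇒≤ i<) (<⇒≤ (<⇒≤ i<)) i<
        (trans (tight (<⇒≤ i<)) odd) (middle-tip (s≤s⁻¹ (s≤s⁻¹ (s≤s⁻¹ i<)))) (e-before (s≤s⁻¹ (s≤s⁻¹ (s≤s⁻¹ i<)))) (e-after (s≤s⁻¹ (s≤s⁻¹ (s≤s⁻¹ i<)))) })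
      (inj₁ (odd , λ i i< → ≤-reflexive (tight i<)))

-- Assembly of the three statements

module _ (G : Graph) (s : Fin (n G)) (k : ℕ) (loopless : Loopless G) (sk : SKEdgeConnected G s k)
  (2≤k : 2 ≤ k) (4<d : 4 < deg G s) where

  open SpecialCase G s k loopless sk 2≤k 4<d

  LiftingGraph-disconnected : Set
  LiftingGraph-disconnected = ¬ Connected d L → Odd d × IsolatedPlusBalancedBipartite d L

  LiftingGraph-even : Set
  LiftingGraph-even = Even k → CompleteMultipartite d L ⊎ IsolatedPlusBalancedBipartite d L

  LiftingGraph-structure : Set
  LiftingGraph-structure = Connected d C →
    (Odd k ⊎ IsolatedPlusBalancedBipartite d L) ×
    ((HamiltonCycle d C × StructureClaim G s k (CycleStructure G s) (IsolatedPlusBalancedBipartite d L)) ⊎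
     (TwoCliquesJoinedByPath d C × StructureClaim G s k (PathStructure G s) (IsolatedPlusBalancedBipartite d L)))

  special-case : Special → LiftingGraph-disconnected × LiftingGraph-even × LiftingGraph-structure
  special-case sp =
    (λ _ → degree-odd sp , isolatedPlusBipartite sp) ,
    (λ _ → inj₂ (isolatedPlusBipartite sp)) ,
    (λ _ → inj₂ (isolatedPlusBipartite sp) , inj₂ (cliques sp , structure sp))

  -- Here the lifting graph is connected, so (i) is vacuous. In (iii) the parity of `k` comes from
  -- the first two lines of the chain, which cross.
  general-case : ¬ Special → LiftingGraph-disconnected × LiftingGraph-even × LiftingGraph-structure
  general-case nonspecial =
    (λ disconnected → contradiction N.lifting-connected disconnected) ,
    (λ even → inj₁ (N.multipartite even)) ,
    (λ connected → [ cyclic connected , open-ended connected ]′ (N.Linked.chain (linked connected)))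
    where
    module N = NonspecialCase G s k loopless sk 2≤k 4<d nonspecial
    linked : Connected d C → ∀ x y → Star _~_ x y
    linked connected x y = Star.map (λ {x} {y} → C⇒~ {x} {y}) (connected x y)
    cyclic : Connected d C → N.Closing → _
    cyclic connected (l , q , cyc) = inj₁ (N.Sequence.p q , N.Sequence.odd q) ,
      inj₁ (N.Cycle.hamilton q cyc (linked connected) , N.Cycle.cycle-structure q cyc (linked connected))
    open-ended : Connected d C → N.Open → _
    open-ended connected (l , q , fc , bc) = inj₁ (N.Sequence.p q , N.Sequence.odd q) ,
      inj₂ (N.PathCase.path-cliques q fc bc (linked connected) , N.PathCase.path-structure q fc bc (linked connected))

theorem1p5 : (G : Graph) (s : Fin (n G)) (k : ℕ) →
    Loopless G → SKEdgeConnected G s k → 2 ≤ k → 4 < deg G s →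
    -- (i)
    (¬ Connected (deg G s) (LiftGraph G s k) →
       Odd (deg G s) × IsolatedPlusBalancedBipartite (deg G s) (LiftGraph G s k))
    ×
    -- (ii)
    (Even k →
       CompleteMultipartite (deg G s) (LiftGraph G s k)
       ⊎ IsolatedPlusBalancedBipartite (deg G s) (LiftGraph G s k))
    ×
    -- (iii)
    (Connected (deg G s) (Complement (deg G s) (LiftGraph G s k)) →
       (Odd k ⊎ IsolatedPlusBalancedBipartite (deg G s) (LiftGraph G s k)) ×
       ((HamiltonCycle (deg G s) (Complement (deg G s) (LiftGraph G s k)) ×
         StructureClaim G s k (CycleStructure G s)
           (IsolatedPlusBalancedBipartite (deg G s) (LiftGraph G s k)))
        ⊎
        (TwoCliquesJoinedByPath (deg G s) (Complement (deg G s) (LiftGraph G s k)) ×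
         StructureClaim G s k (PathStructure G s)
           (IsolatedPlusBalancedBipartite (deg G s) (LiftGraph G s k)))))
theorem1p5 G s k loopless sk 2≤k 4<d =
  [ special-case G s k loopless sk 2≤k 4<d , general-case G s k loopless sk 2≤k 4<d ]′
    (toSum (SpecialCase.special? G s k loopless sk 2≤k 4<d))
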